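{- \textsc{ReachFast} with any number of sources can be solved in polynomial time on temporal graphs whose underlying graph is a tree. That is, given such a temporal graph $\mathcal{G}$ and a set of sources $S$, one can compute in polynomial time a solution of minimum value.
   Context: A temporal graph $\mathcal{G}=\langle G,(E_1,\dots,E_{t_{\max}})\rangle$ consists of a static graph $G=(V,E)$ and edge sets $E_i\subseteq E$ with $E=\bigcup_i E_i$. An edge has label $i$ if it lies in $E_i$. A temporal path uses edges with strictly increasing labels, and its arrival time is its last label. $\mathrm{reachtime}(v,\mathcal{G})$ is the least $t$ such that $v$ reaches every vertex by a temporal path with arrival time at most $t$, and $\infty$ if some vertex is unreachable. Delaying a label $i$ by a positive integer $\delta$ replaces it by $i+\delta$, and the new label may exceed $t_{\max}$. A solution for sources $S$ is a temporal graph $\mathcal{G}'$ obtained by delaying any number of labels such that every source reaches every vertex. Its value is $\max_{v\in S}\mathrm{reachtime}(v,\mathcal{G}')$. -}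

module Defs where

open import Data.Bool using (Bool; true; false; T)
open import Data.Fin using (Fin; toℕ)
open import Data.Fin.Subset using (Subset; Empty) renaming (_∈_ to _∈ₛ_)
open import Data.List using (List; []; _∷_; _++_; length; map)
open import Data.List.Membership.Propositional using (_∈_)
open import Data.List.Relation.Unary.All using (All; []; _∷_; lookup)
open import Data.List.Relation.Unary.Linked using (Linked)
open import Data.List.Relation.Unary.Unique.Propositional using (Unique)
open import Data.Nat using (ℕ; suc; _+_; _*_; _∸_; _^_; _≤_; _<_; _≤ᵇ_)
open import Data.Nat.Logarithm using (⌊log₂_⌋)
open import Data.Product using (Σ; ∃-syntax; _×_; _,_; proj₁; proj₂)
open import Data.Sum using (_⊎_; inj₁; inj₂)
open import Data.Unit using (⊤; tt)
open import Function.Bundles using (_⇔_)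
open import Relation.Binary.Construct.Closure.ReflexiveTransitive using (Star)
open import Relation.Binary.PropositionalEquality using (_≡_)
open import Relation.Nullary using (¬_)

record Graph (n : ℕ) : Set where
  field
    edge   : Fin n → Fin n → Bool
    sym    : ∀ {u v} → T (edge u v) → T (edge v u)
    irrefl : ∀ {u} → ¬ T (edge u u)

  Adj : Fin n → Fin n → Set
  Adj u v = T (edge u v)

open Graph using (Adj)

Connected : ∀ {n} → Graph n → Set
Connected G = ∀ u v → Star (Adj G) u v

-- The cycle v, w₁, …, wₖ, v: at least three vertices, all distinct.
IsCycle : ∀ {n} → Graph n → Fin n → List (Fin n) → Set
IsCycle G v ws =
  2 ≤ length ws × Unique (v ∷ ws) × Linked (Adj G) (v ∷ ws ++ v ∷ [])

record IsTree {n : ℕ} (G : Graph n) : Set where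
  field
    nonempty  : 1 ≤ n
    connected : Connected G
    acyclic   : ∀ v ws → ¬ IsCycle G v ws

record TemporalGraph (n : ℕ) : Set where
  field
    underlying : Graph n
    tmax       : ℕ
    -- E i is the edge set with label 1 + toℕ i, so labels run over 1, …, tmax.
    E          : Fin tmax → Graph n
    E⊆         : ∀ i {u v} → Adj (E i) u v → Adj underlying u v
    ⊆⋃E        : ∀ {u v} → Adj underlying u v → ∃[ i ] Adj (E i) u v

  HasLabel : Fin n → Fin n → ℕ → Set
  HasLabel u v l = ∃[ i ] (l ≡ suc (toℕ i) × Adj (E i) u v)

open TemporalGraph using (underlying; tmax; HasLabel)

-- A step (l , w) traverses, at time l, an edge to w.
data Walk {n} (𝒢 : TemporalGraph n) : Fin n → List (ℕ × Fin n) → Fin n → Set where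
  []  : ∀ {u} → Walk 𝒢 u [] u
  _∷_ : ∀ {u v w l steps} →
        HasLabel 𝒢 u w l → Walk 𝒢 w steps v → Walk 𝒢 u ((l , w) ∷ steps) v

record IsTemporalPath {n} (𝒢 : TemporalGraph n)
                      (u : Fin n) (steps : List (ℕ × Fin n)) (v : Fin n) : Set where
  field
    walk       : Walk 𝒢 u steps v
    distinct   : Unique (u ∷ map proj₂ steps)
    increasing : Linked _<_ (map proj₁ steps)

-- The last label; the trivial path from a vertex to itself arrives at time 0.
arrival : ∀ {n} → List (ℕ × Fin n) → ℕ
arrival []                  = 0
arrival ((l , _) ∷ [])      = l
arrival (_ ∷ steps@(_ ∷ _)) = arrival steps

Reaches : ∀ {n} → TemporalGraph n → Fin n → Fin n → Set
Reaches 𝒢 u v = ∃[ steps ] IsTemporalPath 𝒢 u steps v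

ReachesBy : ∀ {n} → TemporalGraph n → ℕ → Fin n → Fin n → Set
ReachesBy 𝒢 t u v = ∃[ steps ] (IsTemporalPath 𝒢 u steps v × arrival steps ≤ t)

-- reachtime(v, 𝒢) = t for finite t; reachtime(v, 𝒢) = ∞ when no t qualifies.
IsReachtime : ∀ {n} → TemporalGraph n → Fin n → ℕ → Set
IsReachtime 𝒢 v t =
  (∀ w → ReachesBy 𝒢 t v w) ×
  (∀ t′ → (∀ w → ReachesBy 𝒢 t′ v w) → t ≤ t′)

-- Each label i of each edge uv is moved to i + δ u v i, where δ u v i = 0 means
-- that this label is left alone.
IsDelayOf : ∀ {n} → TemporalGraph n → TemporalGraph n → Set
IsDelayOf {n} 𝒢 𝒢′ =
  Σ (Fin n → Fin n → ℕ → ℕ) λ δ →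
    (∀ u v i → δ u v i ≡ δ v u i) ×
    (∀ u v j → HasLabel 𝒢′ u v j ⇔ (∃[ i ] (HasLabel 𝒢 u v i × j ≡ i + δ u v i)))

IsSolution : ∀ {n} → TemporalGraph n → Subset n → TemporalGraph n → Set
IsSolution 𝒢 S 𝒢′ = IsDelayOf 𝒢 𝒢′ × (∀ v → v ∈ₛ S → ∀ w → Reaches 𝒢′ v w)

-- max { reachtime(v, 𝒢) : v ∈ S } = k, the maximum over no sources being 0.
IsValue : ∀ {n} → TemporalGraph n → Subset n → ℕ → Set
IsValue 𝒢 S k =
  (∀ v → v ∈ₛ S → ∃[ t ] (IsReachtime 𝒢 v t × t ≤ k)) ×
  ((∃[ v ] (v ∈ₛ S × IsReachtime 𝒢 v k)) ⊎ (Empty S × k ≡ 0))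

IsMinimumSolution : ∀ {n} → TemporalGraph n → Subset n → TemporalGraph n → Set
IsMinimumSolution 𝒢 S 𝒢′ =
  IsSolution 𝒢 S 𝒢′ ×
  ∃[ k ] (IsValue 𝒢′ S k ×
          (∀ 𝒢″ k″ → IsSolution 𝒢 S 𝒢″ → IsValue 𝒢″ S k″ → k ≤ k″))

-- The model of computation is a Turing-complete first-order call-by-value language
-- with natural numbers, pairs, sums, lists and unbounded loops. Every evaluation
-- step costs one unit. The only arithmetic is +, ∸ and ≤, so one step lengthens
-- numbers by at most one bit, and compound data is only touched one constructor
-- at a time (hence can be held by reference); as for unit-cost RAMs without
-- multiplication, this time is polynomially related to Turing machine time.

infixr 7 _⊗_
infixr 6 _⊕_

data Ty : Set where
  unit bool nat : Ty
  _⊗_ _⊕_       : Ty → Ty → Ty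
  list          : Ty → Ty

⟦_⟧ : Ty → Set
⟦ unit ⟧   = ⊤
⟦ bool ⟧   = Bool
⟦ nat ⟧    = ℕ
⟦ σ ⊗ τ ⟧  = ⟦ σ ⟧ × ⟦ τ ⟧
⟦ σ ⊕ τ ⟧  = ⟦ σ ⟧ ⊎ ⟦ τ ⟧
⟦ list τ ⟧ = List ⟦ τ ⟧

-- Length of the encoding of a datum, with numbers written in binary.
size : (τ : Ty) → ⟦ τ ⟧ → ℕ
size unit     _        = 1
size bool     _        = 1
size nat      n        = suc ⌊log₂ n ⌋
size (σ ⊗ τ)  (x , y)  = size σ x + size τ y
size (σ ⊕ τ)  (inj₁ x) = suc (size σ x)
size (σ ⊕ τ)  (inj₂ y) = suc (size τ y)
size (list τ) []       = 1
size (list τ) (x ∷ xs) = suc (size τ x + size (list τ) xs)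

data Expr (Γ : List Ty) : Ty → Set where
  var        : ∀ {τ} → τ ∈ Γ → Expr Γ τ
  let′       : ∀ {σ τ} → Expr Γ σ → Expr (σ ∷ Γ) τ → Expr Γ τ
  call       : ∀ {σ τ} → Expr (σ ∷ []) τ → Expr Γ σ → Expr Γ τ
  unit       : Expr Γ unit
  num        : ℕ → Expr Γ nat
  add sub    : Expr Γ nat → Expr Γ nat → Expr Γ nat
  leq        : Expr Γ nat → Expr Γ nat → Expr Γ bool
  if         : ∀ {τ} → Expr Γ bool → Expr Γ τ → Expr Γ τ → Expr Γ τ
  pair       : ∀ {σ τ} → Expr Γ σ → Expr Γ τ → Expr Γ (σ ⊗ τ)
  fst        : ∀ {σ τ} → Expr Γ (σ ⊗ τ) → Expr Γ σ
  snd        : ∀ {σ τ} → Expr Γ (σ ⊗ τ) → Expr Γ τ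
  inl        : ∀ {σ τ} → Expr Γ σ → Expr Γ (σ ⊕ τ)
  inr        : ∀ {σ τ} → Expr Γ τ → Expr Γ (σ ⊕ τ)
  case       : ∀ {ρ σ τ} → Expr Γ (ρ ⊕ σ) → Expr (ρ ∷ Γ) τ → Expr (σ ∷ Γ) τ → Expr Γ τ
  nil        : ∀ {τ} → Expr Γ (list τ)
  cons       : ∀ {τ} → Expr Γ τ → Expr Γ (list τ) → Expr Γ (list τ)
  listcase   : ∀ {σ τ} → Expr Γ (list σ) → Expr Γ τ → Expr (σ ∷ list σ ∷ Γ) τ → Expr Γ τ
  -- loop e b starts in state e and runs b until it yields inj₂ of the result;
  -- inj₁ gives the next state.
  loop       : ∀ {σ τ} → Expr Γ σ → Expr (σ ∷ Γ) (σ ⊕ τ) → Expr Γ τ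

Env : List Ty → Set
Env = All ⟦_⟧

-- γ ⊢ e ⇓ v ∣ m: in environment γ, e evaluates to v in m steps.
-- γ ⊢ b from s ⇓ v ∣ m: the loop with body b entered in state s yields v in m steps.
infix 2 _⊢_⇓_∣_ _⊢_from_⇓_∣_

data _⊢_⇓_∣_ {Γ} (γ : Env Γ) : ∀ {τ} → Expr Γ τ → ⟦ τ ⟧ → ℕ → Set
data _⊢_from_⇓_∣_ {Γ} (γ : Env Γ) {σ τ} (b : Expr (σ ∷ Γ) (σ ⊕ τ)) :
  ⟦ σ ⟧ → ⟦ τ ⟧ → ℕ → Set

data _⊢_⇓_∣_ {Γ} γ where
  ⇓var  : ∀ {τ} {x : τ ∈ Γ} → γ ⊢ var x ⇓ lookup γ x ∣ 1
  ⇓let  : ∀ {σ τ} {e : Expr Γ σ} {f : Expr (σ ∷ Γ) τ} {x y j k} →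
          γ ⊢ e ⇓ x ∣ j → x ∷ γ ⊢ f ⇓ y ∣ k → γ ⊢ let′ e f ⇓ y ∣ suc (j + k)
  ⇓call : ∀ {σ τ} {f : Expr (σ ∷ []) τ} {e : Expr Γ σ} {x y j k} →
          γ ⊢ e ⇓ x ∣ j → x ∷ [] ⊢ f ⇓ y ∣ k → γ ⊢ call f e ⇓ y ∣ suc (j + k)
  ⇓unit : γ ⊢ unit ⇓ tt ∣ 1
  ⇓num  : ∀ {n} → γ ⊢ num n ⇓ n ∣ 1
  ⇓add  : ∀ {e f x y j k} →
          γ ⊢ e ⇓ x ∣ j → γ ⊢ f ⇓ y ∣ k → γ ⊢ add e f ⇓ x + y ∣ suc (j + k)
  ⇓sub  : ∀ {e f x y j k} →
          γ ⊢ e ⇓ x ∣ j → γ ⊢ f ⇓ y ∣ k → γ ⊢ sub e f ⇓ x ∸ y ∣ suc (j + k)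
  ⇓leq  : ∀ {e f x y j k} →
          γ ⊢ e ⇓ x ∣ j → γ ⊢ f ⇓ y ∣ k → γ ⊢ leq e f ⇓ (x ≤ᵇ y) ∣ suc (j + k)
  ⇓if-true  : ∀ {τ c} {e f : Expr Γ τ} {y j k} →
          γ ⊢ c ⇓ true ∣ j → γ ⊢ e ⇓ y ∣ k → γ ⊢ if c e f ⇓ y ∣ suc (j + k)
  ⇓if-false : ∀ {τ c} {e f : Expr Γ τ} {y j k} →
          γ ⊢ c ⇓ false ∣ j → γ ⊢ f ⇓ y ∣ k → γ ⊢ if c e f ⇓ y ∣ suc (j + k)
  ⇓pair : ∀ {σ τ} {e : Expr Γ σ} {f : Expr Γ τ} {x y j k} →
          γ ⊢ e ⇓ x ∣ j → γ ⊢ f ⇓ y ∣ k → γ ⊢ pair e f ⇓ (x , y) ∣ suc (j + k)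
  ⇓fst  : ∀ {σ τ} {e : Expr Γ (σ ⊗ τ)} {x y k} →
          γ ⊢ e ⇓ (x , y) ∣ k → γ ⊢ fst e ⇓ x ∣ suc k
  ⇓snd  : ∀ {σ τ} {e : Expr Γ (σ ⊗ τ)} {x y k} →
          γ ⊢ e ⇓ (x , y) ∣ k → γ ⊢ snd e ⇓ y ∣ suc k
  ⇓inl  : ∀ {σ τ} {e : Expr Γ σ} {x k} →
          γ ⊢ e ⇓ x ∣ k → γ ⊢ inl {τ = τ} e ⇓ inj₁ x ∣ suc k
  ⇓inr  : ∀ {σ τ} {e : Expr Γ τ} {x k} →
          γ ⊢ e ⇓ x ∣ k → γ ⊢ inr {σ = σ} e ⇓ inj₂ x ∣ suc k
  ⇓case-inl : ∀ {ρ σ τ} {e : Expr Γ (ρ ⊕ σ)} {f : Expr (ρ ∷ Γ) τ} {g : Expr (σ ∷ Γ) τ} {x y j k} →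
          γ ⊢ e ⇓ inj₁ x ∣ j → x ∷ γ ⊢ f ⇓ y ∣ k → γ ⊢ case e f g ⇓ y ∣ suc (j + k)
  ⇓case-inr : ∀ {ρ σ τ} {e : Expr Γ (ρ ⊕ σ)} {f : Expr (ρ ∷ Γ) τ} {g : Expr (σ ∷ Γ) τ} {x y j k} →
          γ ⊢ e ⇓ inj₂ x ∣ j → x ∷ γ ⊢ g ⇓ y ∣ k → γ ⊢ case e f g ⇓ y ∣ suc (j + k)
  ⇓nil  : ∀ {τ} → γ ⊢ nil {τ = τ} ⇓ [] ∣ 1
  ⇓cons : ∀ {τ} {e : Expr Γ τ} {f : Expr Γ (list τ)} {x xs j k} →
          γ ⊢ e ⇓ x ∣ j → γ ⊢ f ⇓ xs ∣ k → γ ⊢ cons e f ⇓ x ∷ xs ∣ suc (j + k)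
  ⇓listcase-nil : ∀ {σ τ} {e : Expr Γ (list σ)} {f : Expr Γ τ} {g y j k} →
          γ ⊢ e ⇓ [] ∣ j → γ ⊢ f ⇓ y ∣ k → γ ⊢ listcase e f g ⇓ y ∣ suc (j + k)
  ⇓listcase-cons : ∀ {σ τ} {e : Expr Γ (list σ)} {f : Expr Γ τ} {g x xs y j k} →
          γ ⊢ e ⇓ x ∷ xs ∣ j → x ∷ xs ∷ γ ⊢ g ⇓ y ∣ k →
          γ ⊢ listcase e f g ⇓ y ∣ suc (j + k)
  ⇓loop : ∀ {σ τ} {e : Expr Γ σ} {b : Expr (σ ∷ Γ) (σ ⊕ τ)} {s y j k} →
          γ ⊢ e ⇓ s ∣ j → γ ⊢ b from s ⇓ y ∣ k → γ ⊢ loop e b ⇓ y ∣ suc (j + k)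

data _⊢_from_⇓_∣_ {Γ} γ {σ} {τ} b where
  stop     : ∀ {s y k} →
             s ∷ γ ⊢ b ⇓ inj₂ y ∣ k → γ ⊢ b from s ⇓ y ∣ suc k
  continue : ∀ {s s′ y j k} →
             s ∷ γ ⊢ b ⇓ inj₁ s′ ∣ j → γ ⊢ b from s′ ⇓ y ∣ k →
             γ ⊢ b from s ⇓ y ∣ suc (j + k)

record Problem : Set₁ where
  field
    Instance     : Set
    input output : Ty
    Encodes      : ⟦ input ⟧ → Instance → Set
    Answers      : ⟦ output ⟧ → Instance → Set

-- One program, and one polynomial in the input length bounding its running
-- time, serve all encodings of all instances satisfying P.
PolynomialTimeOn : (Π : Problem) → (Problem.Instance Π → Set) → Set
PolynomialTimeOn Π P =
  Σ (Expr (input ∷ []) output) λ program → ∃[ c ] ∃[ d ]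
    (∀ (I : Instance) → P I → ∀ x → Encodes x I →
      ∃[ y ] ∃[ m ] ((x ∷ [] ⊢ program ⇓ y ∣ m) ×
                     m ≤ c * size input x ^ d + c ×
                     Answers y I))
  where open Problem Π

record ReachFastInstance : Set where
  field
    {n} : ℕ
    𝒢   : TemporalGraph n
    S   : Subset n

-- The number of vertices, tmax, and the triples (u , v , l) such that uv has label l.
temporalGraphTy : Ty
temporalGraphTy = nat ⊗ nat ⊗ list (nat ⊗ nat ⊗ nat)

-- The triples may come in any order, with the ends of an edge in either order,
-- and possibly repeated.
EncodesGraph : ∀ {n} → ⟦ temporalGraphTy ⟧ → TemporalGraph n → Set
EncodesGraph {n} (order , lifetime , triples) 𝒢 =
  order ≡ n ×
  lifetime ≡ tmax 𝒢 ×
  (∀ a b l → (a , b , l) ∈ triples →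
    ∃[ u ] ∃[ v ] (a ≡ toℕ u × b ≡ toℕ v × HasLabel 𝒢 u v l)) ×
  (∀ u v l → HasLabel 𝒢 u v l →
    (toℕ u , toℕ v , l) ∈ triples ⊎ (toℕ v , toℕ u , l) ∈ triples)

EncodesSources : ∀ {n} → ⟦ list nat ⟧ → Subset n → Set
EncodesSources xs S = ∀ a → a ∈ xs ⇔ (∃[ v ] (a ≡ toℕ v × v ∈ₛ S))

-- The answer inj₁ tt reports that there is no solution.
ReachFast : Problem
ReachFast = record
  { Instance = ReachFastInstance
  ; input    = temporalGraphTy ⊗ list nat
  ; output   = unit ⊕ temporalGraphTy
  ; Encodes  = λ { (g , xs) I → EncodesGraph g (𝒢 I) × EncodesSources xs (S I) }
  ; Answers  = λ { (inj₁ tt) I → ∀ 𝒢′ → ¬ IsSolution (𝒢 I) (S I) 𝒢′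
                 ; (inj₂ g)  I → ∃[ 𝒢′ ] (EncodesGraph g 𝒢′ × IsMinimumSolution (𝒢 I) (S I) 𝒢′) }
  }
  where open ReachFastInstance

OnTree : ReachFastInstance → Set
OnTree I = IsTree (underlying (ReachFastInstance.𝒢 I))

{-# OPTIONS --safe #-}

-- Since only the last arrival matters, all sources behind an edge may cross it
-- together, so a solution amounts to one crossing time for each edge and direction.
-- Let γ(z) be the time by which all sources have reached z, and let c minimise γ.
-- Away from c the values of γ increase strictly along the tree, except that a single
-- neighbour of c may tie with c. Hence information first rises to the centre (the
-- vertex c, or the tied edge, which both directions then cross at the same time) and
-- falls from it afterwards: below the centre the sources rise through the least label
-- of each edge, and everything falls through another label, the second least one if
-- the edge is also used for rising. Given the centre, the earliest such times are
-- computed greedily and bound those of every solution with that centre from below.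
-- So it suffices to try every vertex and every edge as the centre.
--
-- The program is written in a language of list folds over the given one. A fold runs
-- once through its list, and arithmetic has unit cost, so that the running time is
-- polynomial in any common bound on the lengths of the lists that are folded.
module Submission where

open import Defs
open import Data.Bool using (Bool; true; false; if_then_else_)
open import Data.Bool.Properties using (T?)
open import Data.Empty using (⊥-elim)
open import Data.Fin using (Fin; toℕ; fromℕ<) renaming (zero to fzero; suc to fsuc)
import Data.Fin.Properties as Fin
open import Data.Fin.Properties using (toℕ-injective; toℕ-fromℕ<; toℕ<n; any?)
open import Data.Fin.Subset using (Subset) renaming (_∈_ to _∈ₛ_)
open import Data.Fin.Subset.Properties using () renaming (_∈?_ to _∈ₛ?_)
open import Data.List using (List; []; _∷_; _++_; length; map)
open import Data.List.Membership.DecPropositional using () renaming (_∈?_ to decMember)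
open import Data.List.Membership.Propositional using (_∈_; _∉_)
open import Data.List.Membership.Propositional.Properties using (∈-++⁻)
open import Data.List.Properties using (∷ʳ-injectiveˡ; map-++)
open import Data.List.Relation.Unary.All as All using (All; []; _∷_; lookup)
open import Data.List.Relation.Unary.All.Properties using (¬Any⇒All¬; All¬⇒¬Any)
open import Data.List.Relation.Unary.AllPairs using ([]; _∷_)
open import Data.List.Relation.Unary.Any using (here; there)
open import Data.List.Relation.Unary.Linked using (Linked; []; [-]; _∷_)
open import Data.List.Relation.Unary.Unique.Propositional using (Unique)
open import Data.Nat
open import Data.Nat.Properties
open import Data.Product using (Σ; ∃-syntax; _×_; _,_; proj₁; proj₂)
open import Data.Sum as Sum using (_⊎_; inj₁; inj₂; [_,_]′; swap)
open import Data.Unit using (⊤; tt)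
open import Function using (_∘_; id)
open import Function.Bundles using (mk⇔; Equivalence)
open import Relation.Binary.Construct.Closure.ReflexiveTransitive using (Star; ε; _◅_)
open import Relation.Binary.PropositionalEquality using (_≡_; _≢_; refl; sym; trans; cong; subst; module ≡-Reasoning)
open import Relation.Nullary using (¬_; Dec; yes; no; Reflects; ofʸ; ofⁿ; contradiction)
open import Relation.Nullary.Decidable using (map′; _×-dec_; ¬?; _→-dec_; ⌊_⌋; toWitness; fromWitness)

open TemporalGraph using (underlying; tmax; E; HasLabel)

-- A language of folds

-- The growth of γ rests on the tree. A source on the side of p reaches w only across the edge pw,
-- and is at p strictly earlier, so γ(p) < γ(w) unless the latest source of p lies on the side of w.
-- Going outward, a latest source of w lying behind w would be at w before γ(c), against the choice
-- of c; so it comes from the centre, and passes w before anything further out. A tied edge has to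
-- be a centre of its own because labels are scarce. One label has one delay, so an edge crossed at
-- two different times needs two labels, and below a centre the times of rising and falling do
-- differ. On a tied edge both directions cross at γ(c) and one label is enough, whereas making one
-- of its ends a central vertex could demand two. The lower bound is local: each rise is compared
-- with the earliest arrival of a single source, each fall with γ. Times from which a vertex may be
-- left are arrivals plus one, so the minimised number `R` is one more than the bound on arrivals.
-- Labels are positive, which frees 0 to mean that there is no label or no source.

iter : ∀ {A B : Set} → (A → List A → B → B) → List A → B → B
iter f []       b = b
iter f (x ∷ xs) b = iter f xs (f x xs b)

-- The context of the body of a fold is the one in which the body of the compiled
-- loop runs: current element, remaining elements, and the whole loop state.
data Tm (Γ : List Ty) : Ty → Set where
  var     : ∀ {τ} → τ ∈ Γ → Tm Γ τ
  let′    : ∀ {σ τ} → Tm Γ σ → Tm (σ ∷ Γ) τ → Tm Γ τ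
  call    : ∀ {σ τ} → Tm (σ ∷ []) τ → Tm Γ σ → Tm Γ τ
  unit    : Tm Γ unit
  num     : ℕ → Tm Γ nat
  add sub : Tm Γ nat → Tm Γ nat → Tm Γ nat
  leq     : Tm Γ nat → Tm Γ nat → Tm Γ bool
  if      : ∀ {τ} → Tm Γ bool → Tm Γ τ → Tm Γ τ → Tm Γ τ
  pair    : ∀ {σ τ} → Tm Γ σ → Tm Γ τ → Tm Γ (σ ⊗ τ)
  fst     : ∀ {σ τ} → Tm Γ (σ ⊗ τ) → Tm Γ σ
  snd     : ∀ {σ τ} → Tm Γ (σ ⊗ τ) → Tm Γ τ
  inl     : ∀ {σ τ} → Tm Γ σ → Tm Γ (σ ⊕ τ)
  inr     : ∀ {σ τ} → Tm Γ τ → Tm Γ (σ ⊕ τ)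
  nil     : ∀ {τ} → Tm Γ (list τ)
  cons    : ∀ {τ} → Tm Γ τ → Tm Γ (list τ) → Tm Γ (list τ)
  fold    : ∀ {σ α} → Tm Γ (list σ) → Tm Γ α →
            Tm (σ ∷ list σ ∷ (list σ ⊗ α) ∷ Γ) α → Tm Γ α

den : ∀ {Γ τ} → Tm Γ τ → Env Γ → ⟦ τ ⟧
den (var x)      γ = lookup γ x
den (let′ e f)   γ = den f (den e γ ∷ γ)
den (call f e)   γ = den f (den e γ ∷ [])
den unit         γ = tt
den (num n)      γ = n
den (add e f)    γ = den e γ + den f γ
den (sub e f)    γ = den e γ ∸ den f γ
den (leq e f)    γ = den e γ ≤ᵇ den f γ
den (if c e f)   γ = if den c γ then den e γ else den f γ
den (pair e f)   γ = den e γ , den f γ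
den (fst e)      γ = proj₁ (den e γ)
den (snd e)      γ = proj₂ (den e γ)
den (inl e)      γ = inj₁ (den e γ)
den (inr e)      γ = inj₂ (den e γ)
den nil          γ = []
den (cons e f)   γ = den e γ ∷ den f γ
den (fold l i b) γ = iter (λ x xs a → den b (x ∷ xs ∷ (x ∷ xs , a) ∷ γ)) (den l γ) (den i γ)

compile : ∀ {Γ τ} → Tm Γ τ → Expr Γ τ
compile (var x)      = var x
compile (let′ e f)   = let′ (compile e) (compile f)
compile (call f e)   = call (compile f) (compile e)
compile unit         = unit
compile (num n)      = num n
compile (add e f)    = add (compile e) (compile f)
compile (sub e f)    = sub (compile e) (compile f)
compile (leq e f)    = leq (compile e) (compile f)
compile (if c e f)   = if (compile c) (compile e) (compile f)
compile (pair e f)   = pair (compile e) (compile f)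
compile (fst e)      = fst (compile e)
compile (snd e)      = snd (compile e)
compile (inl e)      = inl (compile e)
compile (inr e)      = inr (compile e)
compile nil          = nil
compile (cons e f)   = cons (compile e) (compile f)
compile (fold l i b) =
  loop (pair (compile l) (compile i))
       (listcase (fst (var (here refl)))
                 (inr (snd (var (here refl))))
                 (inl (pair (var (there (here refl))) (compile b))))

-- Exact cost of compiled terms

cost : ∀ {Γ τ} → Tm Γ τ → Env Γ → ℕ
foldCost : ∀ {Γ σ α} → Tm (σ ∷ list σ ∷ (list σ ⊗ α) ∷ Γ) α → Env Γ → List ⟦ σ ⟧ → ⟦ α ⟧ → ℕ

cost (var x)      γ = 1
cost (let′ e f)   γ = suc (cost e γ + cost f (den e γ ∷ γ))
cost (call f e)   γ = suc (cost e γ + cost f (den e γ ∷ []))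
cost unit         γ = 1
cost (num n)      γ = 1
cost (add e f)    γ = suc (cost e γ + cost f γ)
cost (sub e f)    γ = suc (cost e γ + cost f γ)
cost (leq e f)    γ = suc (cost e γ + cost f γ)
cost (if c e f)   γ = suc (cost c γ + (if den c γ then cost e γ else cost f γ))
cost (pair e f)   γ = suc (cost e γ + cost f γ)
cost (fst e)      γ = suc (cost e γ)
cost (snd e)      γ = suc (cost e γ)
cost (inl e)      γ = suc (cost e γ)
cost (inr e)      γ = suc (cost e γ)
cost nil          γ = 1
cost (cons e f)   γ = suc (cost e γ + cost f γ)
cost (fold l i b) γ = suc (suc (cost l γ + cost i γ) + foldCost b γ (den l γ) (den i γ))

-- The constants count the loop around `b`. The last round costs 1 for `stop`, 1 for `listcase`, 2
-- for its scrutinee and 3 for the result. Any other round costs 1 for `continue`, 1 and 2 again,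
-- and 3 for `inl`, `pair` and the rest of the list.
foldCost b γ []       a = 7
foldCost b γ (x ∷ xs) a =
  suc ((6 + cost b (x ∷ xs ∷ (x ∷ xs , a) ∷ γ)) +
       foldCost b γ xs (den b (x ∷ xs ∷ (x ∷ xs , a) ∷ γ)))

compile-⇓ : ∀ {Γ τ} (t : Tm Γ τ) (γ : Env Γ) → γ ⊢ compile t ⇓ den t γ ∣ cost t γ
compile-fold-⇓ : ∀ {Γ σ α} (b : Tm (σ ∷ list σ ∷ (list σ ⊗ α) ∷ Γ) α) (γ : Env Γ) xs a →
  γ ⊢ listcase (fst (var (here refl)))
               (inr (snd (var (here refl))))
               (inl (pair (var (there (here refl))) (compile b)))
      from (xs , a)
      ⇓ iter (λ x xs a → den b (x ∷ xs ∷ (x ∷ xs , a) ∷ γ)) xs a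
      ∣ foldCost b γ xs a

compile-⇓ (var x)      γ = ⇓var
compile-⇓ (let′ e f)   γ = ⇓let (compile-⇓ e γ) (compile-⇓ f _)
compile-⇓ (call f e)   γ = ⇓call (compile-⇓ e γ) (compile-⇓ f _)
compile-⇓ unit         γ = ⇓unit
compile-⇓ (num n)      γ = ⇓num
compile-⇓ (add e f)    γ = ⇓add (compile-⇓ e γ) (compile-⇓ f γ)
compile-⇓ (sub e f)    γ = ⇓sub (compile-⇓ e γ) (compile-⇓ f γ)
compile-⇓ (leq e f)    γ = ⇓leq (compile-⇓ e γ) (compile-⇓ f γ)
compile-⇓ (if c e f)   γ with den c γ | compile-⇓ c γ
... | true  | ⇓c = ⇓if-true ⇓c (compile-⇓ e γ)
... | false | ⇓c = ⇓if-false ⇓c (compile-⇓ f γ)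
compile-⇓ (pair e f)   γ = ⇓pair (compile-⇓ e γ) (compile-⇓ f γ)
compile-⇓ (fst e)      γ = ⇓fst (compile-⇓ e γ)
compile-⇓ (snd e)      γ = ⇓snd (compile-⇓ e γ)
compile-⇓ (inl e)      γ = ⇓inl (compile-⇓ e γ)
compile-⇓ (inr e)      γ = ⇓inr (compile-⇓ e γ)
compile-⇓ nil          γ = ⇓nil
compile-⇓ (cons e f)   γ = ⇓cons (compile-⇓ e γ) (compile-⇓ f γ)
compile-⇓ (fold l i b) γ =
  ⇓loop (⇓pair (compile-⇓ l γ) (compile-⇓ i γ)) (compile-fold-⇓ b γ (den l γ) (den i γ))

compile-fold-⇓ b γ []       a = stop (⇓listcase-nil (⇓fst ⇓var) (⇓inr (⇓snd ⇓var)))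
compile-fold-⇓ b γ (x ∷ xs) a =
  continue (⇓listcase-cons (⇓fst ⇓var) (⇓inl (⇓pair ⇓var (compile-⇓ b _))))
           (compile-fold-⇓ b γ xs _)

-- Folds in branches that are not taken are restricted as well.
Short : ∀ {Γ τ} → ℕ → Tm Γ τ → Env Γ → Set
ShortFold : ∀ {Γ σ α} → ℕ → Tm (σ ∷ list σ ∷ (list σ ⊗ α) ∷ Γ) α → Env Γ → List ⟦ σ ⟧ → ⟦ α ⟧ → Set

Short X (let′ e f)   γ = Short X e γ × Short X f (den e γ ∷ γ)
Short X (call f e)   γ = Short X e γ × Short X f (den e γ ∷ [])
Short X (add e f)    γ = Short X e γ × Short X f γ
Short X (sub e f)    γ = Short X e γ × Short X f γ
Short X (leq e f)    γ = Short X e γ × Short X f γ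
Short X (if c e f)   γ = Short X c γ × Short X e γ × Short X f γ
Short X (pair e f)   γ = Short X e γ × Short X f γ
Short X (fst e)      γ = Short X e γ
Short X (snd e)      γ = Short X e γ
Short X (inl e)      γ = Short X e γ
Short X (inr e)      γ = Short X e γ
Short X (cons e f)   γ = Short X e γ × Short X f γ
Short X (fold l i b) γ =
  Short X l γ × Short X i γ × length (den l γ) ≤ X × ShortFold X b γ (den l γ) (den i γ)
Short X (var _)      γ = ⊤
Short X unit         γ = ⊤
Short X (num _)      γ = ⊤
Short X nil          γ = ⊤

ShortFold X b γ []       a = ⊤
ShortFold X b γ (x ∷ xs) a =
  Short X b (x ∷ xs ∷ (x ∷ xs , a) ∷ γ) ×
  ShortFold X b γ xs (den b (x ∷ xs ∷ (x ∷ xs , a) ∷ γ))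

-- The bodies of some folds run further folds over the accumulator, so its length has to be
-- controlled. An invariant of the remaining list and the accumulator does this.
shortFold : ∀ {Γ σ α X} (b : Tm (σ ∷ list σ ∷ (list σ ⊗ α) ∷ Γ) α) (γ : Env Γ)
  (P : List ⟦ σ ⟧ → ⟦ α ⟧ → Set) →
  (∀ x xs a → P (x ∷ xs) a →
    Short X b (x ∷ xs ∷ (x ∷ xs , a) ∷ γ) × P xs (den b (x ∷ xs ∷ (x ∷ xs , a) ∷ γ))) →
  ∀ xs a → P xs a → ShortFold X b γ xs a
shortFold b γ P step []       a p = tt
shortFold b γ P step (x ∷ xs) a p with step x xs a p
... | s , p′ = s , shortFold b γ P step xs _ p′

-- Polynomials that bound the cost

infixl 6 _⊞_
infixl 7 _⊠_

data Pol : Set where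
  con     : ℕ → Pol
  arg     : Pol
  _⊞_ _⊠_ : Pol → Pol → Pol

eval : Pol → ℕ → ℕ
eval (con c) x = c
eval arg     x = x
eval (p ⊞ q) x = eval p x + eval q x
eval (p ⊠ q) x = eval p x * eval q x

bound : ∀ {Γ τ} → Tm Γ τ → Pol
bound (var x)      = con 1
bound (let′ e f)   = con 1 ⊞ (bound e ⊞ bound f)
bound (call f e)   = con 1 ⊞ (bound e ⊞ bound f)
bound unit         = con 1
bound (num n)      = con 1
bound (add e f)    = con 1 ⊞ (bound e ⊞ bound f)
bound (sub e f)    = con 1 ⊞ (bound e ⊞ bound f)
bound (leq e f)    = con 1 ⊞ (bound e ⊞ bound f)
bound (if c e f)   = con 1 ⊞ (bound c ⊞ (bound e ⊞ bound f))
bound (pair e f)   = con 1 ⊞ (bound e ⊞ bound f)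
bound (fst e)      = con 1 ⊞ bound e
bound (snd e)      = con 1 ⊞ bound e
bound (inl e)      = con 1 ⊞ bound e
bound (inr e)      = con 1 ⊞ bound e
bound nil          = con 1
bound (cons e f)   = con 1 ⊞ (bound e ⊞ bound f)
bound (fold l i b) = con 2 ⊞ (bound l ⊞ bound i) ⊞ (arg ⊠ (con 7 ⊞ bound b) ⊞ con 7)

cost≤bound : ∀ {Γ τ x} (t : Tm Γ τ) (γ : Env Γ) → Short x t γ → cost t γ ≤ eval (bound t) x
foldCost≤bound : ∀ {Γ σ α x} (b : Tm (σ ∷ list σ ∷ (list σ ⊗ α) ∷ Γ) α) (γ : Env Γ) xs a →
  ShortFold x b γ xs a → foldCost b γ xs a ≤ length xs * (7 + eval (bound b) x) + 7

cost≤bound (var x)      γ _ = ≤-refl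
cost≤bound (let′ e f)   γ (p , q) = s≤s (+-mono-≤ (cost≤bound e γ p) (cost≤bound f _ q))
cost≤bound (call f e)   γ (p , q) = s≤s (+-mono-≤ (cost≤bound e γ p) (cost≤bound f _ q))
cost≤bound unit         γ _ = ≤-refl
cost≤bound (num n)      γ _ = ≤-refl
cost≤bound (add e f)    γ (p , q) = s≤s (+-mono-≤ (cost≤bound e γ p) (cost≤bound f γ q))
cost≤bound (sub e f)    γ (p , q) = s≤s (+-mono-≤ (cost≤bound e γ p) (cost≤bound f γ q))
cost≤bound (leq e f)    γ (p , q) = s≤s (+-mono-≤ (cost≤bound e γ p) (cost≤bound f γ q))
cost≤bound (if c e f)   γ (p , q , r) with den c γ
... | true  = s≤s (+-mono-≤ (cost≤bound c γ p) (≤-trans (cost≤bound e γ q) (m≤m+n _ _)))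
... | false = s≤s (+-mono-≤ (cost≤bound c γ p) (≤-trans (cost≤bound f γ r) (m≤n+m _ _)))
cost≤bound (pair e f)   γ (p , q) = s≤s (+-mono-≤ (cost≤bound e γ p) (cost≤bound f γ q))
cost≤bound (fst e)      γ p = s≤s (cost≤bound e γ p)
cost≤bound (snd e)      γ p = s≤s (cost≤bound e γ p)
cost≤bound (inl e)      γ p = s≤s (cost≤bound e γ p)
cost≤bound (inr e)      γ p = s≤s (cost≤bound e γ p)
cost≤bound nil          γ _ = ≤-refl
cost≤bound (cons e f)   γ (p , q) = s≤s (+-mono-≤ (cost≤bound e γ p) (cost≤bound f γ q))
cost≤bound {x = x} (fold l i b) γ (p , q , len , r) = s≤s (s≤s (+-mono-≤
  (+-mono-≤ (cost≤bound l γ p) (cost≤bound i γ q))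
  (≤-trans (foldCost≤bound b γ (den l γ) (den i γ) r)
           (+-monoˡ-≤ 7 (*-monoˡ-≤ (7 + eval (bound b) x) len)))))

foldCost≤bound b γ [] a _ = ≤-refl
foldCost≤bound {x = n} b γ (x ∷ xs) a (s , r) = begin
  7 + cost b _ + foldCost b γ xs _
    ≤⟨ +-mono-≤ (+-monoʳ-≤ 7 (cost≤bound b _ s)) (foldCost≤bound b γ xs _ r) ⟩
  7 + eval (bound b) n + (length xs * (7 + eval (bound b) n) + 7)
    ≡⟨ +-assoc (7 + eval (bound b) n) (length xs * (7 + eval (bound b) n)) 7 ⟨
  (7 + eval (bound b) n) + length xs * (7 + eval (bound b) n) + 7 ∎
  where open ≤-Reasoning

degree : Pol → ℕ
degree (con c) = 0
degree arg     = 1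
degree (p ⊞ q) = degree p + degree q
degree (p ⊠ q) = degree p + degree q

height : Pol → ℕ
height (con c) = c
height arg     = 1
height (p ⊞ q) = height p + height q
height (p ⊠ q) = height p * height q

-- Both summands of `p ⊞ q` are padded to one common power, for which the sum of the degrees serves
-- as well as their maximum. Padding needs a positive argument: at 0 the bound fails for
-- `con 1 ⊞ arg`.
eval≤ : ∀ p x → eval p (suc x) ≤ height p * suc x ^ degree p
eval≤ (con c) x = ≤-reflexive (sym (*-identityʳ c))
eval≤ arg     x = ≤-reflexive (begin
  suc x               ≡⟨ *-identityʳ (suc x) ⟨
  suc x ^ 1           ≡⟨ *-identityˡ _ ⟨
  1 * suc x ^ 1       ∎)
  where open ≡-Reasoning
eval≤ (p ⊞ q) x = begin
  eval p (suc x) + eval q (suc x)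
    ≤⟨ +-mono-≤ (eval≤ p x) (eval≤ q x) ⟩
  height p * suc x ^ degree p + height q * suc x ^ degree q
    ≤⟨ +-mono-≤ (*-monoʳ-≤ (height p) (^-monoʳ-≤ (suc x) (m≤m+n (degree p) (degree q))))
                (*-monoʳ-≤ (height q) (^-monoʳ-≤ (suc x) (m≤n+m (degree q) (degree p)))) ⟩
  height p * suc x ^ (degree p + degree q) + height q * suc x ^ (degree p + degree q)
    ≡⟨ *-distribʳ-+ (suc x ^ (degree p + degree q)) (height p) (height q) ⟨
  (height p + height q) * suc x ^ (degree p + degree q) ∎
  where open ≤-Reasoning
eval≤ (p ⊠ q) x = begin
  eval p (suc x) * eval q (suc x)
    ≤⟨ *-mono-≤ (eval≤ p x) (eval≤ q x) ⟩
  (height p * suc x ^ degree p) * (height q * suc x ^ degree q)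
    ≡⟨ [m*n]*[o*p]≡[m*o]*[n*p] (height p) _ (height q) _ ⟩
  (height p * height q) * (suc x ^ degree p * suc x ^ degree q)
    ≡⟨ cong (height p * height q *_) (^-distribˡ-+-* (suc x) (degree p) (degree q)) ⟨
  (height p * height q) * suc x ^ (degree p + degree q) ∎
  where open ≤-Reasoning

-- The algorithm

-- A link is (child , parent); a rise adds the time at which the child's side crosses
-- to the parent, or 0 if it has no sources, and a fall also the time of the way back.
Triple Link Rise Fall : Set
Triple = ℕ × ℕ × ℕ
Link   = ℕ × ℕ
Rise   = ℕ × ℕ × ℕ
Fall   = ℕ × ℕ × ℕ × ℕ

tripleTy linkTy riseTy fallTy : Ty
tripleTy = nat ⊗ nat ⊗ nat
linkTy   = nat ⊗ nat
riseTy   = nat ⊗ nat ⊗ nat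
fallTy   = nat ⊗ nat ⊗ nat ⊗ nat

and or : Bool → Bool → Bool
and x y = if x then y else false
or x y  = if x then true else y

eq : ℕ → ℕ → Bool
eq a b = and (a ≤ᵇ b) (b ≤ᵇ a)

mx : ℕ → ℕ → ℕ
mx a b = a + (b ∸ a)

same : ℕ → ℕ → ℕ → ℕ → Bool
same w p a b = or (and (eq a w) (eq b p)) (and (eq a p) (eq b w))

opaque
  mem : ℕ → List ℕ → Bool
  mem a xs = iter (λ x _ r → or (eq x a) r) xs false

minAboveStep : ℕ → ℕ → ℕ → Triple → ℕ → ℕ
minAboveStep t w p (a , b , l) r =
  -- `r` stays 0 until a first label is accepted, so 0 gives way to any label.
  if and (same w p a b) (and (suc t ≤ᵇ l) (or (r ≤ᵇ 0) (l ≤ᵇ r))) then l else r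

-- The least label of the edge wp greater than t, or 0 if there is none.
opaque
  minAbove : List Triple → ℕ → ℕ → ℕ → ℕ
  minAbove T t w p = iter (λ e _ r → minAboveStep t w p e r) T 0

-- Discovered vertices, links with the latest first, and the
-- triples that have not yet been seen to touch a discovered vertex.
Search : Set
Search = List ℕ × List Link × List Triple

searchStep : Triple → Search → Search
searchStep (a , b , l) (D , L , P) =
  if mem a D
  then (if mem b D then (D , L , P) else (b ∷ D , (b , a) ∷ L , P))
  else (if mem b D then (a ∷ D , (a , b) ∷ L , P) else (D , L , (a , b , l) ∷ P))

sweep : Search → Search
sweep (D , L , P) = iter (λ e _ s → searchStep e s) P (D , L , [])

opaque
  -- One sweep per triple suffices: a sweep that drops no triple has met none that touches a
  -- discovered vertex, and then nothing is left to discover.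
  discover : List Triple → List ℕ → Search
  discover T B = iter (λ _ _ s → sweep s) T (B , [] , T)

opaque
  riseBelow : ℕ → List Rise → ℕ → ℕ
  riseBelow w U i =
    iter (λ e _ r → if and (eq (proj₁ (proj₂ e)) w) (1 ≤ᵇ proj₂ (proj₂ e))
                    then mx r (suc (proj₂ (proj₂ e))) else r) U i

-- The time at which the sources below w cross from w to its parent p, and 0 if
-- there are none; U contains the links discovered after w, hence all those below w.
riseTime : List Triple → List ℕ → ℕ → ℕ → List Rise → ℕ
riseTime T S w p U =
  let m = riseBelow w U (if mem w S then 1 else 0)
  in if 1 ≤ᵇ m then mx m (minAbove T 0 w p) else 0

-- The latest link comes first, so children are treated before their parents. Accumulation reverses
-- the order, and `falls` then meets parents before their children.
rises : List Triple → List ℕ → List Link → List Rise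
rises T S L = iter (λ e _ U → (proj₁ e , proj₂ e , riseTime T S (proj₁ e) (proj₂ e) U) ∷ U) L []

-- The initial 1 is the least possible label; it matters when nothing rises, as when the only source
-- is the centre.
gathered : List Rise → ℕ
gathered U = iter (λ e _ r → mx r (suc (proj₂ (proj₂ e)))) U 1

-- m is 0 for a central vertex, and the least label of a central edge.
start : ℕ → ℕ → ℕ
start m g = if 1 ≤ᵇ m then suc (mx m g) else g

opaque
  -- The initial `ρ` is for the base, whose vertices are children of no link. A vertex informed at
  -- `d` may be left from `suc d` on.
  ready : ℕ → List Fall → ℕ → ℕ
  ready ρ W p = iter (λ e _ r → if eq (proj₁ e) p then suc (proj₂ (proj₂ (proj₂ e))) else r) W ρ

fallMin : List Triple → Rise → ℕ
fallMin T (w , p , u) =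
  let m = minAbove T 0 w p in if 1 ≤ᵇ u then minAbove T m w p else m

Plan : Set
Plan = Bool × ℕ × List Fall

-- The plan fails when an edge has too few labels for the directions in which it is needed. `R`
-- strictly exceeds every fall.
fallStep : List Triple → ℕ → Rise → Plan → Plan
fallStep T ρ (w , p , u) (ok , R , W) =
  let m = fallMin T (w , p , u)
      d = mx m (ready ρ W p)
  in and ok (1 ≤ᵇ m) , mx R (suc d) , (w , p , u , d) ∷ W

falls : List Triple → ℕ → List Rise → Plan
falls T ρ U = iter (λ e _ s → fallStep T ρ e s) U (true , ρ , [])

-- Only the least label is spent on the rise. All others may be pushed to `d` or beyond, since just
-- one of them has to land on `d`, namely the one found by `fallMin`. With `u` equal to 0 that is
-- the least label itself.
fallLabel : List Triple → ℕ → Fall → ℕ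
fallLabel T l (w , p , u , d) = if and (1 ≤ᵇ u) (l ≤ᵇ minAbove T 0 w p) then u else mx l d

opaque
  newLabel : List Triple → ℕ → List Fall → ℕ → ℕ → ℕ → ℕ
  newLabel T ρ W a b l =
    iter (λ e _ r → if same (proj₁ e) (proj₁ (proj₂ e)) a b then fallLabel T l e else r)
         -- The default serves the central edge, which is not among the links of `W` and is crossed
         -- at `ρ ∸ 1`, one step before its ends may be left.
         W (mx l (ρ ∸ 1))

relabel : List Triple → ℕ → List Fall → List Triple
relabel T ρ W =
  iter (λ e _ r → (proj₁ e , proj₁ (proj₂ e) , newLabel T ρ W (proj₁ e) (proj₁ (proj₂ e)) (proj₂ (proj₂ e))) ∷ r) T []

Best : Set
Best = Bool × ℕ × List Triple

risesFrom : List Triple → List ℕ → List ℕ → List Rise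
risesFrom T S B = rises T S (proj₁ (proj₂ (discover T B)))

startFrom : List Triple → List ℕ → List ℕ → ℕ → ℕ
startFrom T S B m = start m (gathered (risesFrom T S B))

opaque
  plan : List Triple → List ℕ → List ℕ → ℕ → Plan
  plan T S B m = falls T (startFrom T S B m) (risesFrom T S B)

choose : List Triple → ℕ → Plan → Best → Best
choose T ρ π s =
  if and (proj₁ π) (if proj₁ s then suc (proj₁ (proj₂ π)) ≤ᵇ proj₁ (proj₂ s) else true)
  then (true , proj₁ (proj₂ π) , relabel T ρ (proj₂ (proj₂ π)))
  else s

opaque
  attempt : List Triple → List ℕ → List ℕ → ℕ → Best → Best
  attempt T S B m s = choose T (startFrom T S B m) (plan T S B m) s

attempts : List Triple → List ℕ → Triple → Best → Best
attempts T S (a , b , l) s =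
  attempt T S (a ∷ b ∷ []) (minAbove T 0 a b) (attempt T S (b ∷ []) 0 (attempt T S (a ∷ []) 0 s))

opaque
  -- Vertex 0 is tried separately because a tree with a single vertex has no triples.
  best : List Triple → List ℕ → Best
  best T S = iter (λ e _ s → attempts T S e s) T (attempt T S (0 ∷ []) 0 (false , 0 , []))

solve : ⟦ temporalGraphTy ⊗ list nat ⟧ → ⟦ unit ⊕ temporalGraphTy ⟧
solve ((n , t , T) , S) =
  -- The test holds if there is some source. Without sources the given graph is already optimal,
  -- with value 0.
  if iter (λ _ _ _ → true) S false
  then (let s = best T S in if proj₁ s then inj₂ (n , t + proj₁ (proj₂ s) , proj₂ (proj₂ s)) else inj₁ tt)
  else inj₂ (n , t , T)

-- The algorithm as a program

-- f! is a term that denotes the function f.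
v0 : ∀ {Γ a} → Tm (a ∷ Γ) a
v0 = var (here refl)

v1 : ∀ {Γ a b} → Tm (a ∷ b ∷ Γ) b
v1 = var (there (here refl))

v2 : ∀ {Γ a b c} → Tm (a ∷ b ∷ c ∷ Γ) c
v2 = var (there (there (here refl)))

v3 : ∀ {Γ a b c d} → Tm (a ∷ b ∷ c ∷ d ∷ Γ) d
v3 = var (there (there (there (here refl))))

v4 : ∀ {Γ a b c d e} → Tm (a ∷ b ∷ c ∷ d ∷ e ∷ Γ) e
v4 = var (there (there (there (there (here refl)))))

acc : ∀ {Γ a b c d} → Tm (a ∷ b ∷ (c ⊗ d) ∷ Γ) d
acc = snd v2

yes! no! : ∀ {Γ} → Tm Γ bool
yes! = leq (num 0) (num 0)
no!  = leq (num 1) (num 0)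

and! or! : ∀ {Γ} → Tm Γ bool → Tm Γ bool → Tm Γ bool
and! x y = if x y no!
or! x y  = if x yes! y

-- Helpers are closed up to one argument and entered through `call`, so that denotation and fold
-- lengths of each are settled once, whatever the environment of the caller.
eq! : Tm (nat ⊗ nat ∷ []) bool
eq! = and! (leq (fst v0) (snd v0)) (leq (snd v0) (fst v0))

mx! : Tm (nat ⊗ nat ∷ []) nat
mx! = add (fst v0) (sub (snd v0) (fst v0))

same! : Tm (nat ⊗ nat ⊗ nat ⊗ nat ∷ []) bool
same! = let′ (fst v0) (let′ (fst (snd v1)) (let′ (fst (snd (snd v2))) (let′ (snd (snd (snd v3)))
  (or! (and! (call eq! (pair v1 v3)) (call eq! (pair v0 v2)))
       (and! (call eq! (pair v1 v2)) (call eq! (pair v0 v3)))))))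

mem! : Tm (nat ⊗ list nat ∷ []) bool
mem! = fold (snd v0) no! (or! (call eq! (pair v0 (fst v3))) acc)

short-mem : ∀ {X} a xs → length xs ≤ X → Short X mem! ((a , xs) ∷ [])
short-mem a xs h = _ , _ , h , shortFold _ _ (λ _ _ → ⊤) (λ _ _ _ _ → _ , _) xs _ _

minAbove! : Tm (list tripleTy ⊗ nat ⊗ nat ⊗ nat ∷ []) nat
minAbove! = fold (fst v0) (num 0)
  (if (and! (call same! (pair (fst (snd (snd v3))) (pair (snd (snd (snd v3))) (pair (fst v0) (fst (snd v0))))))
            (and! (leq (add (num 1) (fst (snd v3))) (snd (snd v0)))
                  (or! (leq acc (num 0)) (leq (snd (snd v0)) acc))))
      (snd (snd v0)) acc)

short-minAbove : ∀ {X} T t w p → length T ≤ X → Short X minAbove! ((T , t , w , p) ∷ [])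
short-minAbove T t w p h = _ , _ , h , shortFold _ _ (λ _ _ → ⊤) (λ _ _ _ _ → _ , _) T _ _

searchTy : Ty
searchTy = list nat ⊗ list linkTy ⊗ list tripleTy

searchStep! : Tm (tripleTy ⊗ searchTy ∷ []) searchTy
searchStep! = let′ (fst (fst v0)) (let′ (fst (snd (fst v1))) (let′ (snd v2)
  (if (call mem! (pair v2 (fst v0)))
      (if (call mem! (pair v1 (fst v0))) v0
          (pair (cons v1 (fst v0)) (pair (cons (pair v1 v2) (fst (snd v0))) (snd (snd v0)))))
      (if (call mem! (pair v1 (fst v0)))
          (pair (cons v2 (fst v0)) (pair (cons (pair v2 v1) (fst (snd v0))) (snd (snd v0))))
          (pair (fst v0) (pair (fst (snd v0)) (cons (fst v3) (snd (snd v0)))))))))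

-- `k` counts the triples of the running sweep that are still to be inspected. Each of them turns
-- into a discovered vertex, becomes pending again or is dropped, so the sum never grows beyond the
-- sizes of the base and of `T`.
Fits : ℕ → ℕ → Search → Set
Fits X k (D , L , P) = length D + length P + k ≤ X × length L ≤ length D

searchStep-fits : ∀ {X k} e s → Fits X (suc k) s → Fits X k (searchStep e s)
searchStep-fits {X} {k} (a , b , l) (D , L , P) (h , h′) with mem a D | mem b D
... | true  | true  = ≤-trans (+-monoʳ-≤ (length D + length P) (n≤1+n k)) h , h′
... | true  | false = ≤-trans (≤-reflexive (sym (+-suc (length D + length P) k))) h , s≤s h′
... | false | true  = ≤-trans (≤-reflexive (sym (+-suc (length D + length P) k))) h , s≤s h′
... | false | false = ≤-trans (≤-reflexive (begin
  length D + suc (length P) + k  ≡⟨ cong (_+ k) (+-suc (length D) (length P)) ⟩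
  suc (length D + length P + k)  ≡⟨ +-suc (length D + length P) k ⟨
  length D + length P + suc k    ∎)) h , h′
  where open ≡-Reasoning

short-searchStep : ∀ {X} e s → length (proj₁ s) ≤ X → Short X searchStep! ((e , s) ∷ [])
short-searchStep (a , b , _) (D , _) h =
  _ , _ , _ , (_ , short-mem a D h) , ((_ , short-mem b D h) , _ , _) , ((_ , short-mem b D h) , _ , _)

sweep-fits : ∀ {X k} s → Fits X k s → Fits X k (sweep s)
sweep-fits {X} {k} (D , L , P) (h , h′) =
  go P (D , L , []) (subst (_≤ X) (shift (length D) (length P) k) h , h′)
  where
  shift : ∀ d p k → d + p + k ≡ d + 0 + (p + k)
  shift d p k rewrite +-identityʳ d = +-assoc d p k
  go : ∀ P s → Fits X (length P + k) s → Fits X k (iter (λ e _ s → searchStep e s) P s)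
  go []      s h = h
  go (e ∷ P) s h = go P (searchStep e s) (searchStep-fits e s h)

sweep! : Tm (searchTy ∷ []) searchTy
sweep! = fold (snd (snd v0)) (pair (fst v0) (pair (fst (snd v0)) nil))
  (call searchStep! (pair v0 acc))

opaque
  unfolding mem

  short-sweep : ∀ {X} s → Fits X 0 s → Short X sweep! (s ∷ [])
  short-sweep {X} (D , L , P) (h , h′) =
    _ , _ , ≤-trans (m≤n+m (length P) (length D)) h₁ ,
    shortFold _ _ (λ P s → Fits X (length P) s)
      (λ e P s f → (_ , short-searchStep e s (≤-trans (m≤m+n _ _) (≤-trans (m≤m+n _ _) (proj₁ f)))) ,
                   searchStep-fits e s f)
      P (D , L , []) (subst (λ d → d + length P ≤ X) (sym (+-identityʳ (length D))) h₁ , h′)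
    where
    h₁ : length D + length P ≤ X
    h₁ = ≤-trans (m≤m+n _ 0) h

opaque
  unfolding discover

  discover-fits : ∀ {X} T B → length B + length T ≤ X → Fits X 0 (discover T B)
  discover-fits {X} T B h = go T (B , [] , T) (subst (_≤ X) (sym (+-identityʳ _)) h , z≤n)
    where
    go : ∀ (C : List Triple) s → Fits X 0 s → Fits X 0 (iter (λ _ _ s → sweep s) C s)
    go []      s f = f
    go (_ ∷ C) s f = go C (sweep s) (sweep-fits s f)

opaque
  unfolding mem minAbove riseBelow ready newLabel discover plan attempt best

  discover! : Tm (list tripleTy ⊗ list nat ∷ []) searchTy
  discover! = fold (fst v0) (pair (snd v0) (pair nil (fst v0))) (call sweep! acc)

  den-discover : ∀ T B → den discover! ((T , B) ∷ []) ≡ discover T B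
  den-discover T B = refl

  short-discover : ∀ {X} T B → length B + length T ≤ X → Short X discover! ((T , B) ∷ [])
  short-discover {X} T B h =
    _ , _ , ≤-trans (m≤n+m (length T) (length B)) h ,
    shortFold _ _ (λ _ s → Fits X 0 s) (λ _ _ s f → (_ , short-sweep s f) , sweep-fits s f)
      T _ (subst (_≤ X) (sym (+-identityʳ _)) h , z≤n)

riseBelow! : Tm (nat ⊗ list riseTy ⊗ nat ∷ []) nat
riseBelow! = fold (fst (snd v0)) (snd (snd v0))
  (if (and! (call eq! (pair (fst (snd v0)) (fst v3))) (leq (num 1) (snd (snd v0))))
      (call mx! (pair acc (add (num 1) (snd (snd v0))))) acc)

riseTime! : Tm (list tripleTy ⊗ list nat ⊗ nat ⊗ nat ⊗ list riseTy ∷ []) nat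
riseTime! = let′ (fst (snd (snd v0))) (let′
  (call riseBelow! (pair v0 (pair (snd (snd (snd (snd v1))))
    (if (call mem! (pair v0 (fst (snd v1)))) (num 1) (num 0)))))
  (if (leq (num 1) v0)
      (call mx! (pair v0 (call minAbove! (pair (fst v2) (pair (num 0) (pair v1 (fst (snd (snd (snd v2))))))))))
      (num 0)))

short-riseTime : ∀ {X} T S w p U → length T ≤ X → length S ≤ X → length U ≤ X →
  Short X riseTime! ((T , S , w , p , U) ∷ [])
short-riseTime T S w p U hT hS hU =
  _ ,
  ((_ , _ , (_ , short-mem w S hS) , _ , _) ,
   (_ , _ , hU , shortFold _ _ (λ _ _ → ⊤) (λ _ _ _ _ → _ , _) U _ _)) ,
  (_ , ((_ , (_ , short-minAbove T 0 w p hT)) , _) , _)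

rises-length : ∀ T S L → length (rises T S L) ≡ length L
rises-length T S L = trans (go L []) (+-identityʳ (length L))
  where
  go : ∀ L U → length (iter (λ e _ U → (proj₁ e , proj₂ e , riseTime T S (proj₁ e) (proj₂ e) U) ∷ U) L U)
             ≡ length L + length U
  go []      U = refl
  go (_ ∷ L) U = trans (go L _) (+-suc (length L) (length U))

opaque
  unfolding mem minAbove riseBelow ready newLabel discover plan attempt best

  rises! : Tm (list tripleTy ⊗ list nat ⊗ list linkTy ∷ []) (list riseTy)
  rises! = fold (snd (snd v0)) nil
    (cons (pair (fst v0) (pair (snd v0)
            (call riseTime! (pair (fst v3) (pair (fst (snd v3)) (pair (fst v0) (pair (snd v0) acc)))))))
          acc)

  den-rises : ∀ T S L → den rises! ((T , S , L) ∷ []) ≡ rises T S L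
  den-rises T S L = refl

  short-rises : ∀ {X} T S L → length T ≤ X → length S ≤ X → length L ≤ X →
    Short X rises! ((T , S , L) ∷ [])
  short-rises {X} T S L hT hS hL =
    _ , _ , hL ,
    shortFold _ _ (λ L U → length L + length U ≤ X)
      (λ e L U h → ((_ , _ , _ , short-riseTime T S _ _ U hT hS
                      (≤-trans (m≤n+m _ (length L)) (≤-trans (n≤1+n _) h))) , _) ,
                   ≤-trans (≤-reflexive (+-suc (length L) (length U))) h)
      L [] (≤-trans (≤-reflexive (+-identityʳ _)) hL)

opaque
  unfolding mem minAbove riseBelow ready newLabel discover plan attempt best

  gathered! : Tm (list riseTy ∷ []) nat
  gathered! = fold v0 (num 1) (call mx! (pair acc (add (num 1) (snd (snd v0)))))

  den-gathered : ∀ U → den gathered! (U ∷ []) ≡ gathered U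
  den-gathered U = refl

  short-gathered : ∀ {X} U → length U ≤ X → Short X gathered! (U ∷ [])
  short-gathered U h = _ , _ , h , shortFold _ _ (λ _ _ → ⊤) (λ _ _ _ _ → _ , _) U _ _

start! : Tm (nat ⊗ nat ∷ []) nat
start! = if (leq (num 1) (fst v0)) (add (num 1) (call mx! v0)) (snd v0)

ready! : Tm (nat ⊗ list fallTy ⊗ nat ∷ []) nat
ready! = fold (fst (snd v0)) (fst v0)
  (if (call eq! (pair (fst v0) (snd (snd v3)))) (add (num 1) (snd (snd (snd v0)))) acc)

fallMin! : Tm (list tripleTy ⊗ riseTy ∷ []) nat
fallMin! = let′ (call minAbove! (pair (fst v0) (pair (num 0) (pair (fst (snd v0)) (fst (snd (snd v0)))))))
  (if (leq (num 1) (snd (snd (snd v1))))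
      (call minAbove! (pair (fst v1) (pair v0 (pair (fst (snd v1)) (fst (snd (snd v1)))))))
      v0)

planTy : Ty
planTy = bool ⊗ nat ⊗ list fallTy

fallStep! : Tm (list tripleTy ⊗ nat ⊗ riseTy ⊗ planTy ∷ []) planTy
fallStep! = let′ (fst (snd (snd v0))) (let′ (snd (snd (snd v1)))
  (let′ (call fallMin! (pair (fst v2) v1))
  (let′ (call mx! (pair v0 (call ready! (pair (fst (snd v3)) (pair (snd (snd v1)) (fst (snd v2)))))))
  (pair (and! (fst v2) (leq (num 1) v1))
  (pair (call mx! (pair (fst (snd v2)) (add (num 1) v0)))
        (cons (pair (fst v3) (pair (fst (snd v3)) (pair (snd (snd v3)) v0))) (snd (snd v2))))))))

short-fallStep : ∀ {X} T ρ e s → length T ≤ X → length (proj₂ (proj₂ s)) ≤ X →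
  Short X fallStep! ((T , ρ , e , s) ∷ [])
short-fallStep T ρ (w , p , u) (ok , R , W) hT hW =
  _ , _ ,
  (_ , ((_ , short-minAbove T 0 w p hT) , _ , (_ , short-minAbove T _ w p hT) , _)) ,
  ((_ , _ , (_ , _ , hW , shortFold _ _ (λ _ _ → ⊤) (λ _ _ _ _ → _ , _) W _ _)) , _) ,
  _

falls-length : ∀ T ρ U → length (proj₂ (proj₂ (falls T ρ U))) ≡ length U
falls-length T ρ U = trans (go U (true , ρ , [])) (+-identityʳ (length U))
  where
  go : ∀ U s → length (proj₂ (proj₂ (iter (λ e _ s → fallStep T ρ e s) U s)))
             ≡ length U + length (proj₂ (proj₂ s))
  go []      s = refl
  go (e ∷ U) s = trans (go U (fallStep T ρ e s)) (+-suc (length U) _)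

opaque
  unfolding mem minAbove riseBelow ready newLabel discover plan attempt best

  falls! : Tm (list tripleTy ⊗ nat ⊗ list riseTy ∷ []) planTy
  falls! = fold (snd (snd v0)) (pair yes! (pair (fst (snd v0)) nil))
    (call fallStep! (pair (fst v3) (pair (fst (snd v3)) (pair v0 acc))))

  den-falls : ∀ T ρ U → den falls! ((T , ρ , U) ∷ []) ≡ falls T ρ U
  den-falls T ρ U = refl

  short-falls : ∀ {X} T ρ U → length T ≤ X → length U ≤ X → Short X falls! ((T , ρ , U) ∷ [])
  short-falls {X} T ρ U hT hU =
    _ , _ , hU ,
    shortFold _ _ (λ U s → length U + length (proj₂ (proj₂ s)) ≤ X)
      (λ e U s h → (_ , short-fallStep T ρ e s hT
                      (≤-trans (m≤n+m _ (length U)) (≤-trans (n≤1+n _) h))) ,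
                   ≤-trans (≤-reflexive (+-suc (length U) _)) h)
      U _ (≤-trans (≤-reflexive (+-identityʳ _)) hU)

fallLabel! : Tm (list tripleTy ⊗ nat ⊗ fallTy ∷ []) nat
fallLabel! = let′ (fst (snd v0)) (let′ (snd (snd v1))
  (if (and! (leq (num 1) (fst (snd (snd v0))))
            (leq v1 (call minAbove! (pair (fst v2) (pair (num 0) (pair (fst v0) (fst (snd v0))))))))
      (fst (snd (snd v0)))
      (call mx! (pair v1 (snd (snd (snd v0)))))))

newLabel! : Tm (list tripleTy ⊗ nat ⊗ list fallTy ⊗ tripleTy ∷ []) nat
newLabel! = let′ (snd (snd (snd v0)))
  (fold (fst (snd (snd v1))) (call mx! (pair (snd (snd v0)) (sub (fst (snd v1)) (num 1))))
    (if (call same! (pair (fst v0) (pair (fst (snd v0)) (pair (fst v3) (fst (snd v3))))))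
        (call fallLabel! (pair (fst v4) (pair (snd (snd v3)) v0)))
        acc))

short-fallLabel : ∀ {X} T l e → length T ≤ X → Short X fallLabel! ((T , l , e) ∷ [])
short-fallLabel T l (w , p , u , d) hT =
  _ , _ , (_ , (_ , (_ , short-minAbove T 0 w p hT)) , _) , _

short-newLabel : ∀ {X} T ρ W e → length T ≤ X → length W ≤ X →
  Short X newLabel! ((T , ρ , W , e) ∷ [])
short-newLabel T ρ W e hT hW =
  _ , _ , _ , hW ,
  shortFold _ _ (λ _ _ → ⊤)
    (λ f _ _ _ → (_ , (_ , short-fallLabel T (proj₂ (proj₂ e)) f hT) , _) , _)
    W _ _

opaque
  unfolding mem minAbove riseBelow ready newLabel discover plan attempt best

  relabel! : Tm (list tripleTy ⊗ nat ⊗ list fallTy ∷ []) (list tripleTy)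
  relabel! = fold (fst v0) nil
    (cons (pair (fst v0) (pair (fst (snd v0))
            (call newLabel! (pair (fst v3) (pair (fst (snd v3)) (pair (snd (snd v3)) v0))))))
          acc)

  den-relabel : ∀ T ρ W → den relabel! ((T , ρ , W) ∷ []) ≡ relabel T ρ W
  den-relabel T ρ W = refl

  short-relabel : ∀ {X} T ρ W → length T ≤ X → length W ≤ X → Short X relabel! ((T , ρ , W) ∷ [])
  short-relabel T ρ W hT hW =
    _ , _ , hT ,
    shortFold _ _ (λ _ _ → ⊤)
      (λ e _ _ _ → ((_ , _ , _ , short-newLabel T ρ W e hT hW) , _) , _)
      T _ _

bestTy : Ty
bestTy = bool ⊗ nat ⊗ list tripleTy

taskTy : Ty
taskTy = list tripleTy ⊗ list nat

opaque
  unfolding mem minAbove riseBelow ready newLabel discover plan attempt best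

  choose! : Tm (list tripleTy ⊗ nat ⊗ planTy ⊗ bestTy ∷ []) bestTy
  choose! = let′ (fst (snd (snd v0))) (let′ (snd (snd (snd v1)))
    (if (and! (fst v1) (if (fst v0) (leq (add (num 1) (fst (snd v1))) (fst (snd v0))) yes!))
        (pair yes! (pair (fst (snd v1)) (call relabel! (pair (fst v2) (pair (fst (snd v2)) (snd (snd v1)))))))
        v0))

  den-choose : ∀ T ρ π s → den choose! ((T , ρ , π , s) ∷ []) ≡ choose T ρ π s
  den-choose T ρ π s =
    cong (λ r → if and (proj₁ π) (if proj₁ s then suc (proj₁ (proj₂ π)) ≤ᵇ proj₁ (proj₂ s) else true)
                then (true , proj₁ (proj₂ π) , r) else s)
         (den-relabel T ρ (proj₂ (proj₂ π)))

  short-choose : ∀ {X} T ρ π s → length T ≤ X → length (proj₂ (proj₂ π)) ≤ X →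
    Short X choose! ((T , ρ , π , s) ∷ [])
  short-choose T ρ π s hT hW = _ , _ , _ , (_ , _ , (_ , short-relabel T ρ _ hT hW)) , _

opaque
  unfolding mem minAbove riseBelow ready newLabel discover plan attempt best

  schedule! : Tm (list tripleTy ⊗ nat ⊗ list riseTy ⊗ bestTy ∷ []) bestTy
  schedule! = call choose! (pair (fst v0) (pair (fst (snd v0))
    (pair (call falls! (pair (fst v0) (pair (fst (snd v0)) (fst (snd (snd v0)))))) (snd (snd (snd v0))))))

  den-schedule : ∀ T ρ U s → den schedule! ((T , ρ , U , s) ∷ []) ≡ choose T ρ (falls T ρ U) s
  den-schedule T ρ U s =
    trans (cong (λ π → den choose! ((T , ρ , π , s) ∷ [])) (den-falls T ρ U))
          (den-choose T ρ (falls T ρ U) s)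

  short-schedule : ∀ {X} T ρ U s → length T ≤ X → length U ≤ X →
    Short X schedule! ((T , ρ , U , s) ∷ [])
  short-schedule {X} T ρ U s hT hU =
    (_ , _ , (_ , short-falls T ρ U hT hU) , _) ,
    subst (λ π → Short X choose! ((T , ρ , π , s) ∷ [])) (sym (den-falls T ρ U))
      (short-choose T ρ (falls T ρ U) s hT (≤-trans (≤-reflexive (falls-length T ρ U)) hU))

opaque
  unfolding mem minAbove riseBelow ready newLabel discover plan attempt best

  risesFrom! : Tm (taskTy ⊗ list nat ∷ []) (list riseTy)
  risesFrom! = call rises! (pair (fst (fst v0)) (pair (snd (fst v0))
    (fst (snd (call discover! (pair (fst (fst v0)) (snd v0)))))))

  den-risesFrom : ∀ T S B → den risesFrom! (((T , S) , B) ∷ []) ≡ risesFrom T S B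
  den-risesFrom T S B =
    trans (cong (λ s → den rises! ((T , S , proj₁ (proj₂ s)) ∷ [])) (den-discover T B))
          (den-rises T S (proj₁ (proj₂ (discover T B))))

  links-length : ∀ {X} T B → length B + length T ≤ X → length (proj₁ (proj₂ (discover T B))) ≤ X
  links-length T B hT with discover T B | discover-fits T B hT
  ... | D , L , P | h , h′ = ≤-trans h′ (≤-trans (m≤m+n _ _) (≤-trans (m≤m+n _ _) h))

  risesFrom-length : ∀ {X} T S B → length B + length T ≤ X → length (risesFrom T S B) ≤ X
  risesFrom-length T S B hT =
    ≤-trans (≤-reflexive (rises-length T S (proj₁ (proj₂ (discover T B))))) (links-length T B hT)

  short-risesFrom : ∀ {X} T S B → length B + length T ≤ X → length S ≤ X →
    Short X risesFrom! (((T , S) , B) ∷ [])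
  short-risesFrom {X} T S B hT hS =
    (_ , _ , (_ , short-discover T B hT)) ,
    subst (λ s → Short X rises! ((T , S , proj₁ (proj₂ s)) ∷ [])) (sym (den-discover T B))
      (short-rises T S (proj₁ (proj₂ (discover T B)))
        (≤-trans (m≤n+m (length T) (length B)) hT) hS (links-length T B hT))

opaque
  unfolding mem minAbove riseBelow ready newLabel discover plan attempt best

  launch! : Tm (list tripleTy ⊗ list riseTy ⊗ nat ⊗ bestTy ∷ []) bestTy
  launch! = call schedule! (pair (fst v0)
    (pair (call start! (pair (fst (snd (snd v0))) (call gathered! (fst (snd v0)))))
    (pair (fst (snd v0)) (snd (snd (snd v0))))))

  den-launch : ∀ T U m s → den launch! ((T , U , m , s) ∷ []) ≡
    choose T (start m (gathered U)) (falls T (start m (gathered U)) U) s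
  den-launch T U m s =
    trans (cong (λ g → den schedule! ((T , start m g , U , s) ∷ [])) (den-gathered U))
          (den-schedule T (start m (gathered U)) U s)

  short-launch : ∀ {X} T U m s → length T ≤ X → length U ≤ X → Short X launch! ((T , U , m , s) ∷ [])
  short-launch T U m s hT hU =
    (_ , (((_ , _ , short-gathered U hU) , _) , _)) , short-schedule T _ U s hT hU

opaque
  unfolding mem minAbove riseBelow ready newLabel discover plan attempt best

  attempt! : Tm (taskTy ⊗ list nat ⊗ nat ⊗ bestTy ∷ []) bestTy
  attempt! = call launch! (pair (fst (fst v0))
    (pair (call risesFrom! (pair (fst v0) (fst (snd v0)))) (snd (snd v0))))

  den-attempt : ∀ T S B m s → den attempt! (((T , S) , B , m , s) ∷ []) ≡ attempt T S B m s
  den-attempt T S B m s =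
    trans (cong (λ U → den launch! ((T , U , m , s) ∷ [])) (den-risesFrom T S B))
          (den-launch T (risesFrom T S B) m s)

  short-attempt : ∀ {X} T S B m s → length B + length T ≤ X → length S ≤ X →
    Short X attempt! (((T , S) , B , m , s) ∷ [])
  short-attempt {X} T S B m s hT hS =
    (_ , ((_ , short-risesFrom T S B hT hS) , _)) ,
    subst (λ U → Short X launch! ((T , U , m , s) ∷ [])) (sym (den-risesFrom T S B))
      (short-launch T (risesFrom T S B) m s (≤-trans (m≤n+m (length T) (length B)) hT)
        (risesFrom-length T S B hT))

opaque
  unfolding mem minAbove riseBelow ready newLabel discover plan attempt best

  attempts! : Tm (taskTy ⊗ tripleTy ⊗ bestTy ∷ []) bestTy
  attempts! = let′ (fst v0) (let′ (fst (fst (snd v1))) (let′ (fst (snd (fst (snd v2))))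
    (call attempt! (pair v2 (pair (cons v1 (cons v0 nil))
      (pair (call minAbove! (pair (fst v2) (pair (num 0) (pair v1 v0))))
    (call attempt! (pair v2 (pair (cons v0 nil) (pair (num 0)
    (call attempt! (pair v2 (pair (cons v1 nil) (pair (num 0) (snd (snd v3))))))))))))))))

  den-attempts : ∀ T S e s → den attempts! (((T , S) , e , s) ∷ []) ≡ attempts T S e s
  den-attempts T S (a , b , l) s
    = trans (cong (λ s → den attempt! (((T , S) , a ∷ b ∷ [] , minAbove T 0 a b , s) ∷ []))
      (trans (cong (λ s → den attempt! (((T , S) , b ∷ [] , 0 , s) ∷ [])) (den-attempt T S (a ∷ []) 0 s))
             (den-attempt T S (b ∷ []) 0 _)))
             (den-attempt T S (a ∷ b ∷ []) (minAbove T 0 a b) _)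

  -- The 2 is the size of the largest base, the two ends of a central edge.
  short-attempts : ∀ {X} T S e s → 2 + length T ≤ X → length S ≤ X →
    Short X attempts! (((T , S) , e , s) ∷ [])
  short-attempts {X} T S (a , b , l) s hT hS =
    _ , _ , _ ,
    (_ , _ , (_ , short-minAbove T 0 a b (≤-trans (m≤n+m _ 2) hT)) ,
      (_ , _ , _ ,
        (_ , short-attempt T S (a ∷ []) 0 s (≤-trans (n≤1+n _) hT) hS)) ,
      short-attempt T S (b ∷ []) 0 _ (≤-trans (n≤1+n _) hT) hS) ,
    short-attempt T S (a ∷ b ∷ []) _ _ hT hS

opaque
  unfolding mem minAbove riseBelow ready newLabel discover plan attempt best

  best! : Tm (taskTy ∷ []) bestTy
  best! = fold (fst v0)
    (call attempt! (pair v0 (pair (cons (num 0) nil) (pair (num 0) (pair no! (pair (num 0) nil))))))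
    (call attempts! (pair v3 (pair v0 acc)))

  den-best : ∀ T S → den best! ((T , S) ∷ []) ≡ best T S
  den-best T S = trans (go T _) (cong (iter (λ e _ s → attempts T S e s) T)
    (den-attempt T S (0 ∷ []) 0 (false , 0 , [])))
    where
    go : ∀ C s → iter (λ e _ s → den attempts! (((T , S) , e , s) ∷ [])) C s
               ≡ iter (λ e _ s → attempts T S e s) C s
    go []      s = refl
    go (e ∷ C) s = trans (go C _) (cong (iter (λ e _ s → attempts T S e s) C) (den-attempts T S e s))

  short-best : ∀ {X} T S → 2 + length T ≤ X → length S ≤ X → Short X best! ((T , S) ∷ [])
  short-best T S hT hS =
    _ , (_ , short-attempt T S (0 ∷ []) 0 _ (≤-trans (n≤1+n _) hT) hS) , ≤-trans (m≤n+m _ 2) hT ,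
    shortFold _ _ (λ _ _ → ⊤) (λ e _ s _ → (_ , short-attempts T S e s hT hS) , _) T _ _

solve! : Tm (temporalGraphTy ⊗ list nat ∷ []) (unit ⊕ temporalGraphTy)
solve! = if (fold (snd v0) no! yes!)
  (let′ (call best! (pair (snd (snd (fst v0))) (snd v0)))
    (if (fst v0)
        (inr (pair (fst (fst v1)) (pair (add (fst (snd (fst v1))) (fst (snd v0))) (snd (snd v0)))))
        (inl unit)))
  (inr (fst v0))

den-solve : ∀ x → den solve! (x ∷ []) ≡ solve x
den-solve ((n , t , T) , S) =
  cong (λ s → if iter (λ _ _ _ → true) S false
              then (if proj₁ s then inj₂ (n , t + proj₁ (proj₂ s) , proj₂ (proj₂ s)) else inj₁ tt)
              else inj₂ (n , t , T))
       (den-best T S)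

short-solve : ∀ {X} x → 2 + length (proj₂ (proj₂ (proj₁ x))) ≤ X → length (proj₂ x) ≤ X →
  Short X solve! (x ∷ [])
short-solve ((n , t , T) , S) hT hS =
  (_ , _ , hS , shortFold _ _ (λ _ _ → ⊤) (λ _ _ _ _ → _ , _) S _ _) ,
  ((_ , short-best T S hT hS) , _) , _

-- Properties of the computed schedules

iter-ind : ∀ {A B : Set} {f : A → List A → B → B} (P : List A → B → Set) →
  (∀ x xs b → P (x ∷ xs) b → P xs (f x xs b)) →
  ∀ xs b → P xs b → P [] (iter f xs b)
iter-ind P step []       b p = p
iter-ind P step (x ∷ xs) b p = iter-ind P step xs _ (step x xs b p)

and-reflects : ∀ {P Q : Set} {x y} → Reflects P x → Reflects Q y → Reflects (P × Q) (and x y)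
and-reflects (ofʸ p)  (ofʸ q)  = ofʸ (p , q)
and-reflects (ofʸ p)  (ofⁿ ¬q) = ofⁿ (¬q ∘ proj₂)
and-reflects (ofⁿ ¬p) _        = ofⁿ (¬p ∘ proj₁)

or-reflects : ∀ {P Q : Set} {x y} → Reflects P x → Reflects Q y → Reflects (P ⊎ Q) (or x y)
or-reflects (ofʸ p)  _        = ofʸ (inj₁ p)
or-reflects (ofⁿ ¬p) (ofʸ q)  = ofʸ (inj₂ q)
or-reflects (ofⁿ ¬p) (ofⁿ ¬q) = ofⁿ [ ¬p , ¬q ]′

map-reflects : ∀ {P Q : Set} {x} → (P → Q) → (Q → P) → Reflects P x → Reflects Q x
map-reflects f g (ofʸ p)  = ofʸ (f p)
map-reflects f g (ofⁿ ¬p) = ofⁿ (¬p ∘ g)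

eq-reflects : ∀ a b → Reflects (a ≡ b) (eq a b)
eq-reflects a b = map-reflects (λ (p , q) → ≤-antisym p q) (λ e → ≤-reflexive e , ≤-reflexive (sym e))
  (and-reflects (≤ᵇ-reflects-≤ a b) (≤ᵇ-reflects-≤ b a))

Same : ℕ → ℕ → ℕ → ℕ → Set
Same w p a b = (a ≡ w × b ≡ p) ⊎ (a ≡ p × b ≡ w)

same-reflects : ∀ w p a b → Reflects (Same w p a b) (same w p a b)
same-reflects w p a b = or-reflects (and-reflects (eq-reflects a w) (eq-reflects b p))
                                    (and-reflects (eq-reflects a p) (eq-reflects b w))

opaque
  unfolding mem

  mem-reflects : ∀ a xs → Reflects (a ∈ xs) (mem a xs)
  mem-reflects a xs = map-reflects [ id , ⊥-elim ]′ inj₁ (go xs (ofⁿ λ ()))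
    where
    assoc : ∀ {x xs} {Q : Set} → a ∈ xs ⊎ (x ≡ a ⊎ Q) → a ∈ x ∷ xs ⊎ Q
    assoc (inj₁ i)        = inj₁ (there i)
    assoc (inj₂ (inj₁ e)) = inj₁ (here (sym e))
    assoc (inj₂ (inj₂ q)) = inj₂ q
    unassoc : ∀ {x xs} {Q : Set} → a ∈ x ∷ xs ⊎ Q → a ∈ xs ⊎ (x ≡ a ⊎ Q)
    unassoc (inj₁ (here e))  = inj₂ (inj₁ (sym e))
    unassoc (inj₁ (there i)) = inj₁ i
    unassoc (inj₂ q)         = inj₂ (inj₂ q)
    -- The accumulator changes along the fold, hence the arbitrary proposition `Q` that it reflects.
    go : ∀ xs {Q : Set} {r} → Reflects Q r → Reflects (a ∈ xs ⊎ Q) (iter (λ x _ r → or (eq x a) r) xs r)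
    go []       q = map-reflects inj₂ [ (λ ()) , id ]′ q
    go (x ∷ xs) q = map-reflects assoc unassoc (go xs (or-reflects (eq-reflects x a) q))

mx≡⊔ : ∀ a b → mx a b ≡ a ⊔ b
mx≡⊔ a b with ≤-total a b
... | inj₁ a≤b = trans (m+[n∸m]≡n a≤b) (sym (m≤n⇒m⊔n≡n a≤b))
... | inj₂ b≤a rewrite m≤n⇒m∸n≡0 b≤a = trans (+-identityʳ a) (sym (m≥n⇒m⊔n≡m b≤a))

m≤mx : ∀ a b → a ≤ mx a b
m≤mx a b = m≤m+n a _

n≤mx : ∀ a b → b ≤ mx a b
n≤mx a b = ≤-trans (m≤n⊔m a b) (≤-reflexive (sym (mx≡⊔ a b)))

mx-lub : ∀ {a b c} → a ≤ c → b ≤ c → mx a b ≤ c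
mx-lub {a} {b} p q = ≤-trans (≤-reflexive (mx≡⊔ a b)) (⊔-lub p q)

mx-sel : ∀ a b → mx a b ≡ a ⊎ mx a b ≡ b
mx-sel a b rewrite mx≡⊔ a b = ⊔-sel a b

-- Least labels and the search of the tree

module Labels (T : List Triple) where

  Lab : ℕ → ℕ → ℕ → Set
  Lab a b l = (a , b , l) ∈ T ⊎ (b , a , l) ∈ T

  lab-same : ∀ {w p a b l} → Same w p a b → (a , b , l) ∈ T → Lab w p l
  lab-same (inj₁ (refl , refl)) i = inj₁ i
  lab-same (inj₂ (refl , refl)) i = inj₂ i

  Edge : ℕ → ℕ → Set
  Edge a b = ∃[ l ] Lab a b l

  private
    Valid : ℕ → ℕ → ℕ → ℕ → Set
    Valid t w p r = 1 ≤ r → t < r × Lab w p r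

    Least : ℕ → ℕ → ℕ → List Triple → ℕ → Set
    Least t w p rem r = ∀ a b l → (a , b , l) ∈ T → Same w p a b → t < l →
      (a , b , l) ∈ rem ⊎ (1 ≤ r × r ≤ l)

    Inv : ℕ → ℕ → ℕ → List Triple → ℕ → Set
    Inv t w p rem r = (∀ {e} → e ∈ rem → e ∈ T) × Valid t w p r × Least t w p rem r

    step : ∀ t w p e rem r → Inv t w p (e ∷ rem) r → Inv t w p rem (minAboveStep t w p e r)
    step t w p (a , b , l) rem r (⊆T , v , least)
      with and (same w p a b) (and (suc t ≤ᵇ l) (or (r ≤ᵇ 0) (l ≤ᵇ r)))
         | and-reflects (same-reflects w p a b)
             (and-reflects (≤ᵇ-reflects-≤ (suc t) l) (or-reflects (≤ᵇ-reflects-≤ r 0) (≤ᵇ-reflects-≤ l r)))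
    ... | true | ofʸ (s , t<l , small) = ⊆T ∘ there , (λ _ → t<l , lab-same s (⊆T (here refl))) , least′
      where
      least′ : Least t w p rem l
      least′ a′ b′ l′ i s′ t<l′ with least a′ b′ l′ i s′ t<l′
      ... | inj₁ (here refl) = inj₂ (≤-trans (s≤s z≤n) t<l′ , ≤-refl)
      ... | inj₁ (there j)   = inj₁ j
      ... | inj₂ (q , q′)    = inj₂ (≤-trans (s≤s z≤n) t<l ,
        [ (λ r≤0 → contradiction (≤-trans q r≤0) λ ()) , (λ l≤r → ≤-trans l≤r q′) ]′ small)
    ... | false | ofⁿ ¬c = ⊆T ∘ there , v , least′
      where
      least′ : Least t w p rem r
      least′ a′ b′ l′ i s′ t<l′ with least a′ b′ l′ i s′ t<l′
      ... | inj₁ (there j)   = inj₁ j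
      ... | inj₂ q           = inj₂ q
      ... | inj₁ (here refl) with r ≤? 0 | l ≤? r
      ...   | yes r≤0 | _       = contradiction (s′ , t<l′ , inj₁ r≤0) ¬c
      ...   | no r≰0  | yes l≤r = contradiction (s′ , t<l′ , inj₂ l≤r) ¬c
      ...   | no r≰0  | no l≰r  = inj₂ (≰⇒> r≰0 , <⇒≤ (≰⇒> l≰r))

    opaque
      unfolding minAbove

      inv : ∀ t w p → Inv t w p [] (minAbove T t w p)
      inv t w p = iter-ind (Inv t w p) (step t w p) T 0 (id , (λ ()) , λ _ _ _ i _ _ → inj₁ i)

  minAbove-valid : ∀ t w p → 1 ≤ minAbove T t w p → t < minAbove T t w p × Lab w p (minAbove T t w p)
  minAbove-valid t w p = proj₁ (proj₂ (inv t w p))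

  minAbove-least : ∀ {t w p l} → Lab w p l → t < l → 1 ≤ minAbove T t w p × minAbove T t w p ≤ l
  minAbove-least {t} {w} {p} {l} (inj₁ i) t<l
    with proj₂ (proj₂ (inv t w p)) w p l i (inj₁ (refl , refl)) t<l
  ... | inj₂ q = q
  minAbove-least {t} {w} {p} {l} (inj₂ i) t<l
    with proj₂ (proj₂ (inv t w p)) p w l i (inj₂ (refl , refl)) t<l
  ... | inj₂ q = q

  data Grown (B : List ℕ) : List ℕ → List Link → Set where
    []   : Grown B B []
    grow : ∀ {D L w p} → w ∉ D → p ∈ D → Edge w p → Grown B D L → Grown B (w ∷ D) ((w , p) ∷ L)

  Done : Search → Set
  Done (D , L , P) = ∀ a b l → (a , b , l) ∈ P → a ∉ D × b ∉ D

  Progress : List ℕ → List Triple → Search → Set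
  Progress B rem (D , L , P) =
    Grown B D L ×
    (∀ {e} → e ∈ rem ⊎ e ∈ P → e ∈ T) ×
    (∀ a b l → (a , b , l) ∈ T → ((a , b , l) ∈ rem ⊎ (a , b , l) ∈ P) ⊎ (a ∈ D × b ∈ D))

  progress-step : ∀ {B} e rem s → Progress B (e ∷ rem) s → Progress B rem (searchStep e s)
  progress-step (a , b , l) rem (D , L , P) (g , ⊆T , all)
    with mem a D | mem-reflects a D | mem b D | mem-reflects b D
  ... | true | ofʸ a∈D | true | ofʸ b∈D = g , (λ { (inj₁ i) → ⊆T (inj₁ (there i)) ; (inj₂ i) → ⊆T (inj₂ i) }) , all′
    where
    all′ : ∀ a b l → (a , b , l) ∈ T → ((a , b , l) ∈ rem ⊎ (a , b , l) ∈ P) ⊎ (a ∈ D × b ∈ D)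
    all′ _ _ _ i with all _ _ _ i
    ... | inj₁ (inj₁ (here refl)) = inj₂ (a∈D , b∈D)
    ... | inj₁ (inj₁ (there j))   = inj₁ (inj₁ j)
    ... | inj₁ (inj₂ j)           = inj₁ (inj₂ j)
    ... | inj₂ q                  = inj₂ q
  ... | true | ofʸ a∈D | false | ofⁿ b∉D =
    grow b∉D a∈D (l , inj₂ (⊆T (inj₁ (here refl)))) g ,
    (λ { (inj₁ i) → ⊆T (inj₁ (there i)) ; (inj₂ i) → ⊆T (inj₂ i) }) , all′
    where
    all′ : ∀ a′ b′ l → (a′ , b′ , l) ∈ T → ((a′ , b′ , l) ∈ rem ⊎ (a′ , b′ , l) ∈ P) ⊎ (a′ ∈ b ∷ D × b′ ∈ b ∷ D)
    all′ _ _ _ i with all _ _ _ i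
    ... | inj₁ (inj₁ (here refl)) = inj₂ (there a∈D , here refl)
    ... | inj₁ (inj₁ (there j))   = inj₁ (inj₁ j)
    ... | inj₁ (inj₂ j)           = inj₁ (inj₂ j)
    ... | inj₂ (p , q)            = inj₂ (there p , there q)
  ... | false | ofⁿ a∉D | true | ofʸ b∈D =
    grow a∉D b∈D (l , inj₁ (⊆T (inj₁ (here refl)))) g ,
    (λ { (inj₁ i) → ⊆T (inj₁ (there i)) ; (inj₂ i) → ⊆T (inj₂ i) }) , all′
    where
    all′ : ∀ a′ b′ l → (a′ , b′ , l) ∈ T → ((a′ , b′ , l) ∈ rem ⊎ (a′ , b′ , l) ∈ P) ⊎ (a′ ∈ a ∷ D × b′ ∈ a ∷ D)
    all′ _ _ _ i with all _ _ _ i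
    ... | inj₁ (inj₁ (here refl)) = inj₂ (here refl , there b∈D)
    ... | inj₁ (inj₁ (there j))   = inj₁ (inj₁ j)
    ... | inj₁ (inj₂ j)           = inj₁ (inj₂ j)
    ... | inj₂ (p , q)            = inj₂ (there p , there q)
  ... | false | ofⁿ a∉D | false | ofⁿ b∉D =
    g , (λ { (inj₁ i) → ⊆T (inj₁ (there i)) ; (inj₂ (here refl)) → ⊆T (inj₁ (here refl)) ; (inj₂ (there i)) → ⊆T (inj₂ i) }) , all′
    where
    all′ : ∀ a′ b′ l′ → (a′ , b′ , l′) ∈ T →
      ((a′ , b′ , l′) ∈ rem ⊎ (a′ , b′ , l′) ∈ (a , b , l) ∷ P) ⊎ (a′ ∈ D × b′ ∈ D)
    all′ _ _ _ i with all _ _ _ i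
    ... | inj₁ (inj₁ (here refl)) = inj₁ (inj₂ (here refl))
    ... | inj₁ (inj₁ (there j))   = inj₁ (inj₁ j)
    ... | inj₁ (inj₂ j)           = inj₁ (inj₂ (there j))
    ... | inj₂ q                  = inj₂ q

  progress-sweep : ∀ {B} s → Progress B [] s → Progress B [] (sweep s)
  progress-sweep (D , L , P) (g , ⊆T , all) =
    iter-ind {f = λ e _ s → searchStep e s} (Progress _) progress-step P (D , L , [])
      (g , (λ { (inj₁ i) → ⊆T (inj₂ i) }) , λ a b l i → [ [ (λ ()) , inj₁ ∘ inj₁ ]′ , inj₂ ]′ (all a b l i))

  private
    Idle : List ℕ → List Triple → Search → Set
    Idle D₀ rem (D , L , P) = D ≡ D₀ × (∀ a b l → (a , b , l) ∈ P → a ∉ D₀ × b ∉ D₀)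

    Quiet : List ℕ → List Triple → Search → Set
    Quiet D₀ rem s = (∀ a b l → (a , b , l) ∈ rem → a ∉ D₀ × b ∉ D₀) × Idle D₀ rem s

    quiet-step : ∀ {D₀} e rem s → Quiet D₀ (e ∷ rem) s → Quiet D₀ rem (searchStep e s)
    quiet-step (a , b , l) rem (D , L , P) (rest , refl , kept)
      with mem a D | mem-reflects a D | mem b D | mem-reflects b D
    ... | true  | ofʸ a∈D | _     | _       = contradiction a∈D (proj₁ (rest a b l (here refl)))
    ... | false | ofⁿ a∉D | true  | ofʸ b∈D = contradiction b∈D (proj₂ (rest a b l (here refl)))
    ... | false | ofⁿ a∉D | false | ofⁿ b∉D =
      (λ a b l i → rest a b l (there i)) , refl ,
      λ { _ _ _ (here refl) → a∉D , b∉D ; a b l (there i) → kept a b l i }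

  done-sweep : ∀ s → Done s → Done (sweep s)
  done-sweep (D , L , P) done =
    final (sweep (D , L , P)) (iter-ind {f = λ e _ s → searchStep e s} (Quiet D) quiet-step P (D , L , []) (done , refl , λ _ _ _ ()))
    where
    final : ∀ {D} s → Quiet D [] s → Done s
    final _ (_ , refl , kept) = kept

  private
    -- Either a triple has already been dropped in this sweep, or the sweep is still idle: the
    -- discovered set is the initial one and no triple met so far touches it. At the end of a sweep
    -- the second case means that the search is finished.
    Shrunk : List ℕ → ℕ → List Triple → Search → Set
    Shrunk D₀ n rem (D , L , P) =
      length P + length rem < n ⊎ (length P + length rem ≤ n × Idle D₀ rem (D , L , P))

    shrunk-step : ∀ {D₀ n} e rem s → Shrunk D₀ n (e ∷ rem) s → Shrunk D₀ n rem (searchStep e s)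
    shrunk-step {D₀} {n} (a , b , l) rem (D , L , P) h
      with mem a D | mem-reflects a D | mem b D | mem-reflects b D | h
    ... | true  | _       | true  | _       | inj₁ q       = inj₁ (drop P q)
      where
      drop : ∀ P → length {A = Triple} P + suc (length rem) < n → length P + length rem < n
      drop P q = <-trans (+-monoʳ-< (length P) (n<1+n _)) q
    ... | true  | _       | true  | _       | inj₂ (q , _) = inj₁ (≤-trans (≤-reflexive (sym (+-suc (length P) _))) q)
    ... | true  | _       | false | _       | inj₁ q       = inj₁ (<-trans (+-monoʳ-< (length P) (n<1+n _)) q)
    ... | true  | _       | false | _       | inj₂ (q , _) = inj₁ (≤-trans (≤-reflexive (sym (+-suc (length P) _))) q)
    ... | false | _       | true  | _       | inj₁ q       = inj₁ (<-trans (+-monoʳ-< (length P) (n<1+n _)) q)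
    ... | false | _       | true  | _       | inj₂ (q , _) = inj₁ (≤-trans (≤-reflexive (sym (+-suc (length P) _))) q)
    ... | false | ofⁿ a∉D | false | ofⁿ b∉D | inj₁ q       =
      inj₁ (≤-trans (s≤s (≤-reflexive (sym (+-suc (length P) _)))) q)
    ... | false | ofⁿ a∉D | false | ofⁿ b∉D | inj₂ (q , refl , kept) =
      inj₂ (≤-trans (≤-reflexive (sym (+-suc (length P) _))) q , refl ,
            λ { _ _ _ (here refl) → a∉D , b∉D ; a b l (there i) → kept a b l i })

  sweep-shrinks : ∀ s → length (proj₂ (proj₂ (sweep s))) < length (proj₂ (proj₂ s)) ⊎ Done (sweep s)
  sweep-shrinks (D , L , P) =
    final (sweep (D , L , P)) (iter-ind {f = λ e _ s → searchStep e s} (Shrunk D (length P)) shrunk-step P (D , L , [])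
               (inj₂ (≤-refl , refl , λ _ _ _ ())))
    where
    final : ∀ {D n} s → Shrunk D n [] s → length (proj₂ (proj₂ s)) < n ⊎ Done s
    final (_ , _ , P) (inj₁ q)              = inj₁ (≤-trans (≤-reflexive (cong suc (sym (+-identityʳ (length P))))) q)
    final _           (inj₂ (_ , refl , kept)) = inj₂ kept

  opaque
    unfolding discover

    discover-spec : ∀ B → Progress B [] (discover T B) × Done (discover T B)
    discover-spec B =
      iter-ind {f = λ _ _ s → sweep s} (λ _ → Progress B []) (λ _ _ → progress-sweep) T (B , [] , T)
        ([] , [ (λ ()) , id ]′ , λ _ _ _ i → inj₁ (inj₂ i)) ,
      go T (B , [] , T) ≤-refl
      where
      stay : ∀ (C : List Triple) s → Done s → Done (iter (λ _ _ s → sweep s) C s)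
      stay C s = iter-ind {f = λ _ _ s → sweep s} (λ _ → Done) (λ _ _ → done-sweep) C s
      go : ∀ (C : List Triple) s → length (proj₂ (proj₂ s)) ≤ length C → Done (iter (λ _ _ s → sweep s) C s)
      go []      (D , L , []) _ _ _ _ ()
      go (_ ∷ C) s q with sweep-shrinks s
      ... | inj₁ q′ = go C (sweep s) (s≤s⁻¹ (≤-trans q′ q))
      ... | inj₂ d  = stay C (sweep s) d

  discover-closed : ∀ B {a b} → Edge a b → a ∈ proj₁ (discover T B) → b ∈ proj₁ (discover T B)
  discover-closed B {a} {b} e a∈D with discover T B | discover-spec B
  ... | D , L , P | (_ , _ , all) , done = go e
    where
    go : Edge a b → b ∈ D
    go (l , inj₁ i) with all a b l i
    ... | inj₁ (inj₂ j) = contradiction a∈D (proj₁ (done a b l j))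
    ... | inj₂ (_ , q)  = q
    go (l , inj₂ i) with all b a l i
    ... | inj₁ (inj₂ j) = contradiction a∈D (proj₂ (done b a l j))
    ... | inj₂ (q , _)  = q

  discover-grown : ∀ B → Grown B (proj₁ (discover T B)) (proj₁ (proj₂ (discover T B)))
  discover-grown B = proj₁ (proj₁ (discover-spec B))

-- Invariants of the rise, readiness and gathering folds

private
  -- The upper estimates in the third component make schedules feasible; attainment, in the fourth,
  -- is for the lower bound.
  BelowInv : ℕ → List Rise → ℕ → List Rise → ℕ → Set
  BelowInv w U i rem r =
    (∀ {e} → e ∈ rem → e ∈ U) × i ≤ r ×
    (∀ w′ u′ → (w′ , w , u′) ∈ U → 1 ≤ u′ → (w′ , w , u′) ∈ rem ⊎ u′ < r) ×
    (r ≡ i ⊎ ∃[ w′ ] ∃[ u′ ] ((w′ , w , u′) ∈ U × 1 ≤ u′ × r ≡ suc u′))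

  below-step : ∀ w U i e rem r → BelowInv w U i (e ∷ rem) r →
    BelowInv w U i rem (if and (eq (proj₁ (proj₂ e)) w) (1 ≤ᵇ proj₂ (proj₂ e))
                        then mx r (suc (proj₂ (proj₂ e))) else r)
  below-step w U i (a , b , u) rem r (⊆U , i≤r , above , attained)
    with and (eq b w) (1 ≤ᵇ u) | and-reflects (eq-reflects b w) (≤ᵇ-reflects-≤ 1 u)
  ... | true | ofʸ (refl , 1≤u) =
    ⊆U ∘ there , ≤-trans i≤r (m≤mx r (suc u)) , above′ , attained′ (mx-sel r (suc u))
    where
    above′ : ∀ w′ u′ → (w′ , w , u′) ∈ U → 1 ≤ u′ → (w′ , w , u′) ∈ rem ⊎ u′ < mx r (suc u)
    above′ w′ u′ j 1≤u′ with above w′ u′ j 1≤u′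
    ... | inj₁ (here refl) = inj₂ (n≤mx r (suc u))
    ... | inj₁ (there k)   = inj₁ k
    ... | inj₂ q           = inj₂ (≤-trans q (m≤mx r (suc u)))
    attained′ : mx r (suc u) ≡ r ⊎ mx r (suc u) ≡ suc u → mx r (suc u) ≡ i ⊎
      ∃[ w′ ] ∃[ u′ ] ((w′ , w , u′) ∈ U × 1 ≤ u′ × mx r (suc u) ≡ suc u′)
    attained′ (inj₁ e) = [ (λ e′ → inj₁ (trans e e′)) ,
      (λ (w′ , u′ , j , q , e′) → inj₂ (w′ , u′ , j , q , trans e e′)) ]′ attained
    attained′ (inj₂ e) = inj₂ (a , u , ⊆U (here refl) , 1≤u , e)
  ... | false | ofⁿ ¬c = ⊆U ∘ there , i≤r , above′ , attained
    where
    above′ : ∀ w′ u′ → (w′ , w , u′) ∈ U → 1 ≤ u′ → (w′ , w , u′) ∈ rem ⊎ u′ < r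
    above′ w′ u′ j 1≤u′ with above w′ u′ j 1≤u′
    ... | inj₁ (here refl) = contradiction (refl , 1≤u′) ¬c
    ... | inj₁ (there k)   = inj₁ k
    ... | inj₂ q           = inj₂ q

  opaque
    unfolding riseBelow

    below-inv : ∀ w U i → BelowInv w U i [] (riseBelow w U i)
    below-inv w U i = iter-ind (BelowInv w U i) (below-step w U i) U i
      (id , ≤-refl , (λ _ _ j _ → inj₁ j) , inj₁ refl)

gathered-pos : ∀ U → 1 ≤ gathered U
gathered-pos U = iter-ind (λ _ r → 1 ≤ r) (λ e _ r q → ≤-trans q (m≤mx r (suc (proj₂ (proj₂ e))))) U 1 ≤-refl

gathered-above : ∀ {U w p u} → (w , p , u) ∈ U → u < gathered U
gathered-above {U} i = [ (λ ()) , id ]′ (iter-ind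
  (λ rem r → ∀ w p u → (w , p , u) ∈ U → (w , p , u) ∈ rem ⊎ u < r)
  (λ e rem r h w p u i → step e rem r (h w p u i))
  U 1 (λ _ _ _ → inj₁) _ _ _ i)
  where
  step : ∀ e rem r {w p u} → (w , p , u) ∈ e ∷ rem ⊎ u < r →
    (w , p , u) ∈ rem ⊎ u < mx r (suc (proj₂ (proj₂ e)))
  step e rem r (inj₁ (here refl)) = inj₂ (n≤mx r _)
  step e rem r (inj₁ (there i))   = inj₁ i
  step e rem r (inj₂ q)           = inj₂ (≤-trans q (m≤mx r _))

gathered-least : ∀ {U b} → 1 ≤ b → (∀ w p u → (w , p , u) ∈ U → u < b) → gathered U ≤ b
gathered-least {U} {b} 1≤b h = proj₂ (iter-ind
  (λ rem r → (∀ {e} → e ∈ rem → e ∈ U) × r ≤ b)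
  (λ (w , p , u) rem r (s , q) → s ∘ there , mx-lub q (h w p u (s (here refl))))
  U 1 (id , 1≤b))

opaque
  unfolding ready

  ready-skip : ∀ ρ W {p} → (∀ w q u d → (w , q , u , d) ∈ W → w ≢ p) → ready ρ W p ≡ ρ
  ready-skip ρ []                    h = refl
  ready-skip ρ ((w , q , u , d) ∷ W) {p} h with eq w p | eq-reflects w p
  ... | true  | ofʸ e = contradiction e (h w q u d (here refl))
  ... | false | _     = ready-skip ρ W (λ w q u d i → h w q u d (there i))

  ready-base : ∀ ρ p → ready ρ [] p ≡ ρ
  ready-base ρ p = refl

  ready-there : ∀ ρ {w q u d} W {p} → w ≢ p → ready ρ ((w , q , u , d) ∷ W) p ≡ ready ρ W p
  ready-there ρ {w} W {p} w≢p with eq w p | eq-reflects w p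
  ... | true  | ofʸ e = contradiction e w≢p
  ... | false | _     = refl

  ready-here : ∀ ρ {w q u d} W → (∀ w′ q′ u′ d′ → (w′ , q′ , u′ , d′) ∈ W → w′ ≢ w) →
    ready ρ ((w , q , u , d) ∷ W) w ≡ suc d
  ready-here ρ {w} {d = d} W h with eq w w | eq-reflects w w
  ... | true  | _      = ready-skip (suc d) W h
  ... | false | ofⁿ ne = contradiction refl ne

  ready-≤ : ∀ {ρ R} W p → ρ ≤ R → (∀ w q u d → (w , q , u , d) ∈ W → d < R) → ready ρ W p ≤ R
  ready-≤         []                    p ρ≤R h = ρ≤R
  ready-≤ {ρ} {R} ((w , q , u , d) ∷ W) p ρ≤R h with eq w p
  ... | true  = ready-≤ W p (h w q u d (here refl)) (λ w q u d i → h w q u d (there i))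
  ... | false = ready-≤ W p ρ≤R (λ w q u d i → h w q u d (there i))

start-above : ∀ m g → g ≤ start m g
start-above zero    g = ≤-refl
start-above (suc m) g = ≤-trans (n≤mx (suc m) g) (n≤1+n _)

-- Feasible schedules and the labels that they produce

module Schedules (T : List Triple) (S : List ℕ) where
  open Labels T public

  riseTime-source : ∀ {w p U} → w ∈ S → 1 ≤ riseTime T S w p U
  riseTime-source {w} {p} {U} w∈S with mem w S | mem-reflects w S
  ... | false | ofⁿ ∉S = contradiction w∈S ∉S
  ... | true  | _ with riseBelow w U 1 | below-inv w U 1
  ...   | suc m | _      = s≤s z≤n
  ...   | zero  | _ , () , _

  riseTime-below : ∀ {w p U w′ u′} → (w′ , w , u′) ∈ U → 1 ≤ u′ → u′ < riseTime T S w p U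
  riseTime-below {w} {p} {U} i 1≤u′ with (if mem w S then 1 else 0)
  ... | i₀ with riseBelow w U i₀ | below-inv w U i₀
  ...   | m | _ , _ , above , _ with above _ _ i 1≤u′
  riseTime-below {w} {p} {U} i 1≤u′ | i₀ | suc m | _ , _ , above , _ | inj₂ q =
    ≤-trans q (m≤mx (suc m) (minAbove T 0 w p))

  riseTime-label : ∀ {w p U} → 1 ≤ riseTime T S w p U → minAbove T 0 w p ≤ riseTime T S w p U
  riseTime-label {w} {p} {U} q with riseBelow w U (if mem w S then 1 else 0)
  ... | suc m = n≤mx (suc m) (minAbove T 0 w p)

  -- Used for the lower bound: a rise is forced by the least label of its edge and by one further
  -- event, which is either a source at `w`, able to leave from time 1 on, or a rise across an edge
  -- just below.
  riseTime-attained : ∀ {w p U} → 1 ≤ riseTime T S w p U → ∃[ m ]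
    (riseTime T S w p U ≡ mx m (minAbove T 0 w p) ×
     ((m ≡ 1 × w ∈ S) ⊎ ∃[ w′ ] ∃[ u′ ] ((w′ , w , u′) ∈ U × 1 ≤ u′ × m ≡ suc u′)))
  riseTime-attained {w} {p} {U} q with mem w S | mem-reflects w S
  ... | true | ofʸ w∈S with riseBelow w U 1 | below-inv w U 1
  ...   | suc m | _ , _ , _ , inj₁ e  = suc m , refl , inj₁ (e , w∈S)
  ...   | suc m | _ , _ , _ , inj₂ at = suc m , refl , inj₂ at
  riseTime-attained {w} {p} {U} q | false | _ with riseBelow w U 0 | below-inv w U 0
  ...   | suc m | _ , _ , _ , inj₂ at = suc m , refl , inj₂ at

  -- Read from the head, the rises start at the discovered set D and end at D∞, each
  -- adding one new vertex.
  data Rooted : List ℕ → List ℕ → List Rise → Set where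
    []   : ∀ {D} → Rooted D D []
    link : ∀ {D D∞ w p U} → w ∉ D → p ∈ D → Edge w p → Rooted (w ∷ D) D∞ U →
           Rooted D D∞ ((w , p , riseTime T S w p U) ∷ U)

  rises-rooted : ∀ {B D L} → Grown B D L → Rooted B D (rises T S L)
  rises-rooted g = go g []
    where
    go : ∀ {B D D∞ L U} → Grown B D L → Rooted D D∞ U →
      Rooted B D∞ (iter (λ e _ U → (proj₁ e , proj₂ e , riseTime T S (proj₁ e) (proj₂ e) U) ∷ U) L U)
    go []                    r = r
    go (grow w∉D p∈D e g) r = go g (link w∉D p∈D e r)

  rooted-fresh : ∀ {D D∞ U w p u z} → Rooted D D∞ U → (w , p , u) ∈ U → z ∈ D → z ≢ w
  rooted-fresh (link w∉D _ _ r) (here refl) z∈D refl = w∉D z∈D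
  rooted-fresh (link _ _ _ r)   (there i)   z∈D e    = rooted-fresh r i (there z∈D) e

  -- A feasible schedule, with the latest vertex first; g bounds the rises and ρ is
  -- the time from which vertices of the base may be left.
  data Feasible (B : List ℕ) (g ρ : ℕ) : List ℕ → List Fall → Set where
    []   : Feasible B g ρ B []
    fall : ∀ {D W w p u d} → Feasible B g ρ D W → w ∉ D → p ∈ D → Edge w p →
           (w ∈ S → 1 ≤ u) → (1 ≤ u → minAbove T 0 w p ≤ u) → u < g →
           (∀ q u′ d′ → (p , q , u′ , d′) ∈ W → 1 ≤ u → u < u′) →
           1 ≤ fallMin T (w , p , u) → fallMin T (w , p , u) ≤ d → ready ρ W p ≤ d →
           Feasible B g ρ (w ∷ D) ((w , p , u , d) ∷ W)

  feasible-vertex : ∀ {B g ρ D W w p u d} → Feasible B g ρ D W → (w , p , u , d) ∈ W → w ∈ D × p ∈ D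
  feasible-vertex (fall f _ p∈D _ _ _ _ _ _ _ _) (here refl) = here refl , there p∈D
  feasible-vertex (fall f _ _ _ _ _ _ _ _ _ _)   (there i)   with feasible-vertex f i
  ... | w∈D , p∈D = there w∈D , there p∈D

  Finished : List ℕ → ℕ → ℕ → List ℕ → Plan → Set
  Finished B g ρ D∞ (ok , R , W) =
    ok ≡ true → Feasible B g ρ D∞ W × ρ ≤ R × (∀ w p u d → (w , p , u , d) ∈ W → d < R)

  and-true : ∀ {x y} → and x y ≡ true → x ≡ true × y ≡ true
  and-true {true} e = refl , e

  falls-feasible : ∀ {B D∞ g ρ U} → Rooted B D∞ U → (∀ w p u → (w , p , u) ∈ U → u < g) →
    Finished B g ρ D∞ (falls T ρ U)
  falls-feasible {B} {D∞} {g} {ρ} r <g =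
    go r <g (λ _ _ _ _ _ _ ()) (λ _ → [] , ≤-refl , λ _ _ _ _ ())
    where
    -- Scheduled parents against children still to come. `riseTime-below` supplies it at the moment
    -- when the parent enters `W`, because the rises of its children were computed before its own.
    Crossing : List Rise → List Fall → Set
    Crossing U W = ∀ w u p q u′ d′ → (p , q , u′ , d′) ∈ W → (w , p , u) ∈ U → 1 ≤ u → u < u′
    go : ∀ {D U s} → Rooted D D∞ U → (∀ w p u → (w , p , u) ∈ U → u < g) →
      Crossing U (proj₂ (proj₂ s)) → Finished B g ρ D s →
      Finished B g ρ D∞ (iter (λ e _ s → fallStep T ρ e s) U s)
    go []                                     _  _ fin = fin
    go {D} {s = ok , R , W} (link {w = w} {p} {U} w∉D p∈D e r) <g cross fin =
      go {s = fallStep T ρ (w , p , u) (ok , R , W)} r (λ w p u i → <g w p u (there i)) cross′ fin′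
      where
      u = riseTime T S w p U
      m = fallMin T (w , p , u)
      d = mx m (ready ρ W p)
      cross′ : Crossing U ((w , p , u , d) ∷ W)
      cross′ w′ u′ p′ q d′ _ (here refl) j 1≤u = riseTime-below {w} {p} j 1≤u
      cross′ w′ u′ p′ q d′ _ (there i)   j 1≤u = cross _ _ _ _ _ _ i (there j) 1≤u
      fin′ : Finished B g ρ (w ∷ D) (fallStep T ρ (w , p , u) (ok , R , W))
      fin′ all-ok with and-true {ok} all-ok
      ... | ok-true , m-pos with fin ok-true
      ...   | f , ρ≤R , <R =
        fall f w∉D p∈D e (riseTime-source {w} {p} {U}) (riseTime-label {w} {p} {U}) (<g w p u (here refl))
          (λ q u′ d′ i → cross w u p q u′ d′ i (here refl))
          (≤ᵇ⇒≤ 1 m (subst Data.Bool.T (sym m-pos) _)) (m≤mx m _) (n≤mx m _) ,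
        ≤-trans ρ≤R (m≤mx R (suc d)) ,
        λ { _ _ _ _ (here refl) → n≤mx R (suc d)
          ; w p u d′ (there i) → ≤-trans (<R w p u d′ i) (m≤mx R (suc d)) }

  fallMin-label : ∀ {w p u} → 1 ≤ fallMin T (w , p , u) → Lab w p (fallMin T (w , p , u))
  fallMin-label {w} {p} {zero}  q = proj₂ (minAbove-valid _ w p q)
  fallMin-label {w} {p} {suc u} q = proj₂ (minAbove-valid _ w p q)

  fallMin-second : ∀ {w p u} → 1 ≤ u → 1 ≤ fallMin T (w , p , u) → minAbove T 0 w p < fallMin T (w , p , u)
  fallMin-second {w} {p} {suc u} _ q = proj₁ (minAbove-valid _ w p q)

  newLabel-skip : ∀ l W {a b i} → (∀ w p u d → (w , p , u , d) ∈ W → ¬ Same w p a b) →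
    iter (λ e _ r → if same (proj₁ e) (proj₁ (proj₂ e)) a b then fallLabel T l e else r) W i ≡ i
  newLabel-skip l []                    h = refl
  newLabel-skip l ((w , p , u , d) ∷ W) {a} {b} h with same w p a b | same-reflects w p a b
  ... | true  | ofʸ s = contradiction s (h w p u d (here refl))
  ... | false | _     = newLabel-skip l W (λ w p u d i → h w p u d (there i))

  opaque
    unfolding newLabel

    -- The fold lets later matches overwrite earlier ones, so it matters that a pair of vertices
    -- carries one link only. This holds since `w` is new when its link is added.
    newLabel-here : ∀ {B g ρ D W w p u d l} → Feasible B g ρ D W → (w , p , u , d) ∈ W →
      newLabel T ρ W w p l ≡ fallLabel T l (w , p , u , d)
    newLabel-here {W = W} {l = l} f i = go l f i
      where
      go : ∀ {B g ρ D W w p u d r} l → Feasible B g ρ D W → (w , p , u , d) ∈ W →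
        iter (λ e _ r → if same (proj₁ e) (proj₁ (proj₂ e)) w p then fallLabel T l e else r) W r
          ≡ fallLabel T l (w , p , u , d)
      go {W = (w , p , u , d) ∷ W} l (fall f w∉D p∈D _ _ _ _ _ _ _ _) (here refl)
        with same w p w p | same-reflects w p w p
      ... | false | ofⁿ ¬s = contradiction (inj₁ (refl , refl)) ¬s
      ... | true  | _      = newLabel-skip l W λ where
        _ _ _ _ i (inj₁ (refl , refl)) → w∉D (proj₁ (feasible-vertex f i))
        _ _ _ _ i (inj₂ (refl , refl)) → w∉D (proj₂ (feasible-vertex f i))
      go {W = (w , p , u , d) ∷ W} {w′} {p′} l (fall f w∉D p∈D _ _ _ _ _ _ _ _) (there i)
        with same w p w′ p′ | same-reflects w p w′ p′
      ... | false | _ = go l f i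
      ... | true  | ofʸ (inj₁ (refl , refl)) = contradiction (proj₁ (feasible-vertex f i)) w∉D
      ... | true  | ofʸ (inj₂ (refl , refl)) = contradiction (proj₂ (feasible-vertex f i)) w∉D

    newLabel-base : ∀ {B g ρ D W a b l} → Feasible B g ρ D W → a ∈ B → b ∈ B →
      newLabel T ρ W a b l ≡ mx l (ρ ∸ 1)
    newLabel-base {l = l} f a∈B b∈B = newLabel-skip l _ λ where
        _ _ _ _ i (inj₁ (refl , refl)) → fresh f i a∈B refl
        _ _ _ _ i (inj₂ (refl , refl)) → fresh f i b∈B refl
      where
      base : ∀ {B g ρ D W z} → Feasible B g ρ D W → z ∈ B → z ∈ D
      base []                           i = i
      base (fall f _ _ _ _ _ _ _ _ _ _) i = there (base f i)
      fresh : ∀ {B g ρ D W w p u d z} → Feasible B g ρ D W → (w , p , u , d) ∈ W → z ∈ B → z ≢ w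
      fresh (fall f w∉D _ _ _ _ _ _ _ _ _) (here refl) z∈B refl = w∉D (base f z∈B)
      fresh (fall f _ _ _ _ _ _ _ _ _ _)   (there i)   z∈B e    = fresh f i z∈B e

  feasible-facts : ∀ {B g ρ D W w p u d} → Feasible B g ρ D W → (w , p , u , d) ∈ W →
    (1 ≤ u → minAbove T 0 w p ≤ u) × u < g
  feasible-facts (fall f _ _ _ _ a b _ _ _ _)   (here refl) = a , b
  feasible-facts (fall f _ _ _ _ _ _ _ _ _ _) (there i)   = feasible-facts f i

  fallLabel-bounds : ∀ {l w p u d R} → (1 ≤ u → minAbove T 0 w p ≤ u) → u < R → d < R →
    l ≤ fallLabel T l (w , p , u , d) × fallLabel T l (w , p , u , d) ≤ l + R
  fallLabel-bounds {l} {w} {p} {u} {d} {R} lab u<R d<R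
    with and (1 ≤ᵇ u) (l ≤ᵇ minAbove T 0 w p) | and-reflects (≤ᵇ-reflects-≤ 1 u) (≤ᵇ-reflects-≤ l (minAbove T 0 w p))
  ... | true  | ofʸ (1≤u , l≤m) = ≤-trans l≤m (lab 1≤u) , ≤-trans (<⇒≤ u<R) (m≤n+m R l)
  ... | false | _               = m≤mx l d , mx-lub (m≤m+n l R) (≤-trans (<⇒≤ d<R) (m≤n+m R l))

  opaque
    unfolding newLabel

    -- The lower estimate makes the relabelling a delay; the upper one justifies the lifetime
    -- `tmax 𝒢 + R`.
    newLabel-bounds : ∀ {B g ρ D W R a b l} → Feasible B g ρ D W → g ≤ ρ → ρ ≤ R →
      (∀ w p u d → (w , p , u , d) ∈ W → d < R) →
      l ≤ newLabel T ρ W a b l × newLabel T ρ W a b l ≤ l + R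
    newLabel-bounds {g = g} {ρ} {W = W} {R} {a} {b} {l} f g≤ρ ρ≤R <R =
      proj₂ (iter-ind (λ rem r → (∀ {e} → e ∈ rem → e ∈ W) × (l ≤ r × r ≤ l + R)) step W (mx l (ρ ∸ 1))
        (id , m≤mx l _ , mx-lub (m≤m+n l R) (≤-trans (m∸n≤m ρ 1) (≤-trans ρ≤R (m≤n+m R l)))))
      where
      step : ∀ e rem r → (∀ {e′} → e′ ∈ e ∷ rem → e′ ∈ W) × (l ≤ r × r ≤ l + R) →
        (∀ {e′} → e′ ∈ rem → e′ ∈ W) ×
        (l ≤ (if same (proj₁ e) (proj₁ (proj₂ e)) a b then fallLabel T l e else r) ×
         (if same (proj₁ e) (proj₁ (proj₂ e)) a b then fallLabel T l e else r) ≤ l + R)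
      step (w , p , u , d) rem r (⊆W , q) with same w p a b
      ... | false = ⊆W ∘ there , q
      ... | true  with feasible-facts f (⊆W (here refl))
      ...   | lab , u<g = ⊆W ∘ there ,
        fallLabel-bounds lab (≤-trans u<g (≤-trans g≤ρ ρ≤R)) (<R w p u d (⊆W (here refl)))

  same-swap : ∀ w p a b → same w p a b ≡ same w p b a
  same-swap w p a b with same w p a b | same-reflects w p a b | same w p b a | same-reflects w p b a
  ... | true  | _     | true  | _      = refl
  ... | false | _     | false | _      = refl
  ... | true  | ofʸ s | false | ofⁿ ¬s = contradiction (Sum.map (λ (x , y) → y , x) (λ (x , y) → y , x) (swap s)) ¬s
  ... | false | ofⁿ ¬s | true | ofʸ s  = contradiction (Sum.map (λ (x , y) → y , x) (λ (x , y) → y , x) (swap s)) ¬s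

  opaque
    unfolding newLabel

    newLabel-sym : ∀ ρ W a b l → newLabel T ρ W a b l ≡ newLabel T ρ W b a l
    newLabel-sym ρ W a b l = go W (mx l (ρ ∸ 1))
      where
      go : ∀ W r → iter (λ e _ r → if same (proj₁ e) (proj₁ (proj₂ e)) a b then fallLabel T l e else r) W r
                 ≡ iter (λ e _ r → if same (proj₁ e) (proj₁ (proj₂ e)) b a then fallLabel T l e else r) W r
      go []      r = refl
      go (e ∷ W) r rewrite same-swap (proj₁ e) (proj₁ (proj₂ e)) a b = go W _

  relabel-∈ : ∀ {ρ W a b l} → (a , b , l) ∈ T → (a , b , newLabel T ρ W a b l) ∈ relabel T ρ W
  relabel-∈ {ρ} {W} i = [ (λ ()) , id ]′ (iter-ind
    (λ rem out → ∀ a b l → (a , b , l) ∈ T → (a , b , l) ∈ rem ⊎ (a , b , newLabel T ρ W a b l) ∈ out)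
    (λ e rem out h a b l i → step e rem out (h a b l i)) T [] (λ _ _ _ → inj₁) _ _ _ i)
    where
    step : ∀ e rem out {a b l} → (a , b , l) ∈ e ∷ rem ⊎ (a , b , newLabel T ρ W a b l) ∈ out →
      (a , b , l) ∈ rem ⊎ (a , b , newLabel T ρ W a b l) ∈
        (proj₁ e , proj₁ (proj₂ e) , newLabel T ρ W (proj₁ e) (proj₁ (proj₂ e)) (proj₂ (proj₂ e))) ∷ out
    step e rem out (inj₁ (here refl)) = inj₂ (here refl)
    step e rem out (inj₁ (there i))   = inj₁ i
    step e rem out (inj₂ i)           = inj₂ (there i)

  relabel-∈⁻ : ∀ {ρ W a b j} → (a , b , j) ∈ relabel T ρ W →
    ∃[ l ] ((a , b , l) ∈ T × j ≡ newLabel T ρ W a b l)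
  relabel-∈⁻ {ρ} {W} = proj₂ (iter-ind
    {f = λ e _ r → (proj₁ e , proj₁ (proj₂ e) , newLabel T ρ W (proj₁ e) (proj₁ (proj₂ e)) (proj₂ (proj₂ e))) ∷ r}
    (λ rem out → (∀ {e} → e ∈ rem → e ∈ T) ×
      (∀ {a b j} → (a , b , j) ∈ out → ∃[ l ] ((a , b , l) ∈ T × j ≡ newLabel T ρ W a b l)))
    (λ e rem out (s , h) → s ∘ there ,
      λ { (here refl) → proj₂ (proj₂ e) , s (here refl) , refl ; (there i) → h i })
    T [] (id , λ ()))

-- Simple paths in trees

module Paths {n} (G : Graph n) where
  open Graph G using (Adj) renaming (sym to adj-sym; irrefl to adj-irrefl)

  -- vs lists the vertices after a.
  data Chain : Fin n → List (Fin n) → Fin n → Set where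
    []  : ∀ {a} → Chain a [] a
    _∷_ : ∀ {a b c vs} → Adj a c → Chain c vs b → Chain a (c ∷ vs) b

  unique-∷ : ∀ {a : Fin n} {vs} → a ∉ vs → Unique vs → Unique (a ∷ vs)
  unique-∷ a∉ u = ¬Any⇒All¬ _ a∉ ∷ u

  unique-∉ : ∀ {a : Fin n} {vs} → Unique (a ∷ vs) → a ∉ vs
  unique-∉ (a∉ ∷ _) = All¬⇒¬Any a∉

  unique-tail : ∀ {a : Fin n} {vs} → Unique (a ∷ vs) → Unique vs
  unique-tail (_ ∷ u) = u

  unique-∷ʳ : ∀ {a c : Fin n} {vs} → Unique (a ∷ vs) → c ∉ a ∷ vs → Unique (a ∷ vs ++ c ∷ [])
  unique-∷ʳ {vs = []}     u c∉ = ((λ e → c∉ (here (sym e))) ∷ []) ∷ [] ∷ []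
  unique-∷ʳ {a} {c} {v ∷ vs} u c∉ = unique-∷ a∉ (unique-∷ʳ (unique-tail u) (c∉ ∘ there))
    where
    a∉ : a ∉ v ∷ vs ++ c ∷ []
    a∉ i with ∈-++⁻ (v ∷ vs) i
    ... | inj₁ j           = unique-∉ u j
    ... | inj₂ (here refl) = c∉ (here refl)

  _++ᶜ_ : ∀ {a b c vs ws} → Chain a vs b → Chain b ws c → Chain a (vs ++ ws) c
  []      ++ᶜ q = q
  (e ∷ p) ++ᶜ q = e ∷ (p ++ᶜ q)

  end∈ : ∀ {a b vs} → Chain a vs b → b ∈ a ∷ vs
  end∈ []      = here refl
  end∈ (_ ∷ p) = there (end∈ p)

  chain-end : ∀ {a b c vs} → Chain a vs b → Chain a vs c → b ≡ c
  chain-end []      []      = refl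
  chain-end (_ ∷ p) (_ ∷ q) = chain-end p q

  reverse-chain : ∀ {a b vs} → Chain a vs b → ∃[ ws ] (Chain b ws a × (∀ {x} → x ∈ ws → x ∈ a ∷ vs))
  reverse-chain [] = [] , [] , λ ()
  reverse-chain {a} (e ∷ p) with reverse-chain p
  ... | ws , q , ws⊆ = ws ++ a ∷ [] , q ++ᶜ (adj-sym e ∷ []) , covered
    where
    covered : ∀ {x} → x ∈ ws ++ a ∷ [] → x ∈ a ∷ _
    covered i with ∈-++⁻ ws i
    ... | inj₁ j           = there (ws⊆ j)
    ... | inj₂ (here refl) = here refl

  suffix : ∀ {a b c vs} → Chain c vs b → Unique (c ∷ vs) → a ∈ c ∷ vs →
    ∃[ ws ] (Chain a ws b × Unique (a ∷ ws) × (∀ {x} → x ∈ ws → x ∈ vs))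
  suffix p       u (here refl) = _ , p , u , λ i → i
  suffix (_ ∷ p) u (there i) with suffix p (unique-tail u) i
  ... | ws , q , u′ , ws⊆ = ws , q , u′ , there ∘ ws⊆

  simplify : ∀ {a b vs} → Chain a vs b → ∃[ ws ] (Chain a ws b × Unique (a ∷ ws) × (∀ {x} → x ∈ ws → x ∈ vs))
  simplify [] = [] , [] , [] ∷ [] , λ ()
  simplify {a} (_∷_ {c = c} e p) with simplify p
  ... | ws , q , u , ws⊆ with decMember Fin._≟_ a (c ∷ ws)
  ...   | no a∉ = c ∷ ws , e ∷ q , unique-∷ a∉ u , λ { (here refl) → here refl ; (there i) → there (ws⊆ i) }
  ...   | yes a∈ with suffix q u a∈
  ...     | ws′ , q′ , u′ , ws′⊆ = ws′ , q′ , u′ , there ∘ ws⊆ ∘ ws′⊆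

  star⇒chain : ∀ {a b} → Star Adj a b → ∃[ vs ] Chain a vs b
  star⇒chain ε       = [] , []
  star⇒chain (e ◅ s) with star⇒chain s
  ... | vs , p = _ , e ∷ p

  prefix : ∀ {a w p vs} → Chain a vs w → Unique (a ∷ vs) → p ∈ a ∷ vs → p ≢ w →
    ∃[ us ] (Chain a us p × Unique (a ∷ us ++ w ∷ []) × (∀ {x} → x ∈ us ++ w ∷ [] → x ∈ vs))
  prefix []      u (here refl) p≢w = contradiction refl p≢w
  prefix (e ∷ q) u (here refl) p≢w =
    [] , [] , ((p≢w ∷ []) ∷ [] ∷ []) , λ { (here refl) → end∈ q }
  prefix (_∷_ {c = c} e q) u (there i) p≢w with prefix q (unique-tail u) i p≢w
  ... | us , r , u′ , us⊆ = c ∷ us , e ∷ r ,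
    unique-∷ (λ { (here refl) → unique-∉ u (here refl) ; (there j) → unique-∉ u (there (us⊆ j)) }) u′ ,
    λ { (here refl) → here refl ; (there j) → there (us⊆ j) }

  module Acyclic (acyclic : ∀ v ws → ¬ IsCycle G v ws) where

    -- Two simple paths that diverge after a close a cycle through a.
    simple-path-unique : ∀ {a b vs ws} → Chain a vs b → Unique (a ∷ vs) → Chain a ws b → Unique (a ∷ ws) → vs ≡ ws
    simple-path-unique []      _ []      _ = refl
    simple-path-unique []      _ (_ ∷ q) v = contradiction (end∈ q) (unique-∉ v)
    simple-path-unique (_ ∷ p) u []      _ = contradiction (end∈ p) (unique-∉ u)
    simple-path-unique {a} (_∷_ {c = c} {vs} e p) u (_∷_ {c = d} {ws} e′ q) v with c Fin.≟ d
    ... | yes refl = cong (c ∷_) (simple-path-unique p (unique-tail u) q (unique-tail v))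
    ... | no c≢d with reverse-chain q
    ...   | ws′ , q′ , ws′⊆ with simplify (p ++ᶜ q′)
    ...     | zs , r , uz , zs⊆ = contradiction (long r , unique-∷ a∉ uz , e ∷ linked r) (acyclic a (c ∷ zs))
      where
      a∉ : a ∉ c ∷ zs
      a∉ (here refl) = adj-irrefl e
      a∉ (there i) with ∈-++⁻ vs (zs⊆ i)
      ... | inj₁ j = unique-∉ u (there j)
      ... | inj₂ j = unique-∉ v (ws′⊆ j)
      long : ∀ {zs} → Chain c zs d → 2 ≤ length (c ∷ zs)
      long []      = contradiction refl c≢d
      long (_ ∷ _) = s≤s (s≤s z≤n)
      linked : ∀ {c zs} → Chain c zs d → Linked Adj (c ∷ zs ++ a ∷ [])
      linked []      = adj-sym e′ ∷ [-]
      linked (x ∷ r) = x ∷ linked r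

    -- `p` is the neighbour of `w` on the side of `a`. The formulation by penultimate vertices
    -- applies directly to a temporal path whose last step has been split off.
    record Via (a p w : Fin n) : Set where
      field
        nontrivial  : a ≢ w
        penultimate : ∀ vs z → Chain a vs z → Adj z w → Unique (a ∷ vs ++ w ∷ []) → z ≡ p

    -- Take the simple path from `a` to `w`. If it avoids `p`, it extends to a simple path to `p`
    -- through `w`; otherwise its part up to `p`, followed by `w`, is a simple path to `w` through
    -- `p`. Uniqueness of simple paths turns either into a statement about all of them.
    via-dichotomy : Connected G → ∀ a {w p} → Adj w p → Via a w p ⊎ Via a p w
    via-dichotomy connected a {w} {p} e with simplify (proj₂ (star⇒chain (connected a w)))
    ... | vs , q , u , _ with decMember Fin._≟_ p (a ∷ vs)
    ...   | no p∉ = inj₁ record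
      { nontrivial  = λ { refl → p∉ (here refl) }
      ; penultimate = λ vs′ z r e′ u′ → sym (chain-end q (subst (λ x → Chain a x z)
          (∷ʳ-injectiveˡ vs′ vs (simple-path-unique (r ++ᶜ (e′ ∷ [])) u′ (q ++ᶜ (e ∷ [])) (unique-∷ʳ u p∉))) r))
      }
    ...   | yes p∈ = inj₂ record
      { nontrivial  = a≢w
      ; penultimate = penult
      }
      where
      p≢w : p ≢ w
      p≢w refl = adj-irrefl e
      a≢w : a ≢ w
      a≢w refl = trivial (simple-path-unique q u [] ([] ∷ [])) p∈
        where
        trivial : ∀ {vs} → vs ≡ [] → ¬ p ∈ w ∷ vs
        trivial refl (here e) = p≢w e
      penult : ∀ vs′ z → Chain a vs′ z → Adj z w → Unique (a ∷ vs′ ++ w ∷ []) → z ≡ p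
      penult vs′ z r e′ u′ with prefix q u p∈ p≢w
      ... | us , q′ , u″ , _ = chain-end (subst (λ x → Chain a x z)
        (∷ʳ-injectiveˡ vs′ us (simple-path-unique (r ++ᶜ (e′ ∷ [])) u′ (q′ ++ᶜ (adj-sym e ∷ [])) u″)) r) q′

-- Earliest arrivals

module _ {n} (𝒢 : TemporalGraph n) (t : ℕ) where

  data Route (F : List (Fin n)) (s : ℕ) (u v : Fin n) : Set where
    stay   : u ≡ v → Route F s u v
    depart : ∀ {w l} → s < l → l ≤ t → HasLabel 𝒢 u w l → w ∉ u ∷ F → Route (u ∷ F) l w v → Route F s u v

  route⇒path : ∀ {F s u v} → Route F s u v → s ≤ t → ∃[ steps ] (Walk 𝒢 u steps v ×
    Unique (u ∷ map proj₂ steps) × All (_∉ F) (map proj₂ steps) × Linked _<_ (s ∷ map proj₁ steps) × arrival steps ≤ t)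
  route⇒path (stay refl) s≤t = [] , [] , [] ∷ [] , [] , [-] , z≤n
  route⇒path (depart {w} {l} s<l l≤t h w∉ r) s≤t with route⇒path r l≤t
  ... | steps , walk , uniq , avoid , linked , arr =
    (l , w) ∷ steps , h ∷ walk ,
    ((λ e → w∉ (here (sym e))) ∷ All.map (λ x∉ e → x∉ (here (sym e))) avoid) ∷ uniq ,
    (w∉ ∘ there) ∷ All.map (_∘ there) avoid ,
    s<l ∷ linked ,
    arrive steps arr
    where
    arrive : ∀ steps → arrival steps ≤ t → arrival ((l , w) ∷ steps) ≤ t
    arrive []      _ = l≤t
    arrive (_ ∷ _) q = q

  head≤arrival : ∀ {l w} (steps : List (ℕ × Fin n)) → Linked _<_ (l ∷ map proj₁ steps) → l ≤ arrival ((l , w) ∷ steps)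
  head≤arrival []              _       = ≤-refl
  head≤arrival ((_ , w) ∷ steps) (q ∷ k) = ≤-trans (<⇒≤ q) (head≤arrival {w = w} steps k)

  path⇒route : ∀ {F s u v steps} → Walk 𝒢 u steps v → Unique (u ∷ map proj₂ steps) → All (_∉ F) (map proj₂ steps) →
    Linked _<_ (s ∷ map proj₁ steps) → arrival steps ≤ t → Route F s u v
  path⇒route []      _ _ _ _ = stay refl
  path⇒route {u = u} (_∷_ {w = w} {steps = steps} h walk) ((u≢w ∷ u≢) ∷ uniq) (w∉F ∷ avoid) (s<l ∷ linked) arr =
    depart s<l (≤-trans (head≤arrival {w = w} steps linked) arr) h (λ { (here e) → u≢w (sym e) ; (there i) → w∉F i })
      (path⇒route walk uniq (merge u≢ avoid) linked (arrive steps arr))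
    where
    arrive : ∀ {l} steps → arrival ((l , w) ∷ steps) ≤ t → arrival steps ≤ t
    arrive []      _ = z≤n
    arrive (_ ∷ _) q = q
    merge : ∀ {F vs} → All (u ≢_) vs → All (_∉ F) vs → All (_∉ u ∷ F) vs
    merge []       []       = []
    merge (x ∷ xs) (y ∷ ys) = (λ { (here e) → x (sym e) ; (there i) → y i }) ∷ merge xs ys

  -- Labels increase strictly, so each step raises `s` and the fuel `k` outlasts every route that
  -- ends by `t`. Decidability is what makes reachtimes exist as minima.
  route? : ∀ k F s u v → t ≤ s + k → Dec (Route F s u v)
  route? k F s u v t≤ with u Fin.≟ v
  ... | yes u≡v = yes (stay u≡v)
  route? zero    F s u v t≤ | no u≢v = no λ
    { (stay e)            → u≢v e
    ; (depart s<l l≤t _ _ _) → <⇒≱ s<l (≤-trans l≤t (≤-trans t≤ (≤-reflexive (+-identityʳ s)))) }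
  route? (suc k) F s u v t≤ | no u≢v =
    map′ (λ { (w , i , a , w∉ , i≤t , s<l , r) → depart s<l i≤t (i , refl , a) w∉ (r s<l) })
         (λ { (stay e) → ⊥-elim (u≢v e)
            ; (depart s<l l≤t (i , refl , a) w∉ r) → _ , i , a , w∉ , l≤t , s<l , λ _ → r })
         (Fin.any? λ w → Fin.any? λ i → T? (Graph.edge (E 𝒢 i) u w) ×-dec ¬? (decMember Fin._≟_ w (u ∷ F))
            ×-dec (suc (toℕ i) ≤? t) ×-dec later? w i)
    where
    later? : ∀ w (i : Fin (tmax 𝒢)) → Dec (s < suc (toℕ i) × (s < suc (toℕ i) → Route (u ∷ F) (suc (toℕ i)) w v))
    later? w i with s <? suc (toℕ i)
    ... | no s≮l  = no (s≮l ∘ proj₁)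
    ... | yes s<l = map′ (λ r → s<l , λ _ → r) (λ (q , r) → r q)
      (route? k (u ∷ F) (suc (toℕ i)) w v (≤-trans t≤ (≤-trans (≤-reflexive (+-suc s k)) (+-monoˡ-≤ k s<l))))

  reachesBy? : ∀ u v → Dec (ReachesBy 𝒢 t u v)
  reachesBy? u v = map′ to from (route? t [] 0 u v ≤-refl)
    where
    to : Route [] 0 u v → ReachesBy 𝒢 t u v
    to r with route⇒path r z≤n
    ... | steps , walk , uniq , _ , linked , arr =
      steps , record { walk = walk ; distinct = uniq ; increasing = unlink linked } , arr
      where
      unlink : ∀ {x xs} → Linked _<_ (x ∷ xs) → Linked _<_ xs
      unlink [-]     = []
      unlink (_ ∷ k) = k
    from : ReachesBy 𝒢 t u v → Route [] 0 u v
    from (steps , path , arr) = path⇒route walk distinct (All.universal (λ _ ()) _) (link walk increasing) arr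
      where
      open IsTemporalPath path
      link : ∀ {u v steps} → Walk 𝒢 u steps v → Linked _<_ (map proj₁ steps) → Linked _<_ (0 ∷ map proj₁ steps)
      link []                    _ = [-]
      link ((i , refl , _) ∷ _) k = s≤s z≤n ∷ k

-- Minima, maxima and the existence of values

least : ∀ {P : ℕ → Set} → (∀ t → Dec (P t)) → ∀ m → P m → ∃[ t ] (P t × (∀ t′ → P t′ → t ≤ t′))
least P? zero    p = 0 , p , λ _ _ → z≤n
least P? (suc m) p with P? 0
... | yes p₀ = 0 , p₀ , λ _ _ → z≤n
... | no ¬p₀ with least (P? ∘ suc) m p
...   | t , q , min = suc t , q , λ { zero p₀ → contradiction p₀ ¬p₀ ; (suc t′) p′ → s≤s (min t′ p′) }

argmin : ∀ {n} (f : Fin n → ℕ) → Fin n → ∃[ c ] (∀ v → f c ≤ f v)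
argmin f v₀ with least (λ t → Fin.any? λ v → f v ≟ t) (f v₀) (v₀ , refl)
... | t , (c , refl) , min = c , λ v → min (f v) (v , refl)

upper-bound : ∀ {n} (f : Fin n → ℕ) → ∃[ b ] (∀ v → f v ≤ b)
upper-bound {zero}  f = 0 , λ ()
upper-bound {suc n} f with upper-bound (f ∘ fsuc)
... | b , h = f fzero ⊔ b , λ { fzero → m≤m⊔n _ b ; (fsuc v) → ≤-trans (h v) (m≤n⊔m _ b) }

-- The least upper bound is attained, for otherwise its predecessor would be an upper bound too.
argmax : ∀ {n} {P : Fin n → Set} → (∀ v → Dec (P v)) → (f : Fin n → ℕ) → ∃[ v ] P v →
  ∃[ m ] (P m × (∀ v → P v → f v ≤ f m))
argmax {P = P} P? f (v₀ , p₀) with upper-bound f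
... | b , h with least {P = λ t → ∀ v → P v → f v ≤ t} (λ t → Fin.all? λ v → P? v →-dec (f v ≤? t)) b (λ v _ → h v)
...   | t , ub , min with Fin.any? (λ v → P? v ×-dec (f v ≟ t))
...     | yes (m , p , refl) = m , p , ub
...     | no none = contradiction (min (pred t) (λ v p → <⇒≤pred (strict v p))) (<⇒≱ (pred< (strict v₀ p₀)))
  where
  strict : ∀ v → P v → f v < t
  strict v p = ≤∧≢⇒< (ub v p) (λ e → none (v , p , e))
  pred< : ∀ {x t} → x < t → pred t < t
  pred< (s≤s _) = ≤-refl

module _ {n} (𝒢 : TemporalGraph n) where

  reachtime-exists : ∀ {b} v → (∀ w → ReachesBy 𝒢 b v w) → ∃[ t ] (IsReachtime 𝒢 v t × t ≤ b)
  reachtime-exists {b} v h with least (λ t → Fin.all? (reachesBy? 𝒢 t v)) b h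
  ... | t , r , min = t , (r , min) , min b h

  value-exists : ∀ {b} (S : Subset n) → ∃[ v ] v ∈ₛ S → (∀ v → v ∈ₛ S → ∀ w → ReachesBy 𝒢 b v w) →
    ∃[ k ] (IsValue 𝒢 S k × k ≤ b)
  value-exists {b} S nonempty h =
    let m , m∈S , max = argmax (_∈ₛ? S) (proj₁ ∘ time) nonempty
    in proj₁ (time m) ,
       ((λ v v∈S → proj₁ (time v) , proj₁ (proj₂ (time v) v∈S) , max v v∈S) ,
        inj₁ (m , m∈S , proj₁ (proj₂ (time m) m∈S))) ,
       proj₂ (proj₂ (time m) m∈S)
    where
    time : ∀ v → ∃[ t ] (v ∈ₛ S → IsReachtime 𝒢 v t × t ≤ b)
    time v with v ∈ₛ? S
    ... | no v∉S  = 0 , λ v∈S → contradiction v∈S v∉S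
    ... | yes v∈S with reachtime-exists v (h v v∈S)
    ...   | t , q = t , λ _ → q

  earliest-exists : ∀ {b u v} → ReachesBy 𝒢 b u v →
    ∃[ t ] (ReachesBy 𝒢 t u v × (∀ t′ → ReachesBy 𝒢 t′ u v → t ≤ t′))
  earliest-exists {b} {u} {v} r = least (λ t → reachesBy? 𝒢 t u v) b r

  -- A solution comes without a deadline; the finitely many pairs of a source and a vertex supply a
  -- common one.
  solution-bounded : ∀ (S : Subset n) → (∀ v → v ∈ₛ S → ∀ w → Reaches 𝒢 v w) →
    ∃[ b ] (∀ v → v ∈ₛ S → ∀ w → ReachesBy 𝒢 b v w)
  solution-bounded S h =
    proj₁ ceiling , λ v v∈S w → let steps , path , q = proj₂ (time v w) v∈S in
      steps , path , ≤-trans q (≤-trans (proj₂ (upper-bound (proj₁ ∘ time v)) w) (proj₂ ceiling v))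
    where
    time : ∀ v w → ∃[ t ] (v ∈ₛ S → ReachesBy 𝒢 t v w)
    time v w with v ∈ₛ? S
    ... | no v∉S  = 0 , λ v∈S → contradiction v∈S v∉S
    ... | yes v∈S with h v v∈S w
    ...   | steps , path = arrival steps , λ _ → steps , path , ≤-refl
    ceiling : ∃[ b ] (∀ v → proj₁ (upper-bound (proj₁ ∘ time v)) ≤ b)
    ceiling = upper-bound (λ v → proj₁ (upper-bound (proj₁ ∘ time v)))

-- Realising a schedule

hasLabel-sym : ∀ {n} (𝒢 : TemporalGraph n) {u v l} → HasLabel 𝒢 u v l → HasLabel 𝒢 v u l
hasLabel-sym 𝒢 (i , e , a) = i , e , Graph.sym (E 𝒢 i) a

hasLabel-pos : ∀ {n} (𝒢 : TemporalGraph n) {u v l} → HasLabel 𝒢 u v l → 1 ≤ l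
hasLabel-pos 𝒢 (i , refl , _) = s≤s z≤n

module Delay {n} (𝒢 : TemporalGraph n) (F : Fin n → Fin n → ℕ → ℕ) (b : ℕ)
             (F-sym : ∀ u v l → F u v l ≡ F v u l)
             (F-bounds : ∀ u v l → l ≤ F u v l × F u v l ≤ l + b) where

  private
    moved? : ∀ (j : Fin (tmax 𝒢 + b)) u v →
      Dec (∃[ i ] (Graph.Adj (E 𝒢 i) u v × F u v (suc (toℕ i)) ≡ suc (toℕ j)))
    moved? j u v = any? λ i → T? (Graph.edge (E 𝒢 i) u v) ×-dec (F u v (suc (toℕ i)) ≟ suc (toℕ j))

    layer : Fin (tmax 𝒢 + b) → Graph n
    layer j = record
      { edge   = λ u v → ⌊ moved? j u v ⌋
      ; sym    = λ {u} {v} a → let i , a′ , e = toWitness {a? = moved? j u v} a in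
                   fromWitness {a? = moved? j v u} (i , Graph.sym (E 𝒢 i) a′ , trans (F-sym v u _) e)
      ; irrefl = λ {u} a → let i , a′ , _ = toWitness {a? = moved? j u u} a in Graph.irrefl (E 𝒢 i) a′
      }

    -- The new label is positive because it is at least the old one, and it is in range because it
    -- grows by at most `b`.
    index : ∀ u v (i : Fin (tmax 𝒢)) → Σ (Fin (tmax 𝒢 + b)) λ j → F u v (suc (toℕ i)) ≡ suc (toℕ j)
    index u v i with F u v (suc (toℕ i)) | F-bounds u v (suc (toℕ i))
    ... | suc k | _ , k≤ = fromℕ< k< , cong suc (sym (toℕ-fromℕ< k<))
      where
      k< : k < tmax 𝒢 + b
      k< = ≤-trans k≤ (+-monoˡ-≤ b (toℕ<n i))

  delayed : TemporalGraph n
  delayed = record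
    { underlying = underlying 𝒢
    ; tmax       = tmax 𝒢 + b
    ; E          = layer
    ; E⊆         = λ j {u} {v} a → let i , a′ , _ = toWitness {a? = moved? j u v} a in TemporalGraph.E⊆ 𝒢 i a′
    ; ⊆⋃E        = λ {u} {v} a → let i , a′ = TemporalGraph.⊆⋃E 𝒢 a ; j , e = index u v i in
                     j , fromWitness {a? = moved? j u v} (i , a′ , e)
    }

  delayed-label : ∀ {u v l} → HasLabel 𝒢 u v l → HasLabel delayed u v (F u v l)
  delayed-label {u} {v} (i , refl , a) with index u v i
  ... | j , e = j , e , fromWitness {a? = moved? j u v} (i , a , e)

  delayed-label⁻ : ∀ {u v j} → HasLabel delayed u v j → ∃[ l ] (HasLabel 𝒢 u v l × j ≡ F u v l)
  delayed-label⁻ {u} {v} (j , refl , a) with toWitness {a? = moved? j u v} a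
  ... | i , a′ , e = suc (toℕ i) , (i , refl , a′) , sym e

  isDelay : IsDelayOf 𝒢 delayed
  isDelay =
    (λ u v l → F u v l ∸ l) ,
    (λ u v l → cong (_∸ l) (F-sym u v l)) ,
    (λ u v j → mk⇔
      (λ h → let l , h′ , e = delayed-label⁻ h in l , h′ , trans e (sym (m+[n∸m]≡n (proj₁ (F-bounds u v l)))))
      (λ (l , h , e) → subst (HasLabel delayed u v)
        (sym (trans e (m+[n∸m]≡n (proj₁ (F-bounds u v l))))) (delayed-label h)))

module _ {n} {𝒢 : TemporalGraph n} where

  walk-snoc : ∀ {a b c steps l} → Walk 𝒢 a steps b → HasLabel 𝒢 b c l → Walk 𝒢 a (steps ++ (l , c) ∷ []) c
  walk-snoc []      h = h ∷ []
  walk-snoc (x ∷ w) h = x ∷ walk-snoc w h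

unique-snoc : ∀ {n} {a c : Fin n} {l : ℕ} steps → Unique (a ∷ map proj₂ steps) → a ≢ c → All (λ s → proj₂ s ≢ c) steps →
  Unique (a ∷ map proj₂ (steps ++ (l , c) ∷ []))
unique-snoc []      (_ ∷ _)        a≢c _          = (a≢c ∷ []) ∷ [] ∷ []
unique-snoc {c = c} {l} (s ∷ steps) ((a≢s ∷ a≢) ∷ u) a≢c (s≢c ∷ ≢c) = (a≢s ∷ go steps a≢) ∷ unique-snoc steps u s≢c ≢c
  where
  go : ∀ steps → All (_ ≢_) (map proj₂ steps) → All (_ ≢_) (map proj₂ (steps ++ (l , c) ∷ []))
  go []      []       = a≢c ∷ []
  go (_ ∷ s) (x ∷ xs) = x ∷ go s xs

linked-snoc : ∀ {n} {c : Fin n} {l} steps → Linked _<_ (map proj₁ steps) → All (λ s → proj₁ s < l) steps →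
  Linked _<_ (map proj₁ (steps ++ (l , c) ∷ []))
linked-snoc []          _       _            = [-]
linked-snoc (s ∷ [])    _       (s<l ∷ [])   = s<l ∷ [-]
linked-snoc (s ∷ t ∷ r) (q ∷ k) (_ ∷ ts)     = q ∷ linked-snoc (t ∷ r) k ts

linked-cons : ∀ {n} {l} (steps : List (ℕ × Fin n)) → Linked _<_ (map proj₁ steps) →
  All (λ s → l < proj₁ s) steps → Linked _<_ (l ∷ map proj₁ steps)
linked-cons []      _ _       = [-]
linked-cons (s ∷ r) k (q ∷ _) = q ∷ k

arrival-< : ∀ {n b} (steps : List (ℕ × Fin n)) → 1 ≤ b → All (λ s → proj₁ s < b) steps → arrival steps < b
arrival-< []          1≤b _        = 1≤b
arrival-< (_ ∷ [])    1≤b (q ∷ []) = q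
arrival-< (_ ∷ t ∷ r) 1≤b (_ ∷ q)  = arrival-< (t ∷ r) 1≤b q

record EncodedLabels {n} (𝒢 : TemporalGraph n) (T : List Triple) : Set where
  field
    decode : ∀ a b l → (a , b , l) ∈ T → ∃[ u ] ∃[ v ] (a ≡ toℕ u × b ≡ toℕ v × HasLabel 𝒢 u v l)
    encode : ∀ u v l → HasLabel 𝒢 u v l → Labels.Lab T (toℕ u) (toℕ v) l

  decode-lab : ∀ {a b l} → Labels.Lab T a b l → ∃[ u ] ∃[ v ] (a ≡ toℕ u × b ≡ toℕ v × HasLabel 𝒢 u v l)
  decode-lab (inj₁ i) = decode _ _ _ i
  decode-lab (inj₂ i) with decode _ _ _ i
  ... | u , v , p , q , h = v , u , q , p , hasLabel-sym 𝒢 h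

  lab⇒label : ∀ {u v l} → Labels.Lab T (toℕ u) (toℕ v) l → HasLabel 𝒢 u v l
  lab⇒label i with decode-lab i
  ... | u′ , v′ , p , q , h rewrite toℕ-injective p | toℕ-injective q = h

module Realise {n} (𝒢 : TemporalGraph n) (T : List Triple) (S : List ℕ) (enc : EncodedLabels 𝒢 T)
               {B : List ℕ} {g ρ R : ℕ} {D∞ : List ℕ} {W∞ : List Fall}
               (feasible : Schedules.Feasible T S B g ρ D∞ W∞)
               (1≤g : 1 ≤ g) (g≤ρ : g ≤ ρ) (ρ≤R : ρ ≤ R) (<R : ∀ w p u d → (w , p , u , d) ∈ W∞ → d < R) where
  open Schedules T S
  open EncodedLabels enc

  F : Fin n → Fin n → ℕ → ℕ
  F u v l = newLabel T ρ W∞ (toℕ u) (toℕ v) l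

  open Delay 𝒢 F R (λ u v l → newLabel-sym ρ W∞ (toℕ u) (toℕ v) l)
    (λ u v l → newLabel-bounds {a = toℕ u} {toℕ v} feasible g≤ρ ρ≤R <R) public

  delayed-enc : EncodedLabels delayed (relabel T ρ W∞)
  delayed-enc = record { decode = dec ; encode = enc′ }
    where
    dec : ∀ a b j → (a , b , j) ∈ relabel T ρ W∞ → ∃[ u ] ∃[ v ] (a ≡ toℕ u × b ≡ toℕ v × HasLabel delayed u v j)
    dec a b j i with relabel-∈⁻ {ρ} {W∞} i
    ... | l , i′ , refl with decode _ _ _ i′
    ...   | u , v , refl , refl , h = u , v , refl , refl , delayed-label h
    enc′ : ∀ u v j → HasLabel delayed u v j → Labels.Lab (relabel T ρ W∞) (toℕ u) (toℕ v) j
    enc′ u v j h with delayed-label⁻ h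
    ... | l , h′ , refl with encode u v l h′
    ...   | inj₁ i = inj₁ (relabel-∈ {ρ} {W∞} i)
    ...   | inj₂ i = inj₂ (subst (λ x → (toℕ v , toℕ u , x) ∈ relabel T ρ W∞)
                         (newLabel-sym ρ W∞ (toℕ v) (toℕ u) l) (relabel-∈ {ρ} {W∞} i))

  -- The half-open interval of labels lets a step at time `hi` or later be appended, and a step
  -- before `lo` be put in front, without further comparison.
  PathIn : List ℕ → ℕ → ℕ → Fin n → Fin n → Set
  PathIn D lo hi a b = ∃[ steps ] (IsTemporalPath delayed a steps b ×
    All (λ s → toℕ (proj₂ s) ∈ D × lo ≤ proj₁ s × proj₁ s < hi) steps)

  rise-label : ∀ {w p u d} → (toℕ w , toℕ p , u , d) ∈ W∞ → Edge (toℕ w) (toℕ p) → 1 ≤ u →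
    HasLabel delayed w p u
  rise-label {w} {p} {u} {d} i (l , lab) 1≤u =
    subst (HasLabel delayed w p) (trans (newLabel-here {l = m} feasible i) eq-u)
      (delayed-label (lab⇒label {w} {p} (proj₂ (minAbove-valid 0 _ _ m-pos))))
    where
    m : ℕ
    m = minAbove T 0 (toℕ w) (toℕ p)
    m-pos : 1 ≤ m
    m-pos = proj₁ (minAbove-least lab (hasLabel-pos 𝒢 (lab⇒label {w} {p} lab)))
    eq-u : fallLabel T m (toℕ w , toℕ p , u , d) ≡ u
    eq-u with and (1 ≤ᵇ u) (m ≤ᵇ m) | and-reflects (≤ᵇ-reflects-≤ 1 u) (≤ᵇ-reflects-≤ m m)
    ... | true  | _      = refl
    ... | false | ofⁿ ¬c = contradiction (1≤u , ≤-refl) ¬c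

  -- If the least label is spent on the rise, `fallMin` is a strictly larger label. So `fallLabel`
  -- delays it to the maximum with `d`, which is `d` because of `fallMin` being at most `d`.
  fall-label : ∀ {w p u d} → (toℕ w , toℕ p , u , d) ∈ W∞ →
    1 ≤ fallMin T (toℕ w , toℕ p , u) → fallMin T (toℕ w , toℕ p , u) ≤ d → HasLabel delayed p w d
  fall-label {w} {p} {u} {d} i 1≤m m≤d =
    hasLabel-sym delayed (subst (HasLabel delayed w p) (trans (newLabel-here {l = m} feasible i) eq-d)
      (delayed-label (lab⇒label {w} {p} (fallMin-label {u = u} 1≤m))))
    where
    m : ℕ
    m = fallMin T (toℕ w , toℕ p , u)
    eq-d : fallLabel T m (toℕ w , toℕ p , u , d) ≡ d
    eq-d with and (1 ≤ᵇ u) (m ≤ᵇ minAbove T 0 (toℕ w) (toℕ p))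
            | and-reflects (≤ᵇ-reflects-≤ 1 u) (≤ᵇ-reflects-≤ m (minAbove T 0 (toℕ w) (toℕ p)))
    ... | true  | ofʸ (1≤u , q) = contradiction q (<⇒≱ (fallMin-second 1≤u 1≤m))
    ... | false | _ = trans (mx≡⊔ m d) (m≤n⇒m⊔n≡n m≤d)

  base-label : ∀ {a b} → toℕ a ∈ B → toℕ b ∈ B → Edge (toℕ a) (toℕ b) → minAbove T 0 (toℕ a) (toℕ b) ≤ ρ ∸ 1 →
    HasLabel delayed a b (ρ ∸ 1)
  base-label {a} {b} a∈B b∈B (l , lab) m≤ =
    subst (HasLabel delayed a b)
      (trans (newLabel-base {l = minAbove T 0 (toℕ a) (toℕ b)} feasible a∈B b∈B) (trans (mx≡⊔ _ (ρ ∸ 1)) (m≤n⇒m⊔n≡n m≤)))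
      (delayed-label (lab⇒label {a} {b} (proj₂ (minAbove-valid 0 (toℕ a) (toℕ b)
        (proj₁ (minAbove-least lab (hasLabel-pos 𝒢 (lab⇒label {a} {b} lab))))))))

  -- The time at which `z` passes on what it has gathered from below. A vertex with no source at or
  -- below it has none, as no path needs to start there.
  data Leaves (W : List Fall) (z : ℕ) : ℕ → Set where
    central : z ∈ B → Leaves W z g
    rising  : ∀ {p u d} → (z , p , u , d) ∈ W → 1 ≤ u → Leaves W z u

  base⊆ : ∀ {D W z} → Feasible B g ρ D W → z ∈ B → z ∈ D
  base⊆ []                           i = i
  base⊆ (fall f _ _ _ _ _ _ _ _ _ _) i = there (base⊆ f i)

  locate : ∀ {D W z} → Feasible B g ρ D W → z ∈ D → z ∈ B ⊎ ∃[ p ] ∃[ u ] ∃[ d ] ((z , p , u , d) ∈ W × (z ∈ S → 1 ≤ u))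
  locate []                           i           = inj₁ i
  locate (fall _ _ _ _ s _ _ _ _ _ _) (here refl) = inj₂ (_ , _ , _ , here refl , s)
  locate (fall f _ _ _ _ _ _ _ _ _ _) (there i)   with locate f i
  ... | inj₁ j                      = inj₁ j
  ... | inj₂ (p , u , d , j , s) = inj₂ (p , u , d , there j , s)

  source-leaves : ∀ {D W z} → Feasible B g ρ D W → z ∈ D → z ∈ S → ∃[ t ] Leaves W z t
  source-leaves f z∈D z∈S with locate f z∈D
  ... | inj₁ i                = g , central i
  ... | inj₂ (_ , u , _ , i , s) = u , rising i (s z∈S)

  fresh : ∀ {D W w} → Feasible B g ρ D W → w ∉ D → ∀ w′ q u d → (w′ , q , u , d) ∈ W → w′ ≢ w
  fresh f w∉D w′ q u d i refl = w∉D (proj₁ (feasible-vertex f i))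

  leaves-≤ : ∀ {D W z t} → Feasible B g ρ D W → Leaves W z t → t ≤ g
  leaves-≤ f (central _)  = ≤-refl
  leaves-≤ f (rising i _) = <⇒≤ (proj₂ (feasible-facts f i))

  -- No fall starts before all rises are over. Hence a path may turn from rising to falling at any
  -- vertex, without visiting the centre.
  ready-above : ∀ {D W} → Feasible B g ρ D W → ∀ z → g ≤ ready ρ W z
  ready-above []                                                              z = ≤-trans g≤ρ (≤-reflexive (sym (ready-base ρ z)))
  ready-above (fall {W = W} {w} {p} {u} {d} f w∉D _ _ _ _ _ _ _ _ d≥) z with w ≟ z
  ... | no w≢z   rewrite ready-there ρ {w} {p} {u} {d} W w≢z = ready-above f z
  ... | yes refl rewrite ready-here ρ {w} {p} {u} {d} W (fresh f w∉D) =
    ≤-trans (ready-above f p) (≤-trans d≥ (n≤1+n d))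

  widen : ∀ {D lo hi a b w} → PathIn D lo hi a b → PathIn (w ∷ D) lo hi a b
  widen (steps , path , in-D) = steps , path , All.map (λ (i , q) → there i , q) in-D

  module Connect (base-path : ∀ a b → toℕ a ∈ B → toℕ b ∈ B → PathIn B g ρ a b) where

    -- The newest vertex is a leaf of the tree scheduled so far. Paths between older vertices stay
    -- as they are, a path to it gets one fall appended, and a path from it gets its rise put in
    -- front.
    connect : ∀ {D W} → Feasible B g ρ D W → (∀ {e} → e ∈ W → e ∈ W∞) →
      ∀ a b t → toℕ a ∈ D → toℕ b ∈ D → Leaves W (toℕ a) t → PathIn D t (ready ρ W (toℕ b)) a b
    connect [] _ a b _ a∈B b∈B (central _) =
      subst (λ r → PathIn B g r a b) (sym (ready-base ρ (toℕ b))) (base-path a b a∈B b∈B)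
    connect (fall {D} {W} {w} {p} {u} {d} f w∉D p∈D (l , e) s₁ s₂ u<g up 1≤m m≤d r≤d) W⊆ a b t a∈ b∈ leaves
      with decode-lab e
    ... | ω , π , refl , refl , h = go a∈ b∈ leaves
      where
      ready-old : ∀ {z} → z ∈ D → ready ρ ((w , p , u , d) ∷ W) z ≡ ready ρ W z
      ready-old z∈D = ready-there ρ {w} {p} {u} {d} W (λ { refl → w∉D z∈D })
      ready-new : ready ρ ((w , p , u , d) ∷ W) w ≡ suc d
      ready-new = ready-here ρ {w} {p} {u} {d} W (fresh f w∉D)
      go : ∀ {a b t} → toℕ a ∈ w ∷ D → toℕ b ∈ w ∷ D → Leaves ((w , p , u , d) ∷ W) (toℕ a) t →
        PathIn (w ∷ D) t (ready ρ ((w , p , u , d) ∷ W) (toℕ b)) a b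
      go {a} {b} {t} (there a∈D) b∈ lv = to-old-or-new b∈
        where
        older : Leaves ((w , p , u , d) ∷ W) (toℕ a) t → Leaves W (toℕ a) t
        older (central i)            = central i
        older (rising (here e) _)    = contradiction (subst (_∈ D) (cong proj₁ e) a∈D) w∉D
        older (rising (there i) q)   = rising i q
        to-old-or-new : toℕ b ∈ w ∷ D → PathIn (w ∷ D) t (ready ρ ((w , p , u , d) ∷ W) (toℕ b)) a b
        to-old-or-new (there b∈D) = subst (λ r → PathIn (w ∷ D) t r a b) (sym (ready-old b∈D))
          (widen (connect f (W⊆ ∘ there) a b t a∈D b∈D (older lv)))
        to-old-or-new (here e) with toℕ-injective e
        ... | refl with connect f (W⊆ ∘ there) a π t a∈D p∈D (older lv)
        ...   | steps , path , in-D = subst (λ r → PathIn (w ∷ D) t r a b) (sym ready-new)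
          (steps ++ (d , ω) ∷ [] ,
           record
             { walk       = walk-snoc walk (fall-label {ω} {π} (W⊆ (here refl)) 1≤m m≤d)
             ; distinct   = unique-snoc steps distinct (λ { refl → w∉D a∈D })
                              (All.map (λ (i , _) → λ { refl → w∉D i }) in-D)
             ; increasing = linked-snoc steps increasing (All.map (λ (_ , _ , q) → ≤-trans q r≤d) in-D)
             } ,
           snoc-all steps in-D)
          where
          open IsTemporalPath path
          snoc-all : ∀ steps → All (λ s → toℕ (proj₂ s) ∈ D × t ≤ proj₁ s × proj₁ s < ready ρ W p) steps →
            All (λ s → toℕ (proj₂ s) ∈ w ∷ D × t ≤ proj₁ s × proj₁ s < suc d) (steps ++ (d , ω) ∷ [])
          snoc-all []      []                   =
            (here refl , ≤-trans (leaves-≤ f (older lv)) (≤-trans (ready-above f p) r≤d) , ≤-refl) ∷ []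
          snoc-all (_ ∷ r) ((i , lo , hi) ∷ qs) =
            (there i , lo , ≤-trans hi (≤-trans r≤d (n≤1+n d))) ∷ snoc-all r qs
      go {a} {b} {t} (here e) b∈ lv with toℕ-injective e
      ... | refl = from-new b∈ lv
        where
        trivial : ∀ {t r} → PathIn (w ∷ D) t r a a
        trivial = [] , record { walk = [] ; distinct = [] ∷ [] ; increasing = [] } , []
        from-new : toℕ b ∈ w ∷ D → Leaves ((w , p , u , d) ∷ W) w t →
          PathIn (w ∷ D) t (ready ρ ((w , p , u , d) ∷ W) (toℕ b)) a b
        from-new (here e′) _ with toℕ-injective e′
        ... | refl = trivial
        from-new (there b∈D) (central i)            = contradiction (base⊆ f i) w∉D
        from-new (there b∈D) (rising (there i) _)   = contradiction (proj₁ (feasible-vertex f i)) w∉D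
        from-new (there b∈D) (rising (here refl) 1≤u) =
          subst (λ r → PathIn (w ∷ D) u r a b) (sym (ready-old b∈D)) (extend parent)
          where
          -- What rises into `p` must be able to go on: a central `p` continues at `g`, and any
          -- other `p` has a rise of its own that is later than `u`.
          parent : ∃[ t′ ] (u < t′ × Leaves W p t′)
          parent with locate f p∈D
          ... | inj₁ i                       = g , u<g , central i
          ... | inj₂ (q , u′ , d′ , i , _) = u′ , up q u′ d′ i 1≤u , rising i (≤-trans (s≤s z≤n) (up q u′ d′ i 1≤u))
          extend : ∃[ t′ ] (u < t′ × Leaves W p t′) → PathIn (w ∷ D) u (ready ρ W (toℕ b)) a b
          extend (t′ , u<t′ , lv′) with connect f (W⊆ ∘ there) π b t′ p∈D b∈D lv′
          ... | steps , path , in-D =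
            (u , π) ∷ steps ,
            record
              { walk       = rise-label {ω} {π} (W⊆ (here refl)) (l , e₀) 1≤u ∷ walk
              ; distinct   = ((λ { refl → w∉D p∈D }) ∷ apart steps in-D) ∷ distinct
              ; increasing = linked-cons steps increasing (All.map (λ (_ , q , _) → ≤-trans u<t′ q) in-D)
              } ,
            (there p∈D , ≤-refl , ≤-trans u<g (ready-above f (toℕ b))) ∷
            All.map (λ (i , q , q′) → there i , ≤-trans (<⇒≤ u<t′) q , q′) in-D
            where
            open IsTemporalPath path
            e₀ : Lab w p l
            e₀ = encode ω π l h
            apart : ∀ steps → All (λ s → toℕ (proj₂ s) ∈ D × t′ ≤ proj₁ s × proj₁ s < ready ρ W (toℕ b)) steps →
              All (a ≢_) (map proj₂ steps)
            apart []      []             = []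
            apart (_ ∷ r) ((i , _) ∷ qs) = (λ { refl → w∉D i }) ∷ apart r qs

    source-reaches : ∀ v w → toℕ v ∈ S → toℕ v ∈ D∞ → toℕ w ∈ D∞ → ReachesBy delayed (R ∸ 1) v w
    source-reaches v w v∈S v∈D w∈D with source-leaves feasible v∈D v∈S
    ... | t , lv with connect feasible id v w t v∈D w∈D lv
    ...   | steps , path , in-D = steps , path , <⇒≤pred (≤-trans
      (arrival-< steps (≤-trans 1≤g (ready-above feasible (toℕ w))) (All.map (λ (_ , _ , q) → q) in-D))
      (ready-≤ W∞ (toℕ w) ρ≤R <R))

-- Lower bound

module _ {n} {𝒢 : TemporalGraph n} where

  walk-last : ∀ {a w s steps} → Walk 𝒢 a (s ∷ steps) w →
    ∃[ init ] ∃[ l ] ∃[ z ] (s ∷ steps ≡ init ++ (l , w) ∷ [] × Walk 𝒢 a init z × HasLabel 𝒢 z w l)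
  walk-last {a} {s = l , w} (h ∷ [])          = [] , l , a , refl , [] , h
  walk-last {s = s} (h ∷ walk@(_ ∷ _)) with walk-last walk
  ... | init , l , z , e , walk′ , h′ = s ∷ init , l , z , cong (s ∷_) e , h ∷ walk′ , h′

arrival-snoc : ∀ {n} {c : Fin n} {l} init → arrival (init ++ (l , c) ∷ []) ≡ l
arrival-snoc []             = refl
arrival-snoc (_ ∷ [])       = refl
arrival-snoc (_ ∷ s ∷ init) = arrival-snoc (s ∷ init)

linked-init : ∀ {n} {c : Fin n} {l} init → 1 ≤ l → Linked _<_ (map proj₁ (init ++ (l , c) ∷ [])) →
  Linked _<_ (map proj₁ init) × arrival init < l
linked-init []             1≤l _           = [] , 1≤l
linked-init (_ ∷ [])       1≤l (q ∷ _)     = [-] , q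
linked-init (_ ∷ s ∷ init) 1≤l (q ∷ k) with linked-init (s ∷ init) 1≤l k
... | k′ , r = q ∷ k′ , r

unique-init : ∀ {A : Set} {a c : A} vs → Unique (a ∷ vs ++ c ∷ []) → Unique (a ∷ vs)
unique-init []       _              = [] ∷ []
unique-init (v ∷ vs) ((a≢v ∷ a≢) ∷ u) = (a≢v ∷ All-init vs a≢) ∷ unique-init vs u
  where
  All-init : ∀ {A : Set} {P : A → Set} {c} vs → All P (vs ++ c ∷ []) → All P vs
  All-init []       _        = []
  All-init (_ ∷ vs) (p ∷ ps) = p ∷ All-init vs ps

module Bound {n} (𝒢 𝒢′ : TemporalGraph n) (tree : IsTree (underlying 𝒢)) (delay : IsDelayOf 𝒢 𝒢′)
             (Src : Subset n) (nonempty : ∃[ v ] v ∈ₛ Src) (K : ℕ)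
             (reach : ∀ v → v ∈ₛ Src → ∀ w → ReachesBy 𝒢′ K v w) where
  open Graph (underlying 𝒢) using (Adj) renaming (sym to adj-sym; irrefl to adj-irrefl)
  open Paths (underlying 𝒢) using (Chain; []; _∷_; module Acyclic)
  open Acyclic (IsTree.acyclic tree) using (Via; via-dichotomy)

  δ : Fin n → Fin n → ℕ → ℕ
  δ = proj₁ delay

  original : ∀ {u v j} → HasLabel 𝒢′ u v j → ∃[ i ] (HasLabel 𝒢 u v i × j ≡ i + δ u v i)
  original {u} {v} {j} = Equivalence.to (proj₂ (proj₂ delay) u v j)

  label-adj : ∀ {u v j} → HasLabel 𝒢′ u v j → Adj u v
  label-adj h with original h
  ... | _ , (i , _ , a) , _ = TemporalGraph.E⊆ 𝒢 i a

  walk⇒chain : ∀ {a b steps} → Walk 𝒢′ a steps b → Chain a (map proj₂ steps) b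
  walk⇒chain []      = []
  walk⇒chain (h ∷ w) = label-adj h ∷ walk⇒chain w

  private opaque
    earliest : ∀ s z → ∃[ t ] (s ∈ₛ Src →
      ReachesBy 𝒢′ t s z × (∀ t′ → ReachesBy 𝒢′ t′ s z → t ≤ t′))
    earliest s z with s ∈ₛ? Src
    ... | no s∉  = 0 , λ s∈ → contradiction s∈ s∉
    ... | yes s∈ with earliest-exists 𝒢′ (reach s s∈ z)
    ...   | t , q = t , λ _ → q

  ea : Fin n → Fin n → ℕ
  ea s z = proj₁ (earliest s z)

  -- In the tree every path from `s` to `w` ends with the edge `pw`. For an earliest path the label
  -- of that edge is the arrival time, and what precedes it reaches `p` strictly earlier.
  via-last : ∀ {s p w} → s ∈ₛ Src → Via s p w → HasLabel 𝒢′ p w (ea s w) × ea s p < ea s w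
  via-last {s} {p} {w} s∈ via with proj₂ (earliest s w) s∈
  ... | ([] , path , _) , _ with IsTemporalPath.walk path
  ...   | [] = contradiction refl (Via.nontrivial via)
  via-last {s} {p} {w} s∈ via | (st ∷ steps , path , arr) , min with walk-last (IsTemporalPath.walk path)
  ... | init , l , z , e , walk , h = conclude (Via.penultimate via (map proj₂ init) z (walk⇒chain walk)
                                        (label-adj h) uniq)
    where
    increasing : Linked _<_ (map proj₁ (init ++ (l , w) ∷ []))
    increasing = subst (Linked _<_ ∘ map proj₁) e (IsTemporalPath.increasing path)
    uniq : Unique (s ∷ map proj₂ init ++ w ∷ [])
    uniq = subst (Unique ∘ (s ∷_)) (trans (cong (map proj₂) e) (map-++ proj₂ init _)) (IsTemporalPath.distinct path)
    l≡ea : l ≡ ea s w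
    l≡ea = ≤-antisym
      (≤-trans (≤-reflexive (sym (trans (cong arrival e) (arrival-snoc init)))) arr)
      (≤-trans (min _ (st ∷ steps , path , ≤-refl)) (≤-reflexive (trans (cong arrival e) (arrival-snoc init))))
    conclude : z ≡ p → HasLabel 𝒢′ p w (ea s w) × ea s p < ea s w
    conclude refl with linked-init init (hasLabel-pos 𝒢′ h) increasing
    ... | linked , arr<l = subst (HasLabel 𝒢′ z w) l≡ea h ,
      ≤-trans (s≤s (proj₂ (proj₂ (earliest s z) s∈) _
        (init , record { walk = walk ; distinct = unique-init _ uniq ; increasing = linked } , ≤-refl)))
        (≤-trans arr<l (≤-reflexive l≡ea))

  via-unique : ∀ {s p q w} → s ∈ₛ Src → Via s p w → Via s q w → p ≡ q
  via-unique {s} {p} {q} {w} s∈ via via′ with reach s s∈ w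
  ... | [] , path , _ with IsTemporalPath.walk path
  ...   | [] = contradiction refl (Via.nontrivial via)
  via-unique {s} {p} {q} {w} s∈ via via′ | st ∷ steps , path , _ with walk-last (IsTemporalPath.walk path)
  ... | init , l , z , e , walk , h =
    trans (sym (Via.penultimate via _ z (walk⇒chain walk) (label-adj h) uniq))
          (Via.penultimate via′ _ z (walk⇒chain walk) (label-adj h) uniq)
    where
    uniq : Unique (s ∷ map proj₂ init ++ w ∷ [])
    uniq = subst (Unique ∘ (s ∷_)) (trans (cong (map proj₂) e) (map-++ proj₂ init _)) (IsTemporalPath.distinct path)

  via-cases : ∀ s {w p} → Adj w p → Via s w p ⊎ Via s p w
  via-cases s = via-dichotomy (IsTree.connected tree) s

  -- Only one neighbour of `p` lies towards `s`, and that is `w`.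
  via-onward : ∀ {s w p q} → s ∈ₛ Src → Via s w p → Adj p q → w ≢ q → Via s p q
  via-onward {s} s∈ via a w≢q with via-cases s a
  ... | inj₁ via′ = via′
  ... | inj₂ via′ = contradiction (via-unique s∈ via via′) w≢q

  private opaque
    latest : ∀ z → ∃[ s ] (s ∈ₛ Src × (∀ s′ → s′ ∈ₛ Src → ea s′ z ≤ ea s z))
    latest z = argmax (_∈ₛ? Src) (λ s → ea s z) nonempty

  late : Fin n → Fin n
  late z = proj₁ (latest z)

  late∈ : ∀ z → late z ∈ₛ Src
  late∈ z = proj₁ (proj₂ (latest z))

  γ : Fin n → ℕ
  γ z = ea (late z) z

  ea≤γ : ∀ {s} z → s ∈ₛ Src → ea s z ≤ γ z
  ea≤γ z s∈ = proj₂ (proj₂ (latest z)) _ s∈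

  γ≤K : ∀ z → γ z ≤ K
  γ≤K z = proj₂ (proj₂ (earliest (late z) z) (late∈ z)) K (reach _ (late∈ z) z)

  private opaque
    centre : ∃[ c ] (∀ v → γ c ≤ γ v)
    centre = argmin γ (proj₁ nonempty)

  c : Fin n
  c = proj₁ centre

  γc≤ : ∀ v → γ c ≤ γ v
  γc≤ = proj₂ centre

  -- Seen from the discovered set D, nothing comes in from outside at time b or
  -- later, and the outside is completely informed later than the inside.
  record Outward (b : ℕ) (D : List ℕ) : Set where
    field
      inward : ∀ {p w s} → toℕ p ∈ D → toℕ w ∉ D → Adj w p → s ∈ₛ Src → Via s w p → ea s p < b
      later  : ∀ {p w} → toℕ p ∈ D → toℕ w ∉ D → Adj w p → γ p < γ w

  -- Were the latest source of `w` behind `w`, it would be at `w` before it is at `p`, and at `p` by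
  -- `γ c`. That gives `γ w < γ c`, against the choice of `c`.
  outward-late : ∀ {b D p w} → b ≤ suc (γ c) → Outward b D → toℕ p ∈ D → toℕ w ∉ D → Adj w p → Via (late w) p w
  outward-late {p = p} {w} b≤ out p∈ w∉ a with via-cases (late w) a
  ... | inj₂ via = via
  ... | inj₁ via = contradiction
    (≤-trans (proj₂ (via-last (late∈ w) via)) (s≤s⁻¹ (≤-trans (Outward.inward out p∈ w∉ a (late∈ w) via) b≤)))
    (≤⇒≯ (γc≤ w))

  -- A source beyond `w` goes on to `p`, so it is at `w` even earlier than at `p`. The latest source
  -- of `w` comes through `p`, so it reaches any further neighbour of `w` only after `w`.
  outward-step : ∀ {b D p w} → b ≤ suc (γ c) → Outward b D → toℕ p ∈ D → toℕ w ∉ D → Adj w p → Outward b (toℕ w ∷ D)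
  outward-step {b} {D} {p} {w} b≤ out p∈ w∉ a = record { inward = inw ; later = lat }
    where
    parent≢ : ∀ {z} → toℕ z ∉ toℕ w ∷ D → z ≢ p
    parent≢ z∉ refl = z∉ (there p∈)
    inw : ∀ {q z s} → toℕ q ∈ toℕ w ∷ D → toℕ z ∉ toℕ w ∷ D → Adj z q → s ∈ₛ Src → Via s z q → ea s q < b
    inw (there q∈) z∉ a′ s∈ via = Outward.inward out q∈ (z∉ ∘ there) a′ s∈ via
    inw (here e) z∉ a′ s∈ via with toℕ-injective e
    ... | refl = let via′ = via-onward s∈ via a (parent≢ z∉) in
      <-trans (proj₂ (via-last s∈ via′)) (Outward.inward out p∈ w∉ a s∈ via′)
    lat : ∀ {q z} → toℕ q ∈ toℕ w ∷ D → toℕ z ∉ toℕ w ∷ D → Adj z q → γ q < γ z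
    lat (there q∈) z∉ a′ = Outward.later out q∈ (z∉ ∘ there) a′
    lat {z = z} (here e) z∉ a′ with toℕ-injective e
    ... | refl with via-cases (late w) a′
    ...   | inj₂ via = ≤-trans (proj₂ (via-last (late∈ w) via)) (ea≤γ z (late∈ w))
    ...   | inj₁ via = contradiction (via-unique (late∈ w) via (outward-late b≤ out p∈ w∉ a)) (parent≢ z∉)

  module Encoded (T : List Triple) (S : List ℕ) (enc : EncodedLabels 𝒢 T)
                 (sources : ∀ v → toℕ v ∈ S → v ∈ₛ Src) where
    open Schedules T S
    open EncodedLabels enc

    edge-adj : ∀ {u v l} → HasLabel 𝒢 u v l → Adj u v
    edge-adj (i , _ , a) = TemporalGraph.E⊆ 𝒢 i a

    first-label : ∀ {w p j} → HasLabel 𝒢′ w p j →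
      1 ≤ minAbove T 0 (toℕ w) (toℕ p) × minAbove T 0 (toℕ w) (toℕ p) ≤ j
    first-label {w} {p} h with original h
    ... | i , h′ , refl with minAbove-least (encode w p i h′) (hasLabel-pos 𝒢 h′)
    ...   | q , q′ = q , ≤-trans q′ (m≤m+n i _)

    -- Two labels of 𝒢′ come from two labels of 𝒢, one of which is not the least.
    second-label : ∀ {w p j k} → HasLabel 𝒢′ w p j → HasLabel 𝒢′ w p k → j < k →
      1 ≤ minAbove T (minAbove T 0 (toℕ w) (toℕ p)) (toℕ w) (toℕ p) ×
      minAbove T (minAbove T 0 (toℕ w) (toℕ p)) (toℕ w) (toℕ p) ≤ k
    second-label {w} {p} h h′ j<k with original h | original h′
    ... | i , hi , refl | i′ , hi′ , refl with minAbove T 0 (toℕ w) (toℕ p) <? i′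
    ...   | yes m<i′ = let q , q′ = minAbove-least (encode w p i′ hi′) m<i′ in q , ≤-trans q′ (m≤m+n i′ _)
    ...   | no m≮i′ = let q , q′ = minAbove-least (encode w p i hi) m<i in
                        q , ≤-trans q′ (≤-trans (m≤m+n i _) (<⇒≤ j<k))
      where
      m = minAbove T 0 (toℕ w) (toℕ p)
      m≤i : m ≤ i
      m≤i = proj₂ (minAbove-least (encode w p i hi) (hasLabel-pos 𝒢 hi))
      m≤i′ : m ≤ i′
      m≤i′ = proj₂ (minAbove-least (encode w p i′ hi′) (hasLabel-pos 𝒢 hi′))
      -- Otherwise `i` and `i′` are both the least label, and a single label cannot be delayed to
      -- two different times.
      m<i : m < i
      m<i = ≤∧≢⇒< m≤i λ m≡i → <-irrefl
        (cong (λ x → x + δ w p x) (trans (sym m≡i) (≤-antisym m≤i′ (≮⇒≥ m≮i′)))) j<k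

    RiseBound : ℕ → ℕ → ℕ → ℕ → Set
    RiseBound b w p u = 1 ≤ u → ∃[ ω ] ∃[ π ] ∃[ s ] (w ≡ toℕ ω × p ≡ toℕ π ×
      s ∈ₛ Src × Via s ω π × u ≤ ea s π × ea s π < b)

    -- Induction from the leaves. The event that forces a rise names a source behind the edge, and
    -- this same source has to cross the next edge strictly later, which carries the estimate one
    -- edge towards the centre.
    rise-bound : ∀ {b D D∞ U} → b ≤ suc (γ c) → Rooted D D∞ U → Outward b D →
      ∀ w p u → (w , p , u) ∈ U → RiseBound b w p u
    rise-bound {b} b≤ (link {D} {w = w} {p} {U} w∉D p∈D (l , e) r) out with decode-lab e
    ... | ω , π , refl , refl , h = bounds
      where
      adj : Adj ω π
      adj = edge-adj h
      deeper : ∀ w p u → (w , p , u) ∈ U → RiseBound b w p u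
      deeper = rise-bound b≤ r (outward-step b≤ out p∈D w∉D adj)
      finish : ∀ {u m s} → u ≡ mx m (minAbove T 0 w p) → s ∈ₛ Src → Via s ω π →
        (HasLabel 𝒢′ ω π (ea s π) → m ≤ ea s π) →
        ∃[ ω ] ∃[ π ] ∃[ s ] (w ≡ toℕ ω × p ≡ toℕ π × s ∈ₛ Src × Via s ω π × u ≤ ea s π × ea s π < b)
      finish u≡ s∈ via m≤ with via-last s∈ via
      ... | h′ , _ = ω , π , _ , refl , refl , s∈ , via ,
        ≤-trans (≤-reflexive u≡) (mx-lub (m≤ h′) (proj₂ (first-label h′))) ,
        Outward.inward out p∈D w∉D adj s∈ via
      bounds : ∀ w′ p′ u → (w′ , p′ , u) ∈ (w , p , riseTime T S w p U) ∷ U → RiseBound b w′ p′ u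
      bounds w′ p′ u (there i) = deeper w′ p′ u i
      bounds _ _ _ (here refl) 1≤u with riseTime-attained {w} {p} {U} 1≤u
      ... | m , u≡ , inj₁ (refl , w∈S) = finish u≡ (sources ω w∈S) own (hasLabel-pos 𝒢′)
        where
        own : Via ω ω π
        own with via-cases ω adj
        ... | inj₁ via = via
        ... | inj₂ via = contradiction refl (Via.nontrivial via)
      ... | m , u≡ , inj₂ (w′ , u′ , i , 1≤u′ , refl) with deeper w′ w u′ i 1≤u′
      ...   | ω′ , ω″ , s , refl , e″ , s∈ , via , u′≤ , _ with toℕ-injective e″
      ...     | refl = finish u≡ s∈ onward (λ _ → ≤-trans (s≤s u′≤) (proj₂ (via-last s∈ onward)))
        where
        onward : Via s ω π
        onward = via-onward s∈ via adj (λ { refl → rooted-fresh r i (there p∈D) refl })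

    -- The fold is followed with the invariant that every scheduled vertex is ready by one more than
    -- its `γ`. The solution itself has a label at `γ ω` on the link, since the latest source of `ω`
    -- comes from the parent.
    fall-bound : ∀ {b ρ D D∞ U} → b ≤ suc (γ c) → Rooted D D∞ U → Outward b D →
      (∀ w p u → (w , p , u) ∈ U → RiseBound b w p u) → ∀ s →
      proj₁ s ≡ true → proj₁ (proj₂ s) ≤ suc K →
      (∀ w p u d → (w , p , u , d) ∈ proj₂ (proj₂ s) → w ∈ D) →
      (∀ z → toℕ z ∈ D → ready ρ (proj₂ (proj₂ s)) (toℕ z) ≤ suc (γ z)) →
      proj₁ (iter (λ e _ s → fallStep T ρ e s) U s) ≡ true ×
      proj₁ (proj₂ (iter (λ e _ s → fallStep T ρ e s) U s)) ≤ suc K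
    fall-bound b≤ [] out rb s ok R≤ W⊆ rdy = ok , R≤
    fall-bound {b} {ρ} b≤ (link {D} {w = w} {p} {U} w∉D p∈D (l , e) r) out rb (_ , R , W) refl R≤ W⊆ rdy
      with decode-lab e
    ... | ω , π , refl , refl , h =
      fall-bound b≤ r (outward-step b≤ out p∈D w∉D adj) (λ w p u i → rb w p u (there i))
        (fallStep T ρ (w , p , u) (true , R , W))
        (≤ᵇ-true (proj₁ m-bound)) (mx-lub R≤ (s≤s (≤-trans d≤ (γ≤K ω)))) W⊆′ rdy′
      where
      u m d : ℕ
      u = riseTime T S w p U
      m = fallMin T (w , p , u)
      d = mx m (ready ρ W p)
      adj : Adj ω π
      adj = edge-adj h
      γ-label : HasLabel 𝒢′ ω π (γ ω)
      γ-label = hasLabel-sym 𝒢′ (proj₁ (via-last (late∈ ω) (outward-late b≤ out p∈D w∉D adj)))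
      ≤ᵇ-true : ∀ {x} → 1 ≤ x → (1 ≤ᵇ x) ≡ true
      ≤ᵇ-true (s≤s _) = refl
      m-bound : 1 ≤ m × m ≤ γ ω
      m-bound = bnd u (rb w p u (here refl))
        where
        bnd : ∀ u → RiseBound b w p u → 1 ≤ fallMin T (w , p , u) × fallMin T (w , p , u) ≤ γ ω
        bnd zero    _  = first-label γ-label
        bnd (suc u) rb with rb (s≤s z≤n)
        ... | ω′ , π′ , s , e₁ , e₂ , s∈ , via , _ , <b with toℕ-injective e₁ | toℕ-injective e₂
        -- The rising source crosses this edge by `γ π`, the latest source of `ω` at the strictly
        -- later time `γ ω`. So the solution uses two labels of the edge.
        ...   | refl | refl = second-label (proj₁ (via-last s∈ via)) γ-label
          (≤-trans (≤-trans <b (≤-trans b≤ (s≤s (γc≤ π)))) (Outward.later out p∈D w∉D adj))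
      d≤ : d ≤ γ ω
      d≤ = mx-lub (proj₂ m-bound) (≤-trans (rdy π p∈D) (Outward.later out p∈D w∉D adj))
      W⊆′ : ∀ w′ p′ u′ d′ → (w′ , p′ , u′ , d′) ∈ (w , p , u , d) ∷ W → w′ ∈ w ∷ D
      W⊆′ _ _ _ _ (here refl)     = here refl
      W⊆′ w′ p′ u′ d′ (there i) = there (W⊆ w′ p′ u′ d′ i)
      rdy′ : ∀ z → toℕ z ∈ w ∷ D → ready ρ ((w , p , u , d) ∷ W) (toℕ z) ≤ suc (γ z)
      rdy′ z (there z∈) = ≤-trans (≤-reflexive (ready-there ρ {w} {p} {u} {d} W
        (λ e → w∉D (subst (_∈ D) (sym e) z∈)))) (rdy z z∈)
      rdy′ z (here e) with toℕ-injective e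
      ... | refl = ≤-trans (≤-reflexive (ready-here ρ {w} {p} {u} {d} W
        (λ w′ p′ u′ d′ i e → w∉D (subst (_∈ D) e (W⊆ w′ p′ u′ d′ i))))) (s≤s d≤)

    Good : List ℕ → ℕ → Set
    Good B m = proj₁ (plan T S B m) ≡ true × proj₁ (proj₂ (plan T S B m)) ≤ suc K

    rooted : ∀ B → Rooted B (proj₁ (discover T B)) (risesFrom T S B)
    rooted B = rises-rooted (discover-grown B)

    gathered-bound : ∀ {b B} → 1 ≤ b → b ≤ suc (γ c) → Outward b B → gathered (risesFrom T S B) ≤ b
    gathered-bound {b} {B} 1≤b b≤ out = gathered-least {risesFrom T S B} 1≤b λ w p u i →
      rise< u (rise-bound b≤ (rooted B) out w p u i)
      where
      rise< : ∀ {w p} u → RiseBound b w p u → u < b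
      rise< zero    _  = 1≤b
      rise< (suc u) rb with rb (s≤s z≤n)
      ... | _ , _ , _ , _ , _ , _ , _ , u≤ , <b = ≤-trans (s≤s u≤) <b

    opaque
      unfolding plan

      good : ∀ {b B m} → b ≤ suc (γ c) → Outward b B → startFrom T S B m ≤ suc (γ c) → Good B m
      good {b} {B} {m} b≤ out ρ≤ = fall-bound b≤ (rooted B) out (rise-bound b≤ (rooted B) out)
        (true , startFrom T S B m , []) refl (≤-trans ρ≤ (s≤s (γ≤K c))) (λ _ _ _ _ ())
        (λ z _ → ≤-trans (≤-reflexive (ready-base _ (toℕ z))) (≤-trans ρ≤ (s≤s (γc≤ z))))

    -- Here `b` is `suc (γ c)`, as every source is at `c` by `γ c`. The absence of ties makes `γ`
    -- strictly larger at all neighbours.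
    vertex-good : (∀ v → Adj c v → γ v ≢ γ c) → Good (toℕ c ∷ []) 0
    vertex-good no-tie = good {m = 0} ≤-refl out (gathered-bound (s≤s z≤n) ≤-refl out)
      where
      out : Outward (suc (γ c)) (toℕ c ∷ [])
      out = record
        { inward = λ { {p} {s = s} (here e) _ _ s∈ _ → s≤s (subst (λ x → ea s p ≤ γ x) (toℕ-injective e) (ea≤γ p s∈)) }
        ; later  = λ { {p} {w} (here e) _ a → subst (λ x → γ x < γ w) (sym (toℕ-injective e))
            (≤∧≢⇒< (γc≤ w) (λ eq → no-tie w (adj-sym (subst (Adj w) (toℕ-injective e) a)) (sym eq))) }
        }

    -- Here `b` is only `γ c`: a source that enters one end from outside still has to cross to the
    -- other end by `γ c`. This strictness leaves room for the crossing itself, at `γ c` in both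
    -- directions, and it also rules out a tie with any further neighbour.
    edge-good : ∀ {a v} → Adj a v → γ a ≡ γ c → γ v ≡ γ c → Good (toℕ a ∷ toℕ v ∷ []) (minAbove T 0 (toℕ a) (toℕ v))
    edge-good {a} {v} adj γa γv = good {m = minAbove T 0 (toℕ a) (toℕ v)} (n≤1+n _) out start≤
      where
      towards : ∀ {x y w s} → Adj x y → γ y ≡ γ c → w ≢ y → s ∈ₛ Src → Via s w x → ea s x < γ c
      towards a γy w≢y s∈ via = ≤-trans (proj₂ (via-last s∈ (via-onward s∈ via a w≢y)))
        (≤-trans (ea≤γ _ s∈) (≤-reflexive γy))
      away : ∀ {x y w} → Adj x y → γ x ≡ γ c → γ y ≡ γ c → w ≢ y → Adj w x → γ x < γ w
      away {x} {y} {w} a γx γy w≢y a′ with via-cases (late x) a′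
      ... | inj₁ via = contradiction (towards a γy w≢y (late∈ x) via) (≤⇒≯ (≤-reflexive (sym γx)))
      ... | inj₂ via = ≤-trans (proj₂ (via-last (late∈ x) via)) (ea≤γ w (late∈ x))
      out : Outward (γ c) (toℕ a ∷ toℕ v ∷ [])
      out = record { inward = inw ; later = lat }
        where
        inw : ∀ {p w s} → toℕ p ∈ toℕ a ∷ toℕ v ∷ [] → toℕ w ∉ toℕ a ∷ toℕ v ∷ [] → Adj w p → s ∈ₛ Src →
          Via s w p → ea s p < γ c
        inw (here e) w∉ _ s∈ via with toℕ-injective e
        ... | refl = towards adj γv (λ { refl → w∉ (there (here refl)) }) s∈ via
        inw (there (here e)) w∉ _ s∈ via with toℕ-injective e
        ... | refl = towards (adj-sym adj) γa (λ { refl → w∉ (here refl) }) s∈ via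
        lat : ∀ {p w} → toℕ p ∈ toℕ a ∷ toℕ v ∷ [] → toℕ w ∉ toℕ a ∷ toℕ v ∷ [] → Adj w p → γ p < γ w
        lat (here e) w∉ a′ with toℕ-injective e
        ... | refl = away adj γa γv (λ { refl → w∉ (there (here refl)) }) a′
        lat (there (here e)) w∉ a′ with toℕ-injective e
        ... | refl = away (adj-sym adj) γv γa (λ { refl → w∉ (here refl) }) a′
      -- The latest source of `v` crosses from `a`; from the side of `v` it would reach `a` only
      -- after `γ v`, which equals `γ a`.
      central-label : HasLabel 𝒢′ a v (γ v)
      central-label with via-cases (late v) adj
      ... | inj₁ via = proj₁ (via-last (late∈ v) via)
      ... | inj₂ via = contradiction
        (≤-trans (proj₂ (via-last (late∈ v) via)) (≤-trans (ea≤γ a (late∈ v)) (≤-reflexive γa)))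
        (≤⇒≯ (≤-reflexive (sym γv)))
      start≤ : startFrom T S (toℕ a ∷ toℕ v ∷ []) (minAbove T 0 (toℕ a) (toℕ v)) ≤ suc (γ c)
      start≤ = start-≤ (minAbove T 0 (toℕ a) (toℕ v)) (≤-trans (proj₂ (first-label central-label)) (≤-reflexive γv))
        (gathered-bound (≤-trans (hasLabel-pos 𝒢′ central-label) (≤-reflexive γv)) (n≤1+n _) out)
        where
        start-≤ : ∀ {g x} m → m ≤ x → g ≤ x → start m g ≤ suc x
        start-≤ zero    _  q = ≤-trans q (n≤1+n _)
        start-≤ (suc m) q′ q = s≤s (mx-lub q′ q)

    -- A tied edge is treated in both orientations because the input may list it in either one only.
    lower : Good (toℕ c ∷ []) 0 ⊎ ∃[ v ] (Adj c v ×
      Good (toℕ c ∷ toℕ v ∷ []) (minAbove T 0 (toℕ c) (toℕ v)) × Good (toℕ v ∷ toℕ c ∷ []) (minAbove T 0 (toℕ v) (toℕ c)))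
    lower with Fin.any? (λ v → T? (Graph.edge (underlying 𝒢) c v) ×-dec (γ v ≟ γ c))
    ... | yes (v , a , e) = inj₂ (v , a , edge-good a refl e , edge-good (adj-sym a) e refl)
    ... | no none         = inj₁ (vertex-good (λ v a e → none (v , a , e)))

-- Optimality

module Optimum (T : List Triple) (S : List ℕ) where

  data Candidate : List ℕ → ℕ → Set where
    origin       : Candidate (0 ∷ []) 0
    left-vertex  : ∀ {a b l} → (a , b , l) ∈ T → Candidate (a ∷ []) 0
    right-vertex : ∀ {a b l} → (a , b , l) ∈ T → Candidate (b ∷ []) 0
    edge         : ∀ {a b l} → (a , b , l) ∈ T → Candidate (a ∷ b ∷ []) (minAbove T 0 a b)

  Sound : Best → Set
  Sound (found , R , out) = found ≡ true → ∃[ B ] ∃[ m ] (Candidate B m × proj₁ (plan T S B m) ≡ true ×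
    R ≡ proj₁ (proj₂ (plan T S B m)) × out ≡ relabel T (startFrom T S B m) (proj₂ (proj₂ (plan T S B m))))

  Beats : Best → Plan → Set
  Beats (found , R , out) (ok , R′ , W) = ok ≡ true → found ≡ true × R ≤ R′

  choose-beats : ∀ ρ π s → Beats (choose T ρ π s) π
  choose-beats ρ (true , R′ , W) (false , R , out) refl = refl , ≤-refl
  choose-beats ρ (true , R′ , W) (true , R , out) refl with suc R′ ≤ᵇ R | ≤ᵇ-reflects-≤ (suc R′) R
  ... | true  | _      = refl , ≤-refl
  ... | false | ofⁿ R≯ = refl , ≮⇒≥ R≯

  choose-improves : ∀ ρ π s π′ → Beats s π′ → Beats (choose T ρ π s) π′
  choose-improves ρ (false , R′ , W) s                  π′ h ok = h ok
  choose-improves ρ (true , R′ , W)  (false , R , out) π′ h ok = contradiction (proj₁ (h ok)) λ ()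
  choose-improves ρ (true , R′ , W)  (true , R , out)  π′ h ok with suc R′ ≤ᵇ R | ≤ᵇ-reflects-≤ (suc R′) R
  ... | true  | ofʸ R′<R = refl , ≤-trans (<⇒≤ R′<R) (proj₂ (h ok))
  ... | false | _        = h ok

  choose-cases : ∀ ρ π s → choose T ρ π s ≡ s ⊎
    (proj₁ π ≡ true × choose T ρ π s ≡ (true , proj₁ (proj₂ π) , relabel T ρ (proj₂ (proj₂ π))))
  choose-cases ρ (false , R′ , W) s                 = inj₁ refl
  choose-cases ρ (true , R′ , W)  (false , R , out) = inj₂ (refl , refl)
  choose-cases ρ (true , R′ , W)  (true , R , out) with suc R′ ≤ᵇ R
  ... | true  = inj₂ (refl , refl)
  ... | false = inj₁ refl

  opaque
    unfolding attempt

    attempt-sound : ∀ {B m} s → Candidate B m → Sound s → Sound (attempt T S B m s)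
    attempt-sound {B} {m} s cand h with choose-cases (startFrom T S B m) (plan T S B m) s
    ... | inj₁ e        = subst Sound (sym e) h
    ... | inj₂ (ok , e) = subst Sound (sym e) (λ _ → B , m , cand , ok , refl , refl)

  Covers : Best → List ℕ → ℕ → Set
  Covers s B m = Beats s (plan T S B m)

  opaque
    unfolding attempt

    attempt-new : ∀ B m s → Covers (attempt T S B m s) B m
    attempt-new B m s = choose-beats (startFrom T S B m) (plan T S B m) s

    attempt-old : ∀ B m s {B′ m′} → Covers s B′ m′ → Covers (attempt T S B m s) B′ m′
    attempt-old B m s {B′} {m′} = choose-improves (startFrom T S B m) (plan T S B m) s (plan T S B′ m′)

  attempts-old : ∀ a b l s {B′ m′} → Covers s B′ m′ → Covers (attempts T S (a , b , l) s) B′ m′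
  attempts-old a b l s {B′} {m′} h =
    attempt-old (a ∷ b ∷ []) (minAbove T 0 a b) (attempt T S (b ∷ []) 0 (attempt T S (a ∷ []) 0 s)) {B′} {m′}
      (attempt-old (b ∷ []) 0 (attempt T S (a ∷ []) 0 s) {B′} {m′} (attempt-old (a ∷ []) 0 s {B′} {m′} h))

  private
    CoversTriple : Best → ℕ → ℕ → Set
    CoversTriple s a b = Covers s (a ∷ []) 0 × Covers s (b ∷ []) 0 × Covers s (a ∷ b ∷ []) (minAbove T 0 a b)

    Inv : List Triple → Best → Set
    Inv rem s = (∀ {e} → e ∈ rem → e ∈ T) × Sound s × Covers s (0 ∷ []) 0 ×
      (∀ a b l → (a , b , l) ∈ T → (a , b , l) ∈ rem ⊎ CoversTriple s a b)

    step : ∀ e rem s → Inv (e ∷ rem) s → Inv rem (attempts T S e s)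
    step (a , b , l) rem s (⊆T , sound , org , all) =
      ⊆T ∘ there ,
      attempt-sound s₂ (edge (⊆T (here refl)))
        (attempt-sound s₁ (right-vertex (⊆T (here refl))) (attempt-sound s (left-vertex (⊆T (here refl))) sound)) ,
      attempts-old a b l s {0 ∷ []} {0} org ,
      all′
      where
      s₁ s₂ : Best
      s₁ = attempt T S (a ∷ []) 0 s
      s₂ = attempt T S (b ∷ []) 0 s₁
      all′ : ∀ a′ b′ l′ → (a′ , b′ , l′) ∈ T → (a′ , b′ , l′) ∈ rem ⊎ CoversTriple (attempts T S (a , b , l) s) a′ b′
      all′ a′ b′ l′ i with all a′ b′ l′ i
      ... | inj₁ (there j)      = inj₁ j
      ... | inj₂ (p , q , r)    = inj₂
        (attempts-old a b l s {a′ ∷ []} {0} p , attempts-old a b l s {b′ ∷ []} {0} q ,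
         attempts-old a b l s {a′ ∷ b′ ∷ []} {minAbove T 0 a′ b′} r)
      ... | inj₁ (here refl)    = inj₂
        (attempt-old (a ∷ b ∷ []) (minAbove T 0 a b) s₂ {a ∷ []} {0}
           (attempt-old (b ∷ []) 0 s₁ {a ∷ []} {0} (attempt-new (a ∷ []) 0 s)) ,
         attempt-old (a ∷ b ∷ []) (minAbove T 0 a b) s₂ {b ∷ []} {0} (attempt-new (b ∷ []) 0 s₁) ,
         attempt-new (a ∷ b ∷ []) (minAbove T 0 a b) s₂)

    opaque
      unfolding best

      inv : Inv [] (best T S)
      inv = iter-ind {f = λ e _ s → attempts T S e s} Inv step T (attempt T S (0 ∷ []) 0 (false , 0 , []))
        (id , attempt-sound (false , 0 , []) origin (λ ()) , attempt-new (0 ∷ []) 0 (false , 0 , []) ,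
         λ _ _ _ → inj₁)

  best-sound : Sound (best T S)
  best-sound = proj₁ (proj₂ inv)

  best-covers : ∀ {B m} → Candidate B m → Covers (best T S) B m
  best-covers origin = proj₁ (proj₂ (proj₂ inv))
  best-covers (left-vertex i)  with proj₂ (proj₂ (proj₂ inv)) _ _ _ i
  ... | inj₂ (p , _ , _) = p
  best-covers (right-vertex i) with proj₂ (proj₂ (proj₂ inv)) _ _ _ i
  ... | inj₂ (_ , q , _) = q
  best-covers (edge i)         with proj₂ (proj₂ (proj₂ inv)) _ _ _ i
  ... | inj₂ (_ , _ , r) = r

module Correct {n} (𝒢 : TemporalGraph n) (tree : IsTree (underlying 𝒢)) (Src : Subset n)
               (T : List Triple) (S : List ℕ) (enc : EncodedLabels 𝒢 T)
               (sources : EncodesSources S Src) (nonempty : ∃[ v ] v ∈ₛ Src) where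
  open Schedules T S
  open Optimum T S
  open EncodedLabels enc
  open Graph (underlying 𝒢) using (Adj) renaming (sym to adj-sym)

  first-vertex : ∃[ z ] (toℕ {n} z ≡ 0)
  first-vertex = first (proj₁ nonempty)
    where
    first : ∀ {n} → Fin n → ∃[ z ] (toℕ {n} z ≡ 0)
    first fzero    = fzero , refl
    first (fsuc _) = fzero , refl

  adj-edge : ∀ {u v} → Adj u v → Edge (toℕ u) (toℕ v)
  adj-edge {u} {v} a with TemporalGraph.⊆⋃E 𝒢 a
  ... | i , a′ = suc (toℕ i) , encode u v _ (i , refl , a′)

  source⇒ : ∀ v → toℕ v ∈ S → v ∈ₛ Src
  source⇒ v i with Equivalence.to (sources (toℕ v)) i
  ... | v′ , e , v′∈ = subst (_∈ₛ Src) (sym (toℕ-injective e)) v′∈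

  source⇐ : ∀ v → v ∈ₛ Src → toℕ v ∈ S
  source⇐ v v∈ = Equivalence.from (sources (toℕ v)) (v , refl , v∈)

  vertex-candidate : ∀ c → Candidate (toℕ c ∷ []) 0
  vertex-candidate c = from (IsTree.connected tree c (proj₁ first-vertex))
    where
    from : Star Adj c (proj₁ first-vertex) → Candidate (toℕ c ∷ []) 0
    from ε       = subst (λ x → Candidate (x ∷ []) 0) (sym (proj₂ first-vertex)) origin
    from (a ◅ _) with adj-edge a
    ... | _ , inj₁ i = left-vertex i
    ... | _ , inj₂ i = right-vertex i

  edge-candidate : ∀ {u v} → Adj u v →
    Candidate (toℕ u ∷ toℕ v ∷ []) (minAbove T 0 (toℕ u) (toℕ v)) ⊎
    Candidate (toℕ v ∷ toℕ u ∷ []) (minAbove T 0 (toℕ v) (toℕ u))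
  edge-candidate a with adj-edge a
  ... | _ , inj₁ i = inj₁ (edge i)
  ... | _ , inj₂ i = inj₂ (edge i)

  -- Infeasibility and optimality both follow from this: a solution within `K` makes some tried
  -- candidate succeed within `K`, and the additional 1 is the one contained in `R`.
  best-below : ∀ 𝒢′ K → IsDelayOf 𝒢 𝒢′ → (∀ v → v ∈ₛ Src → ∀ w → ReachesBy 𝒢′ K v w) →
    proj₁ (best T S) ≡ true × proj₁ (proj₂ (best T S)) ≤ suc K
  best-below 𝒢′ K delay reach = [ (λ g → use {toℕ c ∷ []} {0} (vertex-candidate c) g) , at-edge ]′ lower
    where
    open Bound 𝒢 𝒢′ tree delay Src nonempty K reach
    open Encoded T S enc source⇒
    use : ∀ {B m} → Candidate B m → Good B m → proj₁ (best T S) ≡ true × proj₁ (proj₂ (best T S)) ≤ suc K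
    use cand (ok , R≤) with best-covers cand ok
    ... | found , q = found , ≤-trans q R≤
    at-edge : ∃[ v ] (Adj c v ×
      Good (toℕ c ∷ toℕ v ∷ []) (minAbove T 0 (toℕ c) (toℕ v)) × Good (toℕ v ∷ toℕ c ∷ []) (minAbove T 0 (toℕ v) (toℕ c))) →
      proj₁ (best T S) ≡ true × proj₁ (proj₂ (best T S)) ≤ suc K
    at-edge (v , a , g , g′) with edge-candidate a
    ... | inj₁ cand = use cand g
    ... | inj₂ cand = use cand g′

  -- All that is needed of a base: it is inhabited, and any two distinct vertices of it are the ends
  -- of an edge whose least label is at most `m`, in whichever order they are read.
  record Central (B : List ℕ) (m : ℕ) : Set where
    field
      vertex : ∃[ v ] toℕ {n} v ∈ B
      joined : ∀ {a b : Fin n} → toℕ a ∈ B → toℕ b ∈ B →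
        a ≡ b ⊎ (Edge (toℕ a) (toℕ b) × 1 ≤ m × minAbove T 0 (toℕ a) (toℕ b) ≤ m)

  central : ∀ {B m} → Candidate B m → Central B m
  central origin = record
    { vertex = proj₁ first-vertex , here (proj₂ first-vertex)
    ; joined = λ { (here e) (here e′) → inj₁ (toℕ-injective (trans e (sym e′))) } }
  central (left-vertex i) with decode _ _ _ i
  ... | u , v , refl , refl , h = record
    { vertex = u , here refl
    ; joined = λ { (here e) (here e′) → inj₁ (toℕ-injective (trans e (sym e′))) } }
  central (right-vertex i) with decode _ _ _ i
  ... | u , v , refl , refl , h = record
    { vertex = v , here refl
    ; joined = λ { (here e) (here e′) → inj₁ (toℕ-injective (trans e (sym e′))) } }
  central (edge {l = l} i) with decode _ _ _ i
  ... | u , v , refl , refl , h = record { vertex = u , here refl ; joined = between }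
    where
    m : ℕ
    m = minAbove T 0 (toℕ u) (toℕ v)
    1≤m : 1 ≤ m
    1≤m = proj₁ (minAbove-least (inj₁ i) (hasLabel-pos 𝒢 h))
    between : ∀ {a b} → toℕ a ∈ toℕ u ∷ toℕ v ∷ [] → toℕ b ∈ toℕ u ∷ toℕ v ∷ [] →
      a ≡ b ⊎ (Edge (toℕ a) (toℕ b) × 1 ≤ m × minAbove T 0 (toℕ a) (toℕ b) ≤ m)
    between (here e) (here e′) = inj₁ (toℕ-injective (trans e (sym e′)))
    between (there (here e)) (there (here e′)) = inj₁ (toℕ-injective (trans e (sym e′)))
    between (here e) (there (here e′)) with toℕ-injective e | toℕ-injective e′
    ... | refl | refl = inj₂ ((l , inj₁ i) , 1≤m , ≤-refl)
    between (there (here e)) (here e′) with toℕ-injective e | toℕ-injective e′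
    ... | refl | refl = inj₂ ((l , inj₂ i) , 1≤m ,
      proj₂ (minAbove-least (swap (proj₂ (minAbove-valid 0 (toℕ u) (toℕ v) 1≤m))) 1≤m))

  discover-complete : ∀ {B v} → toℕ v ∈ B → ∀ w → toℕ w ∈ proj₁ (discover T B)
  discover-complete {B} {v} v∈B w = along (grown⊇ (discover-grown B) v∈B) (IsTree.connected tree v w)
    where
    grown⊇ : ∀ {D L z} → Grown B D L → z ∈ B → z ∈ D
    grown⊇ []             i = i
    grown⊇ (grow _ _ _ g) i = there (grown⊇ g i)
    along : ∀ {u w} → toℕ u ∈ proj₁ (discover T B) → Star Adj u w → toℕ w ∈ proj₁ (discover T B)
    along i ε       = i
    along i (a ◅ s) = along (discover-closed B (adj-edge a) i) s

  opaque
    unfolding plan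

    plan-feasible : ∀ B m → proj₁ (plan T S B m) ≡ true →
      Feasible B (gathered (risesFrom T S B)) (startFrom T S B m) (proj₁ (discover T B)) (proj₂ (proj₂ (plan T S B m))) ×
      startFrom T S B m ≤ proj₁ (proj₂ (plan T S B m)) ×
      (∀ w p u d → (w , p , u , d) ∈ proj₂ (proj₂ (plan T S B m)) → d < proj₁ (proj₂ (plan T S B m)))
    plan-feasible B m = falls-feasible {ρ = startFrom T S B m} (rises-rooted (discover-grown B))
      (λ w p u → gathered-above {risesFrom T S B} {w} {p} {u})

  realise : ∀ {B m} → Candidate B m → proj₁ (plan T S B m) ≡ true →
    ∃[ 𝒢′ ] (tmax 𝒢′ ≡ tmax 𝒢 + proj₁ (proj₂ (plan T S B m)) ×
             EncodedLabels 𝒢′ (relabel T (startFrom T S B m) (proj₂ (proj₂ (plan T S B m)))) ×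
             IsDelayOf 𝒢 𝒢′ ×
             (∀ v → v ∈ₛ Src → ∀ w → ReachesBy 𝒢′ (proj₁ (proj₂ (plan T S B m)) ∸ 1) v w))
  realise {B} {m} cand ok with plan-feasible B m ok
  ... | feasible , ρ≤R , <R =
    delayed , refl , delayed-enc , isDelay ,
    λ v v∈ w → source-reaches v w (source⇐ v v∈) (complete v) (complete w)
    where
    open Central (central cand)
    g ρ : ℕ
    g = gathered (risesFrom T S B)
    ρ = startFrom T S B m
    open Realise 𝒢 T S enc feasible (gathered-pos (risesFrom T S B)) (start-above m g) ρ≤R <R
    complete : ∀ w → toℕ w ∈ proj₁ (discover T B)
    complete = discover-complete (proj₂ vertex)
    start-edge : ∀ m g → 1 ≤ m → m ≤ start m g ∸ 1 × g ≤ start m g ∸ 1 × start m g ∸ 1 < start m g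
    start-edge (suc m) g _ = m≤mx (suc m) g , n≤mx (suc m) g , ≤-refl
    base-path : ∀ a b → toℕ a ∈ B → toℕ b ∈ B → PathIn B g ρ a b
    base-path a b a∈ b∈ with joined a∈ b∈
    ... | inj₁ refl = [] , record { walk = [] ; distinct = [] ∷ [] ; increasing = [] } , []
    ... | inj₂ (e , 1≤m , ≤m) with start-edge m g 1≤m
    ...   | m≤ , g≤ , <ρ =
      (ρ ∸ 1 , b) ∷ [] ,
      record
        { walk       = h ∷ []
        ; distinct   = (apart ∷ []) ∷ [] ∷ []
        ; increasing = [-]
        } ,
      (b∈ , g≤ , <ρ) ∷ []
      where
      h : HasLabel delayed a b (ρ ∸ 1)
      h = base-label a∈ b∈ e (≤-trans ≤m m≤)
      apart : a ≢ b
      apart refl = Graph.irrefl (E delayed (proj₁ h)) (proj₂ (proj₂ h))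
    open Connect base-path

  infeasible : proj₁ (best T S) ≡ false → ∀ 𝒢′ → ¬ IsSolution 𝒢 Src 𝒢′
  infeasible none 𝒢′ (delay , reach) with solution-bounded 𝒢′ Src reach
  ... | K , reachBy with best-below 𝒢′ K delay reachBy
  ...   | found , _ = contradiction (trans (sym found) none) λ ()

  optimal : ∀ {R out} → best T S ≡ (true , R , out) →
    ∃[ 𝒢′ ] (tmax 𝒢′ ≡ tmax 𝒢 + R × EncodedLabels 𝒢′ out × IsMinimumSolution 𝒢 Src 𝒢′)
  optimal {R} {out} e with subst Sound e best-sound refl
  ... | B , m , cand , ok , refl , refl with realise cand ok
  ...   | 𝒢′ , tm , enc′ , delay , reachBy with value-exists 𝒢′ Src nonempty reachBy
  ...     | k , value , k≤ =
    𝒢′ , tm , enc′ ,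
    (delay , λ v v∈ w → let steps , path , _ = reachBy v v∈ w in steps , path) ,
    k , value , minimal
    where
    minimal : ∀ 𝒢″ k″ → IsSolution 𝒢 Src 𝒢″ → IsValue 𝒢″ Src k″ → k ≤ k″
    -- The realised value is at most `R ∸ 1`, and the competitor shows that `R` is at most `suc k″`.
    minimal 𝒢″ k″ (delay″ , _) (times , _) = ≤-trans k≤ (∸-monoˡ-≤ 1
      (subst (λ s → proj₁ (proj₂ s) ≤ suc k″) e (proj₂ (best-below 𝒢″ k″ delay″ within))))
      where
      within : ∀ v → v ∈ₛ Src → ∀ w → ReachesBy 𝒢″ k″ v w
      within v v∈ w with times v v∈
      ... | t , (reach , _) , t≤k with reach w
      ...   | steps , path , q = steps , path , ≤-trans q t≤k

-- Correctness on all instances and the running time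

isDelay-refl : ∀ {n} (𝒢 : TemporalGraph n) → IsDelayOf 𝒢 𝒢
isDelay-refl 𝒢 =
  (λ _ _ _ → 0) , (λ _ _ _ → refl) ,
  λ u v j → mk⇔ (λ h → j , h , sym (+-identityʳ j))
                (λ (i , h , e) → subst (HasLabel 𝒢 u v) (sym (trans e (+-identityʳ i))) h)

solve-correct : ∀ I → OnTree I → ∀ x → Problem.Encodes ReachFast x I → Problem.Answers ReachFast (solve x) I
solve-correct I tree ((n , t , T) , []) (graph , sources) =
  𝒢 , graph ,
  (isDelay-refl 𝒢 , (λ v v∈ → contradiction v∈ (empty v))) ,
  0 , ((λ v v∈ → contradiction v∈ (empty v)) , inj₂ ((λ (v , v∈) → empty v v∈) , refl)) , λ _ _ _ _ → z≤n
  where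
  open ReachFastInstance I
  empty : ∀ v → ¬ v ∈ₛ S
  empty v v∈ with Equivalence.from (sources (toℕ v)) (v , refl , v∈)
  ... | ()
solve-correct I tree ((n , t , T) , xs@(x ∷ ys)) ((n≡ , t≡ , decode , encode) , sources) =
  answer (some ys) (best T xs) refl
  where
  open ReachFastInstance I using (𝒢; S)
  some : ∀ (ys : List ℕ) → iter (λ _ _ _ → true) ys true ≡ true
  some []       = refl
  some (_ ∷ ys) = some ys
  labels : EncodedLabels 𝒢 T
  labels = record { decode = decode ; encode = encode }
  nonempty : ∃[ v ] v ∈ₛ S
  nonempty with Equivalence.to (sources x) (here refl)
  ... | v , _ , v∈ = v , v∈
  open Correct 𝒢 tree S T xs labels sources nonempty
  answer : ∀ {b} → b ≡ true → ∀ s → best T xs ≡ s → Problem.Answers ReachFast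
    (if b then (if proj₁ s then inj₂ (n , t + proj₁ (proj₂ s) , proj₂ (proj₂ s)) else inj₁ tt) else inj₂ (n , t , T)) I
  answer refl (false , _)       e = infeasible (cong proj₁ e)
  answer refl (true , R , out) e with optimal e
  ... | 𝒢′ , tm , enc′ , min =
    𝒢′ , (n≡ , trans (cong (_+ R) t≡) (sym tm) , EncodedLabels.decode enc′ , EncodedLabels.encode enc′) , min

length≤size : ∀ τ (xs : ⟦ list τ ⟧) → suc (length xs) ≤ size (list τ) xs
length≤size τ []       = ≤-refl
length≤size τ (x ∷ xs) = s≤s (≤-trans (length≤size τ xs) (m≤n+m _ (size τ x)))

theorem4 : PolynomialTimeOn ReachFast OnTree
theorem4 = compile solve! , height (bound solve!) , degree (bound solve!) , run
  where
  run : ∀ I → OnTree I → ∀ x → Problem.Encodes ReachFast x I → ∃[ y ] ∃[ m ]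
    ((x ∷ [] ⊢ compile solve! ⇓ y ∣ m) ×
     m ≤ height (bound solve!) * size (Problem.input ReachFast) x ^ degree (bound solve!) + height (bound solve!) ×
     Problem.Answers ReachFast y I)
  run I tree x@((n , t , T) , S) enc =
    solve x , cost solve! (x ∷ []) ,
    subst (λ y → x ∷ [] ⊢ compile solve! ⇓ y ∣ cost solve! (x ∷ [])) (den-solve x) (compile-⇓ solve! (x ∷ [])) ,
    within (size (Problem.input ReachFast) x) hT hS ,
    solve-correct I tree x enc
    where
    hT : 2 + length T ≤ size (Problem.input ReachFast) x
    hT = ≤-trans
      (+-mono-≤ {1} {size nat n} (s≤s z≤n)
        (≤-trans (length≤size tripleTy T) (m≤n+m (size (list tripleTy) T) (size nat t))))
      (m≤m+n (size temporalGraphTy (n , t , T)) (size (list nat) S))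
    hS : length S ≤ size (Problem.input ReachFast) x
    hS = ≤-trans (≤-trans (n≤1+n _) (length≤size nat S))
      (m≤n+m (size (list nat) S) (size temporalGraphTy (n , t , T)))
    within : ∀ z → 2 + length T ≤ z → length S ≤ z →
      cost solve! (x ∷ []) ≤ height (bound solve!) * z ^ degree (bound solve!) + height (bound solve!)
    -- The size of the input is positive, as `eval≤` requires.
    within (suc z) hT hS = ≤-trans (cost≤bound solve! (x ∷ []) (short-solve x hT hS))
      (≤-trans (eval≤ (bound solve!) z) (m≤m+n _ _))
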